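{- Fix $q\ge3$ for which graph $q$-colourability is NP-complete, and fix a rational $\vartheta\in(0,1)$. On an always-satisfiable family of balanced occurrence lifts $e$ of instances over the fixed gated $q$-colouring template (with parameter $\vartheta$), it is NP-hard to distinguish $$\mathrm{NCF}(e)=\vartheta\qquad\text{from}\qquad\mathrm{NCF}(e)=1 .$$ Consequently, additive approximation of $\mathrm{NCF}$ or $\mathrm{CF}$ on this family within any error strictly smaller than $\frac{1-\vartheta}2$ is NP-hard.
   Context: Gated $q$-colouring template: two sorts, a gate sort $M=\{0,1\}$ and a colour sort $C=\{1,\dots,q\}$, each with uniform marginal $\pi_M,\pi_C$, and one four-ary relation on $M\times M\times C\times C$: $\widehat{\mathrm{NEQ}}_q(r,z,a,b)\iff(z=r)$ or ($z\ne r$ and $a\neq b$). Its probability table $\widehat\mu^{\,\vartheta}$ puts mass $\vartheta/(2q^2)$ on each tuple with $z=r$ and mass $(1-\vartheta)/(2q(q-1))$ on each tuple with $z\ne r$, $a\ne b$. An instance has finitely many sorted variables, each in some constraint, and finitely many constraints $\widehat{\mathrm{NEQ}}_q(x_1,x_2,x_3,x_4)$ respecting sorts. It is satisfiable if some sort-preserving assignment satisfies all constraints; a family is always-satisfiable if all its instances are satisfiable. Balanced occurrence lift of an instance: observables are one central observable for each variable, and for every constraint $c$ and position $j$ of its scope a fresh observable $x_j^c$, with outcomes in the domain of the corresponding sort. Contexts and tables: for each $c$ the context $(x_1^c,\dots,x_4^c)$ with table $\widehat\mu^{\,\vartheta}$ (zero off the relation); for each $c,j$ the context $(x_j,x_j^c)$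 with table $(a,b)\mapsto\pi(a)$ if $a=b$ and $0$ otherwise, $\pi$ the uniform distribution on that sort. For a finite empirical model $e$ with tables $e_C$, $\mathrm{NCF}(e)=\max\{\sum_g b_g:\ \sum_{g:\,g|_C=u}b_g\le e_C(u)\text{ for all contexts }C\text{ and local outcomes }u,\ b_g\ge0\}$, where $g$ ranges over all global assignments of outcomes to observables; $\mathrm{CF}(e)=1-\mathrm{NCF}(e)$. -}

module Defs where

open import Data.Bool.Base using (if_then_else_)
open import Data.Empty using (⊥)
open import Data.Fin.Base using (Fin; zero; suc; toℕ; _↑ˡ_; _↑ʳ_; combine)
open import Data.Integer.Base as ℤ using (ℤ)
open import Data.List.Base as List using (List; []; _∷_)
open import Data.List.Relation.Unary.All using (All)
open import Data.Nat.Base using (ℕ; zero; suc; _+_; _*_; _^_; _∸_; _≤_; _≡ᵇ_)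
open import Data.Nat.Logarithm using (⌊log₂_⌋)
import Data.Nat.Properties as ℕ
open import Data.Product.Base using (Σ; ∃; ∃-syntax; _×_; _,_)
open import Data.Rational.Base as ℚ using (ℚ; 0ℚ; 1ℚ)
open import Data.Sum.Base using (_⊎_)
open import Data.Unit.Base using (⊤)
open import Data.Vec.Base as Vec using (Vec; []; _∷_)
import Data.Vec.Properties as Vec
open import Relation.Binary.PropositionalEquality.Core using (_≡_; _≢_)
open import Relation.Nullary.Negation.Core using (¬_)

-- The machine model is a one-variable WHILE language on binary trees with
-- natural numbers at the leaves.  Numbers have their bit length as size, and
-- every primitive step is charged the sizes of its argument and its result
-- (logarithmic cost).  Since the only arithmetic is + and ∸, a computation of
-- cost t is simulated by a multi-tape Turing machine in time polynomial in t;
-- conversely a Turing machine step is a bounded number of primitives acting on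
-- the current configuration.  So "polynomial time" has its usual meaning.

data Data : Set where
  nat  : ℕ → Data
  pair : Data → Data → Data

size : Data → ℕ
size (nat n)    = 1 + ⌊log₂ n ⌋
size (pair x y) = 1 + size x + size y

data Prim : Set where
  identity first second isNat add sub : Prim
  const : Data → Prim

-- Primitives are total; an argument of the wrong shape gives nat 0.
applyPrim : Prim → Data → Data
applyPrim identity  x                      = x
applyPrim first     (pair x y)             = x
applyPrim first     (nat _)                = nat 0
applyPrim second    (pair x y)             = y
applyPrim second    (nat _)                = nat 0
applyPrim isNat     (nat _)                = nat 1
applyPrim isNat     (pair _ _)             = nat 0
applyPrim add       (pair (nat m) (nat n)) = nat (m + n)
applyPrim add       _                      = nat 0
applyPrim sub       (pair (nat m) (nat n)) = nat (m ∸ n)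
applyPrim sub       _                      = nat 0
applyPrim (const d) _                      = d

-- Q names the available oracles: Prog ⊥ are the oracle-free programs and
-- Prog ⊤ the programs with a single oracle.
data Prog (Q : Set) : Set where
  prim           : Prim → Prog Q
  query          : Q → Prog Q
  _then_         : Prog Q → Prog Q → Prog Q
  ⟪_,_⟫          : Prog Q → Prog Q → Prog Q
  branch_yes_no_ : Prog Q → Prog Q → Prog Q → Prog Q
  while_loop_    : Prog Q → Prog Q → Prog Q

-- O ⊢ p ▷ x ⇓ y [ t ]: with oracle O, program p run on x halts with value y
-- at cost t.  A test succeeds when its value differs from nat 0.
data _⊢_▷_⇓_[_] {Q : Set} (O : Q → Data → Data) :
       Prog Q → Data → Data → ℕ → Set where

  prim : ∀ {f x} →
    O ⊢ prim f ▷ x ⇓ applyPrim f x [ size x + size (applyPrim f x) ]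

  query : ∀ {a x} →
    O ⊢ query a ▷ x ⇓ O a x [ size x + size (O a x) ]

  _then_ : ∀ {p r x y z s t} →
    O ⊢ p ▷ x ⇓ y [ s ] →
    O ⊢ r ▷ y ⇓ z [ t ] →
    O ⊢ p then r ▷ x ⇓ z [ s + t ]

  ⟪_,_⟫ : ∀ {p r x y z s t} →
    O ⊢ p ▷ x ⇓ y [ s ] →
    O ⊢ r ▷ x ⇓ z [ t ] →
    O ⊢ ⟪ p , r ⟫ ▷ x ⇓ pair y z [ 1 + s + t ]

  if-true : ∀ {b p r x v y s t} →
    O ⊢ b ▷ x ⇓ v [ s ] → v ≢ nat 0 →
    O ⊢ p ▷ x ⇓ y [ t ] →
    O ⊢ branch b yes p no r ▷ x ⇓ y [ s + t ]

  if-false : ∀ {b p r x y s t} →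
    O ⊢ b ▷ x ⇓ nat 0 [ s ] →
    O ⊢ r ▷ x ⇓ y [ t ] →
    O ⊢ branch b yes p no r ▷ x ⇓ y [ s + t ]

  while-true : ∀ {b p x v y z s t u} →
    O ⊢ b ▷ x ⇓ v [ s ] → v ≢ nat 0 →
    O ⊢ p ▷ x ⇓ y [ t ] →
    O ⊢ while b loop p ▷ y ⇓ z [ u ] →
    O ⊢ while b loop p ▷ x ⇓ z [ s + t + u ]

  while-false : ∀ {b p x s} →
    O ⊢ b ▷ x ⇓ nat 0 [ s ] →
    O ⊢ while b loop p ▷ x ⇓ x [ s ]

-- All sizes are at least 1, so every polynomial in size x is bounded by one of
-- the form c * size x ^ k.
HaltsInPolyTime : {Q : Set} → (Q → Data → Data) → Prog Q → (Data → Data) → Set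
HaltsInPolyTime O p f =
  ∃[ c ] ∃[ k ] ∀ x → ∃[ t ] (O ⊢ p ▷ x ⇓ f x [ t ] × t ≤ c * size x ^ k)

noOracle : ⊥ → Data → Data
noOracle ()

PolyTime : (Data → Data) → Set
PolyTime f = Σ (Prog ⊥) λ p → HaltsInPolyTime noOracle p f

PolyTimeWith : Prog ⊤ → (Data → Data) → (Data → Data) → Set
PolyTimeWith p O f = HaltsInPolyTime (λ _ → O) p f

PolyBounded : (Data → Data) → Set
PolyBounded O = ∃[ c ] ∃[ k ] ∀ x → size (O x) ≤ c * size x ^ k

Language : Set₁
Language = Data → Set

NP : Language → Set
NP L = Σ (Data → Data) λ verify → PolyTime verify ×
  (∃[ c ] ∃[ k ] ∀ x →
     (L x → ∃[ w ] (size w ≤ c * size x ^ k × verify (pair x w) ≡ nat 1)) ×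
     (∀ w → size w ≤ c * size x ^ k → verify (pair x w) ≡ nat 1 → L x))

record PromiseProblem : Set₁ where
  field
    Inst   : Set
    encode : Inst → Data
    Yes No : Inst → Set

decisionProblem : (A : Set) → (A → Data) → (A → Set) → PromiseProblem
decisionProblem A enc Y = record
  { Inst = A ; encode = enc ; Yes = Y ; No = λ a → ¬ Y a }

-- Polynomial-time many-one reductions.  They send every input to the encoding
-- of some instance.
_≤ₘ_ : Language → PromiseProblem → Set
L ≤ₘ P = Σ (Data → Data) λ f → PolyTime f ×
  (∀ x → ∃[ i ] (f x ≡ encode i × (L x → Yes i) × (¬ L x → No i)))
  where open PromiseProblem P

NPHard : PromiseProblem → Set₁
NPHard P = ∀ L → NP L → L ≤ₘ P

yesLanguage : PromiseProblem → Language
yesLanguage P x = ∃[ i ] (x ≡ encode i × Yes i)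
  where open PromiseProblem P

NPComplete : PromiseProblem → Set₁
NPComplete P = NP (yesLanguage P) × NPHard P

-- A computational problem whose instances may have many acceptable answers.
record SearchProblem : Set₁ where
  field
    Inst       : Set
    encode     : Inst → Data
    Acceptable : Inst → Data → Set

Solves : (Data → Data) → SearchProblem → Set
Solves O S = ∀ i → Acceptable i (O (encode i))
  where open SearchProblem S

-- Polynomial-time Turing reductions: one oracle program decides L whichever
-- solver of the search problem, with answers of polynomial length, is supplied.
_≤ₜ_ : Language → SearchProblem → Set
L ≤ₜ S = Σ (Prog ⊤) λ p → ∀ O → Solves O S → PolyBounded O →
  Σ (Data → Data) λ f → PolyTimeWith p O f ×
  (∀ x → (L x → f x ≡ nat 1) × (¬ L x → f x ≡ nat 0))

NPHardSearch : SearchProblem → Set₁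
NPHardSearch S = ∀ L → NP L → L ≤ₜ S

encodeList : {A : Set} → (A → Data) → List A → Data
encodeList enc []       = nat 0
encodeList enc (a ∷ as) = pair (enc a) (encodeList enc as)

encodeFin : ∀ {n} → Fin n → Data
encodeFin i = nat (toℕ i)

encodeℤ : ℤ → Data
encodeℤ (ℤ.+ n)      = pair (nat 0) (nat n)
encodeℤ (ℤ.-[1+ n ]) = pair (nat 1) (nat (suc n))

encodeℚ : ℚ → Data
encodeℚ p = pair (encodeℤ (ℚ.↥ p)) (nat (ℚ.↧ₙ p))

-- Finite simple graphs.  An edge may be listed in either orientation, and
-- repetitions in the list are immaterial.
record Graph : Set where
  field
    order    : ℕ
    edges    : List (Fin order × Fin order)
    loopless : All (λ (u , v) → u ≢ v) edges

Colourable : ℕ → Graph → Set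
Colourable q G = Σ (Fin order → Fin q) λ f → All (λ (u , v) → f u ≢ f v) edges
  where open Graph G

-- The vertex set is written out in full, so the size of an encoding is at
-- least the number of vertices.
encodeGraph : Graph → Data
encodeGraph G = pair (encodeList encodeFin (List.allFin order))
                     (encodeList (λ (u , v) → pair (encodeFin u) (encodeFin v)) edges)
  where open Graph G

Colourability : ℕ → PromiseProblem
Colourability q = decisionProblem Graph encodeGraph (Colourable q)

∑ : {A : Set} → (A → ℚ) → List A → ℚ
∑ f as = List.foldr ℚ._+_ 0ℚ (List.map f as)

-- Observable i has the outcomes 0, …, lookup outcomes i ∸ 1.  A table is only
-- ever consulted at tuples of outcomes of the observables in its scope.
record Context {n : ℕ} (outcomes : Vec ℕ n) : Set where
  constructor context
  field
    {arity} : ℕ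
    scope   : Vec (Fin n) arity
    table   : Vec ℕ arity → ℚ

-- Normalisation and compatibility of the tables play no role in the definition
-- of NCF and are not recorded.
record EmpiricalModel : Set where
  field
    {observables} : ℕ
    outcomes      : Vec ℕ observables
    contexts      : List (Context outcomes)

-- All tuples with i-th entry below the i-th bound, in lexicographic order.
tuples : ∀ {n} → Vec ℕ n → List (Vec ℕ n)
tuples []       = [] ∷ []
tuples (d ∷ ds) = List.cartesianProductWith _∷_ (List.upTo d) (tuples ds)

module _ (e : EmpiricalModel) where
  open EmpiricalModel e

  globalAssignments : List (Vec ℕ observables)
  globalAssignments = tuples outcomes

  localOutcomes : (C : Context outcomes) → List (Vec ℕ (Context.arity C))
  localOutcomes C = tuples (Vec.map (Vec.lookup outcomes) (Context.scope C))

  restrict : Vec ℕ observables → (C : Context outcomes) → Vec ℕ (Context.arity C)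
  restrict g C = Vec.map (Vec.lookup g) (Context.scope C)

  marginal : (Vec ℕ observables → ℚ) →
             (C : Context outcomes) → Vec ℕ (Context.arity C) → ℚ
  marginal b C u =
    ∑ b (List.filter (λ g → Vec.≡-dec ℕ._≟_ (restrict g C) u) globalAssignments)

  Feasible : (Vec ℕ observables → ℚ) → Set
  Feasible b =
    All (λ g → 0ℚ ℚ.≤ b g) globalAssignments ×
    All (λ C → All (λ u → marginal b C u ℚ.≤ Context.table C u) (localOutcomes C))
        contexts

  weight : (Vec ℕ observables → ℚ) → ℚ
  weight b = ∑ b globalAssignments

  -- "v is the maximum defining NCF".  The linear program has rational data, so
  -- its optimum over the reals is attained at a rational point.
  NCF : ℚ → Set
  NCF v = (∃[ b ] (Feasible b × weight b ≡ v)) × (∀ b → Feasible b → weight b ℚ.≤ v)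

  CF : ℚ → Set
  CF v = ∃[ w ] (NCF w × v ≡ 1ℚ ℚ.- w)

  encodeContext : Context outcomes → Data
  encodeContext C =
    pair (encodeList encodeFin (Vec.toList (Context.scope C)))
         (encodeList (λ u → encodeℚ (Context.table C u)) (localOutcomes C))

  encodeModel : Data
  encodeModel = pair (encodeList nat (Vec.toList outcomes))
                     (encodeList encodeContext contexts)

NEQ : ∀ {q} → Fin 2 → Fin 2 → Fin q → Fin q → Set
NEQ r z a b = z ≡ r ⊎ (z ≢ r × a ≢ b)

record Scope (gates colours : ℕ) : Set where
  constructor scope
  field
    x₁ x₂ : Fin gates
    x₃ x₄ : Fin colours

record Instance : Set where
  field
    gates colours #constraints : ℕ
    constraints : Vec (Scope gates colours) #constraints
    gateOccurs : ∀ x → ∃[ c ] let s = Vec.lookup constraints c in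
                   Scope.x₁ s ≡ x ⊎ Scope.x₂ s ≡ x
    colourOccurs : ∀ x → ∃[ c ] let s = Vec.lookup constraints c in
                   Scope.x₃ s ≡ x ⊎ Scope.x₄ s ≡ x

Satisfiable : ℕ → Instance → Set
Satisfiable q I =
  Σ (Fin gates → Fin 2) λ α → Σ (Fin colours → Fin q) λ β →
  ∀ c → let s = Vec.lookup constraints c in
    NEQ (α (Scope.x₁ s)) (α (Scope.x₂ s)) (β (Scope.x₃ s)) (β (Scope.x₄ s))
  where open Instance I

AlwaysSatisfiable : ℕ → (Instance → Set) → Set
AlwaysSatisfiable q F = ∀ I → F I → Satisfiable q I

-- Reciprocal, with the irrelevant value 0 at 0.
recip : ℕ → ℚ
recip zero    = 0ℚ
recip (suc n) = ℤ.+ 1 ℚ./ suc n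

module Lift (q : ℕ) (ϑ : ℚ) where

  μ̂ : Vec ℕ 4 → ℚ
  μ̂ (r ∷ z ∷ a ∷ b ∷ []) =
    if z ≡ᵇ r then ϑ ℚ.* recip (2 * q ^ 2)
    else if a ≡ᵇ b then 0ℚ
    else (1ℚ ℚ.- ϑ) ℚ.* recip (2 * q * (q ∸ 1))

  diagonal : ℕ → Vec ℕ 2 → ℚ
  diagonal d (a ∷ b ∷ []) = if a ≡ᵇ b then recip d else 0ℚ

  -- The observables are ordered as: central gates, central colours, and then,
  -- constraint by constraint, the four fresh copies.
  lift : Instance → EmpiricalModel
  lift I = record
    { outcomes = outs
    ; contexts = List.concat (List.map contextsOf (List.allFin #constraints))
    }
    where
    open Instance I

    copies : ℕ
    copies = #constraints * 4

    outs : Vec ℕ (gates + (colours + copies))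
    outs = Vec.replicate gates 2 Vec.++ (Vec.replicate colours q Vec.++
           Vec.concat (Vec.replicate #constraints (2 ∷ 2 ∷ q ∷ q ∷ [])))

    gate : Fin gates → Fin (gates + (colours + copies))
    gate x = x ↑ˡ (colours + copies)

    colour : Fin colours → Fin (gates + (colours + copies))
    colour x = gates ↑ʳ (x ↑ˡ copies)

    copy : Fin #constraints → Fin 4 → Fin (gates + (colours + copies))
    copy c j = gates ↑ʳ (colours ↑ʳ combine c j)

    contextsOf : Fin #constraints → List (Context outs)
    contextsOf c =
      context (copy c j₁ ∷ copy c j₂ ∷ copy c j₃ ∷ copy c j₄ ∷ []) μ̂ ∷
      context (gate   x₁ ∷ copy c j₁ ∷ []) (diagonal 2) ∷
      context (gate   x₂ ∷ copy c j₂ ∷ []) (diagonal 2) ∷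
      context (colour x₃ ∷ copy c j₃ ∷ []) (diagonal q) ∷
      context (colour x₄ ∷ copy c j₄ ∷ []) (diagonal q) ∷ []
      where
      open Scope (Vec.lookup constraints c)
      j₁ j₂ j₃ j₄ : Fin 4
      j₁ = zero
      j₂ = suc zero
      j₃ = suc (suc zero)
      j₄ = suc (suc (suc zero))

open Lift public using (lift)

-- The input of each problem is the empirical model itself, tables included.

DistinguishNCF : (q : ℕ) (ϑ : ℚ) → (Instance → Set) → PromiseProblem
DistinguishNCF q ϑ F = record
  { Inst   = ∃ F
  ; encode = λ (I , _) → encodeModel (lift q ϑ I)
  ; Yes    = λ (I , _) → NCF (lift q ϑ I) 1ℚ
  ; No     = λ (I , _) → NCF (lift q ϑ I) ϑ
  }

-- The answer must be a rational within ε of the value of Quantity (NCF or CF).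
-- A model without contexts has no such value (the program is unbounded), and
-- then every rational is accepted.
Approximate : (EmpiricalModel → ℚ → Set) → ℚ →
              (q : ℕ) (ϑ : ℚ) → (Instance → Set) → SearchProblem
Approximate Quantity ε q ϑ F = record
  { Inst       = ∃ F
  ; encode     = λ (I , _) → encodeModel (lift q ϑ I)
  ; Acceptable = λ (I , _) y →
      ∃[ r ] (y ≡ encodeℚ r ×
              (∀ v → Quantity (lift q ϑ I) v → ℚ.∣ r ℚ.- v ∣ ℚ.≤ ε))
  }

{-# OPTIONS --safe #-}
-- The reduction sends a graph G to the gated instance whose constraints are the
-- edges of G (with a pendant edge at every vertex, so that no vertex is lost),
-- all guarded by one common pair of gates r, z.
--
-- In the lift, every global assignment of positive weight copies its central
-- values, so if z ≠ r on it then its colours properly colour G.  Hence without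
-- a proper colouring only the mass ϑ of the tuples with z = r can be explained.
-- That much is always explained by equal gates and independent uniform colours.
-- A proper colouring f explains the remaining 1 - ϑ: take opposite gates and the
-- colouring σ ∘ f for a uniformly random permutation σ of the colours, since
-- (σ i , σ j) is uniform on the pairs of distinct colours whenever i ≠ j.
--
-- Approximation within less than half of 1 - ϑ separates the two values by one
-- comparison with their midpoint.
module Submission where

open import Defs
open import Algebra.Bundles using (CommutativeRing)
open import Data.Bool.Base using (Bool; true; false; _∧_; if_then_else_; T)
open import Data.Empty using (⊥; ⊥-elim)
open import Data.Fin.Base using (Fin; zero; suc; toℕ; fromℕ<; opposite; punchIn; splitAt; _↑ˡ_; _↑ʳ_; combine)
import Data.Fin.Properties as Fin
import Data.Integer.Base as ℤ
import Data.Integer.Properties as ℤ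
open import Data.List.Base as List using (List; []; _∷_)
open import Data.List.Membership.Propositional using (_∈_)
import Data.List.Membership.Propositional.Properties as ∈
import Data.List.Properties as List
open import Data.List.Relation.Unary.All as All using (All; []; _∷_)
import Data.List.Relation.Unary.All.Properties as All
open import Data.List.Relation.Unary.AllPairs using ([]; _∷_)
open import Data.List.Relation.Unary.Any using (here; there; index)
import Data.List.Relation.Unary.Any.Properties as Any
open import Data.List.Relation.Unary.Unique.Propositional using (Unique)
import Data.List.Relation.Unary.Unique.Propositional.Properties as Unique
open import Data.Nat.Base as ℕ using (ℕ; zero; suc; _+_; _*_; _^_; _∸_; _≤_; _<_; z≤n; s≤s; _≡ᵇ_; NonZero; >-nonZero)
open import Data.Nat.Coprimality using (Coprime)
open import Data.Nat.GeneralisedArithmetic using (fold)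
open import Data.Nat.Logarithm using (⌊log₂_⌋; ⌊log₂⌋-mono-≤; ⌊log₂[2*b]⌋≡1+⌊log₂b⌋)
import Data.Nat.Properties as ℕ
open import Data.Nat.Tactic.RingSolver using (solve-∀)
open import Data.Product.Base using (Σ; ∃-syntax; _×_; _,_; proj₁; proj₂)
open import Data.Rational.Base as ℚ using (ℚ; mkℚ; 0ℚ; 1ℚ; ½)
import Data.Rational.Properties as ℚ
open import Data.Rational.Solver using (module +-*-Solver)
import Data.Rational.Unnormalised.Base as ℚᵘ
import Data.Rational.Unnormalised.Properties as ℚᵘ
open import Data.Sum.Base using (_⊎_; inj₁; inj₂; [_,_]′)
open import Data.Unit.Base using (⊤; tt)
open import Data.Vec.Base as Vec using (Vec; []; _∷_)
import Data.Vec.Functional as Vector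
import Data.Vec.Properties as Vec
open import Data.Vec.Relation.Binary.Pointwise.Inductive as Pointwise using (Pointwise; []; _∷_)
open import Function.Base using (_∘_)
open import Relation.Binary.Definitions using (DecidableEquality)
open import Relation.Binary.PropositionalEquality
  using (_≡_; _≢_; refl; sym; trans; cong; cong₂; subst; subst₂; module ≡-Reasoning)
open import Relation.Nullary.Decidable.Core using (does; yes; no)
open import Relation.Nullary.Negation.Core using (¬_)
open import Relation.Unary using (Decidable)

open import Algebra.Properties.Semiring.Sum (CommutativeRing.semiring ℚ.+-*-commutativeRing)
  using (sum; sum-remove; ∑-comm; ∑-distrib-+; *-distribˡ-sum; sum-cong-≗)

-- Polynomial time

-- The input of the hard problem is the model with its tables written out, so the reduction has to
-- produce `encodeModel` of the lift symbol for symbol. All its loops are of one kind, a pass over a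
-- list that pushes a bounded amount onto an accumulator. One potential argument then makes them all
-- polynomial; the price is that lists come out reversed and observables are numbered downwards. The
-- common pair of gates is what gives the upper bound ϑ. With separate gates an assignment could
-- make the gates unequal at a few constraints only and be properly coloured just there. With common
-- gates it has to colour the whole graph as soon as the gates differ, so the table of one
-- constraint already caps the weight. For the lower bounds, the tables test only one central
-- variable or one scope at a time. Hence just the one-point and two-point laws of random functions
-- and permutations matter, and `μ̂` is exactly ϑ times the scope law at equal gates plus 1 - ϑ
-- times the one at opposite gates. Colourability is never decided: each value of NCF is derived
-- from its own hypothesis, as the form of the reductions asks.

-- The bound is asked only for s ≥ 1: there s ^ k is monotone in k, so that two monomials merge into
-- one, and every size is at least 1.
Dominated : (ℕ → ℕ) → Set
Dominated B = ∃[ c ] ∃[ k ] ∀ s → 1 ≤ s → B s ≤ c * s ^ k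

monomial-mono : ∀ c k {s t} → s ≤ t → c * s ^ k ≤ c * t ^ k
monomial-mono c k s≤t = ℕ.*-monoʳ-≤ c (ℕ.^-monoˡ-≤ k s≤t)

dominated-const : ∀ n → Dominated (λ _ → n)
dominated-const n = n , 0 , λ s _ → ℕ.≤-reflexive (sym (ℕ.*-identityʳ n))

dominated-id : Dominated (λ s → s)
dominated-id = 1 , 1 , λ s _ → ℕ.≤-reflexive (sym (trans (ℕ.*-identityˡ _) (ℕ.^-identityʳ s)))

dominated-+ : ∀ {A B} → Dominated A → Dominated B → Dominated (λ s → A s + B s)
dominated-+ {A} {B} (c , k , f) (d , l , g) = c + d , k + l , bound
  where
  bound : ∀ s → 1 ≤ s → A s + B s ≤ (c + d) * s ^ (k + l)
  bound s@(suc _) s≥1 = ℕ.≤-trans (ℕ.+-mono-≤ (f s s≥1) (g s s≥1)) (ℕ.≤-trans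
    (ℕ.+-mono-≤ (ℕ.*-monoʳ-≤ c (ℕ.^-monoʳ-≤ s (ℕ.m≤m+n k l)))
                (ℕ.*-monoʳ-≤ d (ℕ.^-monoʳ-≤ s (ℕ.m≤n+m l k))))
    (ℕ.≤-reflexive (sym (ℕ.*-distribʳ-+ (s ^ (k + l)) c d))))

dominated-* : ∀ {A B} → Dominated A → Dominated B → Dominated (λ s → A s * B s)
dominated-* {A} {B} (c , k , f) (d , l , g) = c * d , k + l , λ s s≥1 →
  ℕ.≤-trans (ℕ.*-mono-≤ (f s s≥1) (g s s≥1)) (ℕ.≤-reflexive (trans
    (rearrange c d (s ^ k) (s ^ l)) (cong (c * d *_) (sym (ℕ.^-distribˡ-+-* s k l)))))
  where
  rearrange : ∀ c d x y → c * x * (d * y) ≡ c * d * (x * y)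
  rearrange = solve-∀

dominated-^ : ∀ {A} k → Dominated A → Dominated (λ s → A s ^ k)
dominated-^ zero    _ = dominated-const 1
dominated-^ (suc k) h = dominated-* h (dominated-^ k h)

dominated-monomial : ∀ {A} c k → Dominated A → Dominated (λ s → c * A s ^ k)
dominated-monomial c k h = dominated-* (dominated-const c) (dominated-^ k h)

-- Sizes of values and costs of runs

size-positive : ∀ x → 1 ≤ size x
size-positive (nat _)    = s≤s z≤n
size-positive (pair _ _) = s≤s z≤n

size-first : ∀ x → size (applyPrim first x) ≤ size x
size-first (nat _)    = s≤s z≤n
size-first (pair x y) = ℕ.m≤n⇒m≤1+n (ℕ.m≤m+n (size x) (size y))

size-second : ∀ x → size (applyPrim second x) ≤ size x
size-second (nat _)    = s≤s z≤n
size-second (pair x y) = ℕ.m≤n⇒m≤1+n (ℕ.m≤n+m (size y) (size x))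

-- The sum is at most twice the larger summand, and doubling a positive number adds one to its
-- logarithm.
⌊log₂⌋-+ : ∀ m n → ⌊log₂ (m + n) ⌋ ≤ suc (⌊log₂ m ⌋ + ⌊log₂ n ⌋)
⌊log₂⌋-+ zero n = ℕ.m≤n⇒m≤1+n ℕ.≤-refl
⌊log₂⌋-+ m@(suc _) n with ℕ.≤-total m n
... | inj₁ m≤n = ℕ.≤-trans (⌊log₂⌋-mono-≤ (ℕ.+-mono-≤ m≤n (ℕ.m≤m+n n 0)))
        (ℕ.≤-trans (ℕ.≤-reflexive (⌊log₂[2*b]⌋≡1+⌊log₂b⌋ n {{>-nonZero (ℕ.≤-trans (s≤s z≤n) m≤n)}}))
                   (s≤s (ℕ.m≤n+m ⌊log₂ n ⌋ ⌊log₂ m ⌋)))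
... | inj₂ n≤m = ℕ.≤-trans (⌊log₂⌋-mono-≤ (ℕ.+-monoʳ-≤ m (ℕ.≤-trans n≤m (ℕ.m≤m+n m 0))))
        (ℕ.≤-trans (ℕ.≤-reflexive (⌊log₂[2*b]⌋≡1+⌊log₂b⌋ m))
                   (s≤s (ℕ.m≤m+n ⌊log₂ m ⌋ ⌊log₂ n ⌋)))

size-add : ∀ x y → size (applyPrim add (pair x y)) ≤ size x + size y
size-add (nat m) (nat n)      = s≤s (ℕ.≤-trans (⌊log₂⌋-+ m n) (ℕ.≤-reflexive (sym (ℕ.+-suc ⌊log₂ m ⌋ ⌊log₂ n ⌋))))
size-add (nat m) (pair _ _)   = s≤s z≤n
size-add (pair _ _) (nat _)    = s≤s z≤n
size-add (pair _ _) (pair _ _) = s≤s z≤n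

size-sub : ∀ x y → size (applyPrim sub (pair x y)) ≤ size x
size-sub (nat m) (nat n)       = s≤s (⌊log₂⌋-mono-≤ (ℕ.m∸n≤m m n))
size-sub (nat m) (pair _ _)    = s≤s z≤n
size-sub (pair _ _) (nat _)    = s≤s z≤n
size-sub (pair _ _) (pair _ _) = s≤s z≤n

module _ {Q : Set} {O : Q → Data → Data} where

  -- Serves the loop that exits at once: it returns its input and is charged only for the test,
  -- which has already paid for reading that input.
  input≤cost : ∀ {p x y t} → O ⊢ p ▷ x ⇓ y [ t ] → size x ≤ t
  input≤cost prim              = ℕ.m≤m+n _ _
  input≤cost query             = ℕ.m≤m+n _ _
  input≤cost (d then e)        = ℕ.≤-trans (input≤cost d) (ℕ.m≤m+n _ _)
  input≤cost ⟪ d , e ⟫         = ℕ.≤-trans (input≤cost d) (ℕ.m≤n⇒m≤1+n (ℕ.m≤m+n _ _))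
  input≤cost (if-true d _ e)   = ℕ.≤-trans (input≤cost d) (ℕ.m≤m+n _ _)
  input≤cost (if-false d e)    = ℕ.≤-trans (input≤cost d) (ℕ.m≤m+n _ _)
  input≤cost (while-true {s = s} {t} {u} d _ e f) =
    ℕ.≤-trans (input≤cost d) (ℕ.≤-trans (ℕ.m≤m+n s t) (ℕ.m≤m+n (s + t) u))
  input≤cost (while-false d)   = input≤cost d

  -- Every step pays for its result. In a composition this bounds the intermediate value by the time
  -- spent on it, hence the running time of the second program.
  output≤cost : ∀ {p x y t} → O ⊢ p ▷ x ⇓ y [ t ] → size y ≤ t
  output≤cost prim              = ℕ.m≤n+m _ _
  output≤cost query             = ℕ.m≤n+m _ _
  output≤cost (d then e)        = ℕ.≤-trans (output≤cost e) (ℕ.m≤n+m _ _)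
  output≤cost ⟪ d , e ⟫         = s≤s (ℕ.+-mono-≤ (output≤cost d) (output≤cost e))
  output≤cost (if-true d _ e)   = ℕ.≤-trans (output≤cost e) (ℕ.m≤n+m _ _)
  output≤cost (if-false d e)    = ℕ.≤-trans (output≤cost e) (ℕ.m≤n+m _ _)
  output≤cost (while-true d _ e f) = ℕ.≤-trans (output≤cost f) (ℕ.m≤n+m _ _)
  output≤cost (while-false d)   = input≤cost d

  halts : ∀ {p f} B → Dominated B →
          (∀ x → ∃[ t ] (O ⊢ p ▷ x ⇓ f x [ t ] × t ≤ B (size x))) → HaltsInPolyTime O p f
  halts B (c , k , dom) run = c , k , λ x → let t , d , t≤ = run x in
    t , d , ℕ.≤-trans t≤ (dom (size x) (size-positive x))

  halts-query : ∀ a → PolyBounded (O a) → HaltsInPolyTime O (query a) (O a)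
  halts-query a (c , k , bound) =
    halts (λ s → s + c * s ^ k) (dominated-+ dominated-id (dominated-monomial c k dominated-id))
      λ x → _ , query , ℕ.+-monoʳ-≤ (size x) (bound x)

  halts-prim : ∀ g {b} → (∀ x → size (applyPrim g x) ≤ b + size x) → HaltsInPolyTime O (prim g) (applyPrim g)
  halts-prim g {b} bound =
    halts (λ s → s + (b + s)) (dominated-+ dominated-id (dominated-+ (dominated-const b) dominated-id))
      λ x → _ , prim , ℕ.+-monoʳ-≤ (size x) (bound x)

  -- Only the values of f matter for r, so r need not halt quickly elsewhere.
  halts-then-on : ∀ {p r f h} (c k : ℕ) → HaltsInPolyTime O p f →
    (∀ x → ∃[ t ] (O ⊢ r ▷ f x ⇓ h x [ t ] × t ≤ c * size (f x) ^ k)) → HaltsInPolyTime O (p then r) h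
  halts-then-on {f = f} c k (c₁ , k₁ , run₁) run =
    halts (λ s → c₁ * s ^ k₁ + c * (c₁ * s ^ k₁) ^ k)
      (dominated-+ (c₁ , k₁ , λ _ _ → ℕ.≤-refl) (dominated-monomial c k (c₁ , k₁ , λ _ _ → ℕ.≤-refl)))
      λ x → let _ , d , s≤ = run₁ x ; _ , e , t≤ = run x in
        _ , (d then e) ,
        ℕ.+-mono-≤ s≤ (ℕ.≤-trans t≤ (monomial-mono c k (ℕ.≤-trans (output≤cost d) s≤)))

  halts-then : ∀ {p r f g} → HaltsInPolyTime O p f → HaltsInPolyTime O r g →
               HaltsInPolyTime O (p then r) (λ x → g (f x))
  halts-then {f = f} P (c , k , run) = halts-then-on c k P λ x → run (f x)

  halts-pair : ∀ {p r f g} → HaltsInPolyTime O p f → HaltsInPolyTime O r g →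
               HaltsInPolyTime O ⟪ p , r ⟫ (λ x → pair (f x) (g x))
  halts-pair (c₁ , k₁ , run₁) (c₂ , k₂ , run₂) =
    halts (λ s → 1 + (c₁ * s ^ k₁ + c₂ * s ^ k₂))
      (dominated-+ (dominated-const 1)
        (dominated-+ (c₁ , k₁ , λ _ _ → ℕ.≤-refl) (c₂ , k₂ , λ _ _ → ℕ.≤-refl)))
      λ x → let _ , d , s≤ = run₁ x ; _ , e , t≤ = run₂ x in
        _ , ⟪ d , e ⟫ , s≤s (ℕ.+-mono-≤ s≤ t≤)

-- Closure properties of polynomial-time functions

if-data : Data → Data → Data → Data
if-data (nat zero)    y z = z
if-data (nat (suc _)) y z = y
if-data (pair _ _)    y z = y

polyTime-prim : ∀ g {b} → (∀ x → size (applyPrim g x) ≤ b + size x) → PolyTime (applyPrim g)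
polyTime-prim g bound = prim g , halts-prim g bound

polyTime-then : ∀ {f g} → PolyTime f → PolyTime g → PolyTime (λ x → g (f x))
polyTime-then (p , P) (r , R) = (p then r) , halts-then P R

polyTime-pair : ∀ {f g} → PolyTime f → PolyTime g → PolyTime (λ x → pair (f x) (g x))
polyTime-pair (p , P) (r , R) = ⟪ p , r ⟫ , halts-pair P R

polyTime-id : PolyTime (λ x → x)
polyTime-id = polyTime-prim identity {0} λ x → ℕ.≤-refl

polyTime-const : ∀ d → PolyTime (λ _ → d)
polyTime-const d = polyTime-prim (const d) {size d} λ x → ℕ.m≤m+n (size d) (size x)

polyTime-first : ∀ {f} → PolyTime f → PolyTime (λ x → applyPrim first (f x))
polyTime-first P = polyTime-then P (polyTime-prim first {0} size-first)

polyTime-second : ∀ {f} → PolyTime f → PolyTime (λ x → applyPrim second (f x))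
polyTime-second P = polyTime-then P (polyTime-prim second {0} size-second)

polyTime-add : ∀ {f g} → PolyTime f → PolyTime g → PolyTime (λ x → applyPrim add (pair (f x) (g x)))
polyTime-add P R = polyTime-then (polyTime-pair P R) (polyTime-prim add {0} λ where
  (nat _)    → s≤s z≤n
  (pair x y) → ℕ.m≤n⇒m≤1+n (size-add x y))

polyTime-sub : ∀ {f g} → PolyTime f → PolyTime g → PolyTime (λ x → applyPrim sub (pair (f x) (g x)))
polyTime-sub P R = polyTime-then (polyTime-pair P R) (polyTime-prim sub {0} λ where
  (nat _)    → s≤s z≤n
  (pair x y) → ℕ.m≤n⇒m≤1+n (ℕ.≤-trans (size-sub x y) (ℕ.m≤m+n (size x) (size y))))

polyTime-isNat : ∀ {f} → PolyTime f → PolyTime (λ x → applyPrim isNat (f x))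
polyTime-isNat P = polyTime-then P (polyTime-prim isNat {0} λ where
  (nat _)    → s≤s z≤n
  (pair _ _) → s≤s z≤n)

polyTime-if : ∀ {b f g} → PolyTime b → PolyTime f → PolyTime g →
              PolyTime (λ x → if-data (b x) (f x) (g x))
polyTime-if {b} {f} {g} (p₀ , c₀ , k₀ , run₀) (p₁ , c₁ , k₁ , run₁) (p₂ , c₂ , k₂ , run₂) =
  (branch p₀ yes p₁ no p₂) ,
  halts (λ s → c₀ * s ^ k₀ + (c₁ * s ^ k₁ + c₂ * s ^ k₂))
    (dominated-+ (c₀ , k₀ , λ _ _ → ℕ.≤-refl)
      (dominated-+ (c₁ , k₁ , λ _ _ → ℕ.≤-refl) (c₂ , k₂ , λ _ _ → ℕ.≤-refl)))
    run
  where
  run : ∀ x → ∃[ t ] (noOracle ⊢ branch p₀ yes p₁ no p₂ ▷ x ⇓ if-data (b x) (f x) (g x) [ t ] ×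
                      t ≤ c₀ * size x ^ k₀ + (c₁ * size x ^ k₁ + c₂ * size x ^ k₂))
  run x with b x | run₀ x | run₁ x | run₂ x
  ... | nat zero    | _ , d , s≤ | _ | _ , e , t≤ = _ , if-false d e , ℕ.+-mono-≤ s≤ (ℕ.≤-trans t≤ (ℕ.m≤n+m _ _))
  ... | nat (suc _) | _ , d , s≤ | _ , e , t≤ | _ = _ , if-true d (λ ()) e , ℕ.+-mono-≤ s≤ (ℕ.≤-trans t≤ (ℕ.m≤m+n _ _))
  ... | pair _ _    | _ , d , s≤ | _ , e , t≤ | _ = _ , if-true d (λ ()) e , ℕ.+-mono-≤ s≤ (ℕ.≤-trans t≤ (ℕ.m≤m+n _ _))

polyTime-cong : ∀ {f g} → (∀ x → f x ≡ g x) → PolyTime f → PolyTime g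
polyTime-cong eq (p , c , k , run) = p , c , k , λ x →
  let t , d , t≤ = run x in t , subst (λ y → noOracle ⊢ p ▷ x ⇓ y [ t ]) (eq x) d , t≤

embed : ∀ {Q} → Prog ⊥ → Prog Q
embed (prim f)               = prim f
embed (p then r)             = embed p then embed r
embed ⟪ p , r ⟫              = ⟪ embed p , embed r ⟫
embed (branch b yes p no r)  = branch embed b yes embed p no embed r
embed (while b loop p)       = while embed b loop embed p

embed-⇓ : ∀ {Q} {O : Q → Data → Data} {p x y t} → noOracle ⊢ p ▷ x ⇓ y [ t ] → O ⊢ embed p ▷ x ⇓ y [ t ]
embed-⇓ prim                 = prim
embed-⇓ (d then e)           = embed-⇓ d then embed-⇓ e
embed-⇓ ⟪ d , e ⟫            = ⟪ embed-⇓ d , embed-⇓ e ⟫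
embed-⇓ (if-true d v e)      = if-true (embed-⇓ d) v (embed-⇓ e)
embed-⇓ (if-false d e)       = if-false (embed-⇓ d) (embed-⇓ e)
embed-⇓ (while-true d v e f) = while-true (embed-⇓ d) v (embed-⇓ e) (embed-⇓ f)
embed-⇓ (while-false d)      = while-false (embed-⇓ d)

halts-embed : ∀ {Q} {O : Q → Data → Data} {p f} → HaltsInPolyTime noOracle p f → HaltsInPolyTime O (embed p) f
halts-embed (c , k , run) = c , k , λ x → let t , d , t≤ = run x in t , embed-⇓ d , t≤

-- Folds over encoded lists

-- A syntax for loop bodies, so that one induction yields programs and another yields size bounds. A
-- term cannot mention the accumulator: what it computes is bounded by the key and the current item
-- alone.
data Term : Set where
  key item        : Term
  lit             : Data → Term
  fst snd         : Term → Term
  _,,_ _⊕_        : Term → Term → Term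

⟦_⟧ : Term → Data → Data → Data
⟦ key ⟧ k h    = k
⟦ item ⟧ k h   = h
⟦ lit d ⟧ k h  = d
⟦ fst T ⟧ k h  = applyPrim first (⟦ T ⟧ k h)
⟦ snd T ⟧ k h  = applyPrim second (⟦ T ⟧ k h)
⟦ T ,, U ⟧ k h = pair (⟦ T ⟧ k h) (⟦ U ⟧ k h)
⟦ T ⊕ U ⟧ k h  = applyPrim add (pair (⟦ T ⟧ k h) (⟦ U ⟧ k h))

termBound : Term → ℕ
termBound key      = 1
termBound item     = 1
termBound (lit d)  = size d
termBound (fst T)  = termBound T
termBound (snd T)  = termBound T
termBound (T ,, U) = 1 + (termBound T + termBound U)
termBound (T ⊕ U)  = termBound T + termBound U

-- Sizes are at least 1, so the product dominates both factors. As it is linear in `size h`, it adds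
-- up over the items of a list to the key size times the list size.
size-⟦⟧ : ∀ T k h → size (⟦ T ⟧ k h) ≤ termBound T * (size k * size h)
size-⟦⟧ key k h = ℕ.≤-trans (ℕ.≤-trans (ℕ.≤-reflexive (sym (ℕ.*-identityʳ (size k))))
  (ℕ.*-monoʳ-≤ (size k) (size-positive h))) (ℕ.m≤m+n _ 0)
size-⟦⟧ item k h = ℕ.≤-trans (ℕ.≤-trans (ℕ.≤-reflexive (sym (ℕ.*-identityˡ (size h))))
  (ℕ.*-monoˡ-≤ (size h) (size-positive k))) (ℕ.m≤m+n _ 0)
size-⟦⟧ (lit d) k h = ℕ.≤-trans (ℕ.≤-reflexive (sym (ℕ.*-identityʳ (size d))))
  (ℕ.*-monoʳ-≤ (size d) (ℕ.*-mono-≤ (size-positive k) (size-positive h)))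
size-⟦⟧ (fst T) k h = ℕ.≤-trans (size-first (⟦ T ⟧ k h)) (size-⟦⟧ T k h)
size-⟦⟧ (snd T) k h = ℕ.≤-trans (size-second (⟦ T ⟧ k h)) (size-⟦⟧ T k h)
size-⟦⟧ (T ,, U) k h = ℕ.≤-trans
  (ℕ.+-mono-≤ (ℕ.*-mono-≤ (size-positive k) (size-positive h)) (ℕ.+-mono-≤ (size-⟦⟧ T k h) (size-⟦⟧ U k h)))
  (ℕ.≤-reflexive (collect (termBound T) (termBound U) (size k * size h)))
  where
  collect : ∀ a b s → s + (a * s + b * s) ≡ (1 + (a + b)) * s
  collect = solve-∀
size-⟦⟧ (T ⊕ U) k h = ℕ.≤-trans (size-add (⟦ T ⟧ k h) (⟦ U ⟧ k h)) (ℕ.≤-trans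
  (ℕ.+-mono-≤ (size-⟦⟧ T k h) (size-⟦⟧ U k h))
  (ℕ.≤-reflexive (sym (ℕ.*-distribʳ-+ (size k * size h) (termBound T) (termBound U)))))

-- The accumulator occurs exactly once in an update. An iteration therefore adds to its size and
-- never multiplies it, which rules out exponential growth.
data Update : Set where
  acc       : Update
  _▸_       : Term → Update → Update
  _increase_ : Update → ℕ → Update

infixr 5 _▸_
infixr 6 _,,_
infixl 7 _⊕_

update : Update → Data → Data → Data → Data
update acc            k h o = o
update (T ▸ u)        k h o = pair (⟦ T ⟧ k h) (update u k h o)
update (u increase n) k h o = applyPrim add (pair (update u k h o) (nat n))

updateBound : Update → ℕ
updateBound acc            = 0
updateBound (T ▸ u)        = 1 + (termBound T + updateBound u)
updateBound (u increase n) = size (nat n) + updateBound u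

size-update : ∀ u k h o → size (update u k h o) ≤ size o + updateBound u * (size k * size h)
size-update acc k h o = ℕ.m≤m+n (size o) 0
size-update (T ▸ u) k h o = ℕ.≤-trans
  (ℕ.+-mono-≤ (ℕ.*-mono-≤ (size-positive k) (size-positive h)) (ℕ.+-mono-≤ (size-⟦⟧ T k h) (size-update u k h o)))
  (ℕ.≤-reflexive (collect (termBound T) (updateBound u) (size k * size h) (size o)))
  where
  collect : ∀ a b s o → s + (a * s + (o + b * s)) ≡ o + (1 + (a + b)) * s
  collect = solve-∀
size-update (u increase n) k h o = ℕ.≤-trans (size-add (update u k h o) (nat n)) (ℕ.≤-trans
  (ℕ.+-mono-≤ (size-update u k h o) (size-⟦⟧ (lit (nat n)) k h))
  (ℕ.≤-reflexive (collect (size (nat n)) (updateBound u) (size k * size h) (size o))))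
  where
  collect : ∀ a b s o → o + b * s + a * s ≡ o + (a + b) * s
  collect = solve-∀

-- The key is lowered before each update; as it never grows, the accumulator
-- of a run grows at most by a constant times key size times list size.
lower : ℕ → Data → Data
lower d k = applyPrim sub (pair k (nat d))

iterate : ℕ → Update → Data → Data → Data → Data
iterate d u k o (nat _)    = o
iterate d u k o (pair h t) = iterate d u (lower d k) (update u (lower d k) h o) t

module _ (d : ℕ) (u : Update) where

  stateKey stateAcc stateList : Data → Data
  stateKey y  = applyPrim first (applyPrim first y)
  stateAcc y  = applyPrim second (applyPrim first y)
  stateList y = applyPrim second y

  polyTime-⟦⟧ : ∀ T → PolyTime (λ y → ⟦ T ⟧ (lower d (stateKey y)) (applyPrim first (stateList y)))
  polyTime-⟦⟧ key      = polyTime-sub (polyTime-first (polyTime-first polyTime-id)) (polyTime-const (nat d))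
  polyTime-⟦⟧ item     = polyTime-first (polyTime-second polyTime-id)
  polyTime-⟦⟧ (lit e)  = polyTime-const e
  polyTime-⟦⟧ (fst T)  = polyTime-first (polyTime-⟦⟧ T)
  polyTime-⟦⟧ (snd T)  = polyTime-second (polyTime-⟦⟧ T)
  polyTime-⟦⟧ (T ,, U) = polyTime-pair (polyTime-⟦⟧ T) (polyTime-⟦⟧ U)
  polyTime-⟦⟧ (T ⊕ U)  = polyTime-add (polyTime-⟦⟧ T) (polyTime-⟦⟧ U)

  polyTime-update : ∀ v → PolyTime (λ y → update v (lower d (stateKey y)) (applyPrim first (stateList y)) (stateAcc y))
  polyTime-update acc            = polyTime-second (polyTime-first polyTime-id)
  polyTime-update (T ▸ v)        = polyTime-pair (polyTime-⟦⟧ T) (polyTime-update v)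
  polyTime-update (v increase n) = polyTime-add (polyTime-update v) (polyTime-const (nat n))

  abstract
    -- The loop test: lists end in a number, so 1 minus `isNat` is nonzero as long as an item is
    -- left.
    polyTime-test : PolyTime (λ y → applyPrim sub (pair (nat 1) (applyPrim isNat (stateList y))))
    polyTime-test = polyTime-sub (polyTime-const (nat 1)) (polyTime-isNat (polyTime-second polyTime-id))

    polyTime-body : PolyTime (λ y →
      pair (pair (lower d (stateKey y)) (update u (lower d (stateKey y)) (applyPrim first (stateList y)) (stateAcc y)))
           (applyPrim second (stateList y)))
    polyTime-body = polyTime-pair (polyTime-pair (polyTime-⟦⟧ key) (polyTime-update u))
                                  (polyTime-second (polyTime-second polyTime-id))

  loop : Prog ⊥
  loop = while proj₁ polyTime-test loop proj₁ polyTime-body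

  iterationBound : ℕ → ℕ
  iterationBound s = let _ , c , k , _ = polyTime-test ; _ , c′ , k′ , _ = polyTime-body in
    c * s ^ k + c′ * s ^ k′

  -- The size of the state plus the growth still to come. Consuming h enlarges the accumulator by at
  -- most `updateBound u * (size k * size h)`, and the second summand drops by at least that much
  -- because h leaves the list.
  potential : Data → Data → Data → ℕ
  potential k o l = size (pair (pair k o) l) + updateBound u * (size k * size l)

  potential-decreases : ∀ k o h t →
    potential (lower d k) (update u (lower d k) h o) t ≤ potential k o (pair h t)
  potential-decreases k o h t = ℕ.≤-trans
    (ℕ.+-mono-≤ (s≤s (ℕ.+-monoˡ-≤ (size t) (s≤s (ℕ.+-mono-≤ k′≤k
        (ℕ.≤-trans (size-update u (lower d k) h o)
          (ℕ.+-monoʳ-≤ (size o) (ℕ.*-monoʳ-≤ (updateBound u) (ℕ.*-monoˡ-≤ (size h) k′≤k))))))))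
      (ℕ.*-monoʳ-≤ (updateBound u) (ℕ.*-monoˡ-≤ (size t) k′≤k)))
    (ℕ.≤-trans (ℕ.m≤m+n _ (1 + size h + updateBound u * size k))
      (ℕ.≤-reflexive (collect (updateBound u) (size k) (size o) (size h) (size t))))
    where
    k′≤k : size (lower d k) ≤ size k
    k′≤k = size-sub k (nat d)
    collect : ∀ b k o h t →
      suc (suc (k + (o + b * (k * h))) + t) + b * (k * t) + (1 + h + b * k) ≡
      suc (suc (k + o) + suc (h + t)) + b * (k * suc (h + t))
    collect = solve-∀

  -- M stays fixed during the recursion: the potential never increases, so each iteration costs at
  -- most `iterationBound M`, and `size l` is at least the number of tests, the final one included.
  loop-run : ∀ k o l M → potential k o l ≤ M → ∃[ y ] ∃[ t ]
    (noOracle ⊢ loop ▷ pair (pair k o) l ⇓ y [ t ] × stateAcc y ≡ iterate d u k o l × t ≤ size l * iterationBound M)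
  loop-run k o (nat n) M V≤M =
    let _ , c , j , run = polyTime-test
        _ , c′ , j′ , _ = polyTime-body
        t , D , t≤ = run (pair (pair k o) (nat n)) in
    _ , t , while-false D , refl , (begin
      t                             ≤⟨ t≤ ⟩
      _                             ≤⟨ monomial-mono c j (ℕ.≤-trans (ℕ.m≤m+n _ _) V≤M) ⟩
      c * M ^ j                     ≤⟨ ℕ.m≤m+n (c * M ^ j) _ ⟩
      iterationBound M              ≡⟨ sym (ℕ.*-identityˡ _) ⟩
      1 * iterationBound M          ≤⟨ ℕ.*-monoˡ-≤ (iterationBound M) (size-positive (nat n)) ⟩
      size (nat n) * iterationBound M ∎)
    where open ℕ.≤-Reasoning
  loop-run k o (pair h r) M V≤M =
    let _ , c , j , run = polyTime-test
        _ , c′ , j′ , run′ = polyTime-body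
        y₀ = pair (pair k o) (pair h r)
        size≤M = ℕ.≤-trans (ℕ.m≤m+n (size y₀) _) V≤M
        s , D , s≤ = run y₀
        t , E , t≤ = run′ y₀
        y , v , F , eq , v≤ = loop-run (lower d k) (update u (lower d k) h o) r M
                                (ℕ.≤-trans (potential-decreases k o h r) V≤M) in
    y , _ , while-true D (λ ()) E F , eq , (begin
      s + t + v
        ≤⟨ ℕ.+-mono-≤ (ℕ.+-mono-≤ (ℕ.≤-trans s≤ (monomial-mono c j size≤M))
                                  (ℕ.≤-trans t≤ (monomial-mono c′ j′ size≤M))) v≤ ⟩
      suc (size r) * iterationBound M
        ≤⟨ ℕ.*-monoˡ-≤ (iterationBound M) (s≤s (ℕ.m≤n+m (size r) (size h))) ⟩
      size (pair h r) * iterationBound M ∎)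
    where open ℕ.≤-Reasoning

  polyTime-iterate : ∀ {f g h} → PolyTime f → PolyTime g → PolyTime h →
                     PolyTime (λ x → iterate d u (f x) (g x) (h x))
  polyTime-iterate {f} {g} {h} Pf Pg Ph =
    polyTime-cong (λ x → proj₁ (proj₂ (proj₂ (proj₂ (result x)))))
      (polyTime-second (polyTime-first
        (_ , halts-then-on (proj₁ bound) (proj₁ (proj₂ bound)) (proj₂ initial)
          λ x → let _ , t , D , _ , t≤ = result x in t , D , ℕ.≤-trans t≤
            (ℕ.≤-trans (ℕ.*-monoˡ-≤ (iterationBound _) (size-second (start x)))
              (proj₂ (proj₂ bound) (size (start x)) (size-positive (start x)))))))
    where
    start : Data → Data
    start x = pair (pair (f x) (g x)) (h x)

    initial : PolyTime start
    initial = polyTime-pair (polyTime-pair Pf Pg) Ph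

    -- Bounds the initial potential in terms of the size s of the start state, of which both the key
    -- and the list are parts.
    cap : ℕ → ℕ
    cap s = s + updateBound u * (s * s)

    bound : Dominated (λ s → s * iterationBound (cap s))
    bound = let _ , c , k , _ = polyTime-test ; _ , c′ , k′ , _ = polyTime-body in
      dominated-* dominated-id (dominated-+ (dominated-monomial c k cap-dominated)
                                            (dominated-monomial c′ k′ cap-dominated))
      where
      cap-dominated : Dominated cap
      cap-dominated = dominated-+ dominated-id (dominated-* (dominated-const (updateBound u))
                                                            (dominated-* dominated-id dominated-id))

    result : ∀ x → _
    result x = loop-run (f x) (g x) (h x) (cap (size (start x)))
      (ℕ.+-monoʳ-≤ (size (start x)) (ℕ.*-monoʳ-≤ (updateBound u)
        (ℕ.*-mono-≤ (ℕ.≤-trans (size-first (pair (f x) (g x))) (size-first (start x)))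
                    (size-second (start x)))))

-- The instance of a graph

-- Copies of the local definitions of lift, which are not accessible by name.
module LiftedModel (q : ℕ) (ϑ : ℚ) (I : Instance) where
  open Instance I public
  open Lift q ϑ public using (μ̂; diagonal)

  model : EmpiricalModel
  model = lift q ϑ I

  copies : ℕ
  copies = #constraints * 4

  bounds : Vec ℕ 4
  bounds = 2 ∷ 2 ∷ q ∷ q ∷ []

  outs : Vec ℕ (gates + (colours + copies))
  outs = EmpiricalModel.outcomes model

  gate : Fin gates → Fin (gates + (colours + copies))
  gate x = x ↑ˡ (colours + copies)

  colour : Fin colours → Fin (gates + (colours + copies))
  colour x = gates ↑ʳ (x ↑ˡ copies)

  copy : Fin #constraints → Fin 4 → Fin (gates + (colours + copies))
  copy c j = gates ↑ʳ (colours ↑ʳ combine c j)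

  pattern j₁ = zero
  pattern j₂ = suc zero
  pattern j₃ = suc (suc zero)
  pattern j₄ = suc (suc (suc zero))

  copyContext : Fin #constraints → Context outs
  copyContext c = context (copy c j₁ ∷ copy c j₂ ∷ copy c j₃ ∷ copy c j₄ ∷ []) μ̂

  diagonalContext : ℕ → Fin (gates + (colours + copies)) → Fin #constraints → Fin 4 → Context outs
  diagonalContext d x c j = context (x ∷ copy c j ∷ []) (diagonal d)

  module At (c : Fin #constraints) = Scope (Vec.lookup constraints c)

  contextsOf : Fin #constraints → List (Context outs)
  contextsOf c =
    copyContext c ∷
    diagonalContext 2 (gate (At.x₁ c)) c j₁ ∷
    diagonalContext 2 (gate (At.x₂ c)) c j₂ ∷
    diagonalContext q (colour (At.x₃ c)) c j₃ ∷
    diagonalContext q (colour (At.x₄ c)) c j₄ ∷ []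

  outs-gate : ∀ x → Vec.lookup outs (gate x) ≡ 2
  outs-gate x = trans (Vec.lookup-++ˡ (Vec.replicate gates 2) _ x) (Vec.lookup-replicate x 2)

  outs-colour : ∀ x → Vec.lookup outs (colour x) ≡ q
  outs-colour x = trans (Vec.lookup-++ʳ (Vec.replicate gates 2) _ (x ↑ˡ copies))
    (trans (Vec.lookup-++ˡ (Vec.replicate colours q) _ x) (Vec.lookup-replicate x q))

  outs-copy : ∀ c j → Vec.lookup outs (copy c j) ≡ Vec.lookup bounds j
  outs-copy c j = trans (Vec.lookup-++ʳ (Vec.replicate gates 2) _ (colours ↑ʳ combine c j))
    (trans (Vec.lookup-++ʳ (Vec.replicate colours q) _ (combine c j))
    (trans (Vec.lookup-concat (Vec.replicate #constraints bounds) c j)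
           (cong (λ xs → Vec.lookup xs j) (Vec.lookup-replicate c bounds))))

  outs-copies : ∀ c → Vec.map (Vec.lookup outs) (Context.scope (copyContext c)) ≡ bounds
  outs-copies c = cong₂ _∷_ (outs-copy c j₁) (cong₂ _∷_ (outs-copy c j₂)
    (cong₂ _∷_ (outs-copy c j₃) (cong (_∷ []) (outs-copy c j₄))))

  outs-diagonal : ∀ {d x} c j → Vec.lookup outs x ≡ d → Vec.lookup bounds j ≡ d →
    Vec.map (Vec.lookup outs) (x ∷ copy c j ∷ []) ≡ d ∷ d ∷ []
  outs-diagonal c j p r = cong₂ _∷_ p (cong (_∷ []) (trans (outs-copy c j) r))

  toℕ-gate : ∀ x → toℕ (gate x) ≡ toℕ x
  toℕ-gate x = Fin.toℕ-↑ˡ x (colours + copies)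

  toℕ-colour : ∀ x → toℕ (colour x) ≡ gates + toℕ x
  toℕ-colour x = trans (Fin.toℕ-↑ʳ gates _) (cong (gates +_) (Fin.toℕ-↑ˡ x copies))

  toℕ-copy : ∀ c j → toℕ (copy c j) ≡ gates + colours + toℕ c * 4 + toℕ j
  toℕ-copy c j = trans (Fin.toℕ-↑ʳ gates _) (trans (cong (gates +_)
    (trans (Fin.toℕ-↑ʳ colours _) (cong (colours +_) (Fin.toℕ-combine c j))))
    (rearrange gates colours (toℕ c) (toℕ j)))
    where
    rearrange : ∀ g n c j → g + (n + (4 * c + j)) ≡ g + n + c * 4 + j
    rearrange = solve-∀

edge : ∀ {n} → Fin n → Fin n → Scope 2 n
edge u v = scope zero (suc zero) u v

-- The gates are the same in all constraints and are left out, so that the format agrees with that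
-- of the edges of an encoded graph.
encodeEdge : ∀ {n} → Scope 2 n → Data
encodeEdge s = pair (encodeFin (Scope.x₃ s)) (encodeFin (Scope.x₄ s))

-- Every vertex gets a private partner and one further edge is added, so that
-- every variable of the resulting instance lies in some constraint.
module Gadget (G : Graph) where
  open Graph G

  vertices : ℕ
  vertices = order + (order + 2)

  original partner : Fin order → Fin vertices
  original v = v ↑ˡ (order + 2)
  partner v  = order ↑ʳ (v ↑ˡ 2)

  extra : Fin 2 → Fin vertices
  extra i = order ↑ʳ (order ↑ʳ i)

  pendant : Fin order → Scope 2 vertices
  pendant v = edge (original v) (partner v)

  extraEdge : Scope 2 vertices
  extraEdge = edge (extra zero) (extra (suc zero))

  originalEdge : Fin order × Fin order → Scope 2 vertices
  originalEdge (u , v) = edge (original u) (original v)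

  -- The orders are those produced by the loops: pushing the pendant edges reverses the vertices,
  -- and pushing contexts along `edgeList` reverses that list in turn.
  edgeList scopes : List (Scope 2 vertices)
  edgeList = List.map pendant (List.allFin order) List.ʳ++ (extraEdge ∷ List.map originalEdge edges)
  scopes = edgeList List.ʳ++ []

  ∈-scopes : ∀ {s} → s ∈ edgeList → s ∈ scopes
  ∈-scopes = Any.reverse⁺

  pendant∈scopes : ∀ v → pendant v ∈ scopes
  pendant∈scopes v = ∈-scopes (subst (pendant v ∈_) (sym (List.ʳ++-defn (List.map pendant (List.allFin order))))
    (∈.∈-++⁺ˡ (Any.reverse⁺ (∈.∈-map⁺ pendant (∈.∈-allFin v)))))

  base⊆scopes : ∀ {s} → s ∈ (extraEdge ∷ List.map originalEdge edges) → s ∈ scopes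
  base⊆scopes {s} i = ∈-scopes (subst (s ∈_) (sym (List.ʳ++-defn (List.map pendant (List.allFin order))))
    (∈.∈-++⁺ʳ _ i))

  lookup-index : ∀ {xs : List (Scope 2 vertices)} {s} (i : s ∈ xs) → Vec.lookup (Vec.fromList xs) (index i) ≡ s
  lookup-index (here refl) = refl
  lookup-index (there i)   = lookup-index i

  gateOccurs : ∀ x → ∃[ c ] let s = Vec.lookup (Vec.fromList scopes) c in Scope.x₁ s ≡ x ⊎ Scope.x₂ s ≡ x
  gateOccurs x = index extra∈ , occurs x
    where
    extra∈ = base⊆scopes (here refl)
    occurs : ∀ x → let s = Vec.lookup (Vec.fromList scopes) (index extra∈) in Scope.x₁ s ≡ x ⊎ Scope.x₂ s ≡ x
    occurs zero       = inj₁ (cong Scope.x₁ (lookup-index extra∈))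
    occurs (suc zero) = inj₂ (cong Scope.x₂ (lookup-index extra∈))

  Occurs : Fin vertices → Set
  Occurs x = ∃[ c ] let s = Vec.lookup (Vec.fromList scopes) c in Scope.x₃ s ≡ x ⊎ Scope.x₄ s ≡ x

  colourOccurs : ∀ x → Occurs x
  colourOccurs x with splitAt order x in eq
  ... | inj₁ v = index i , inj₁ (trans (cong Scope.x₃ (lookup-index i)) (Fin.splitAt⁻¹-↑ˡ eq))
    where i = pendant∈scopes v
  ... | inj₂ y with splitAt order y in eq′
  ...   | inj₁ v = index i , inj₂ (trans (cong Scope.x₄ (lookup-index i))
          (trans (cong (order ↑ʳ_) (Fin.splitAt⁻¹-↑ˡ eq′)) (Fin.splitAt⁻¹-↑ʳ eq)))
    where i = pendant∈scopes v
  ...   | inj₂ zero = index i , inj₁ (trans (cong Scope.x₃ (lookup-index i))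
          (trans (cong (order ↑ʳ_) (Fin.splitAt⁻¹-↑ʳ eq′)) (Fin.splitAt⁻¹-↑ʳ eq)))
    where i = base⊆scopes (here refl)
  ...   | inj₂ (suc zero) = index i , inj₂ (trans (cong Scope.x₄ (lookup-index i))
          (trans (cong (order ↑ʳ_) (Fin.splitAt⁻¹-↑ʳ eq′)) (Fin.splitAt⁻¹-↑ʳ eq)))
    where i = base⊆scopes (here refl)

  instance-of : Instance
  instance-of = record
    { gates        = 2
    ; colours      = vertices
    ; #constraints = List.length scopes
    ; constraints  = Vec.fromList scopes
    ; gateOccurs   = gateOccurs
    ; colourOccurs = colourOccurs
    }

  all-reverse : ∀ {A : Set} {P : A → Set} {xs} → All P xs → All P (List.reverse xs)
  all-reverse pxs = All.tabulate λ i → All.lookup pxs (Any.reverse⁻ i)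

  all-edgeList : (P : Scope 2 vertices → Set) → (∀ v → P (pendant v)) → P extraEdge →
                 All (λ e → P (originalEdge e)) edges → All P edgeList
  all-edgeList P p x o = subst (All P) (sym (List.ʳ++-defn (List.map pendant (List.allFin order))))
    (All.++⁺ (all-reverse (All.map⁺ {xs = List.allFin order} (All.tabulate (λ {v} _ → p v)))) (x ∷ All.map⁺ o))

  lookup-fromList∈ : ∀ {A : Set} (xs : List A) c → Vec.lookup (Vec.fromList xs) c ∈ xs
  lookup-fromList∈ (x ∷ xs) zero    = here refl
  lookup-fromList∈ (x ∷ xs) (suc c) = there (lookup-fromList∈ xs c)

  all-constraints : (P : Scope 2 vertices → Set) → (∀ v → P (pendant v)) → P extraEdge →
                 All (λ e → P (originalEdge e)) edges → ∀ c → P (Vec.lookup (Vec.fromList scopes) c)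
  all-constraints P p x o c = All.lookup (all-reverse (all-edgeList P p x o)) (lookup-fromList∈ scopes c)

  Proper : ∀ {q} → (Fin vertices → Fin q) → Set
  Proper f = ∀ c → let s = Vec.lookup (Vec.fromList scopes) c in f (Scope.x₃ s) ≢ f (Scope.x₄ s)

  different : ∀ {q} → Fin (2 + q) → Fin (2 + q)
  different zero    = suc zero
  different (suc _) = zero

  different-≢ : ∀ {q} (x : Fin (2 + q)) → x ≢ different x
  different-≢ zero    ()
  different-≢ (suc _) ()

  -- A partner has to avoid only the colour of its single neighbour, and the extra edge receives the
  -- colours 0 and 1; two colours are enough for the added vertices.
  extend : ∀ {q} → (Fin order → Fin (2 + q)) → Fin vertices → Fin (2 + q)
  extend {q} f = [ f , [ different ∘ f , (_↑ˡ q) ]′ ∘ splitAt order ]′ ∘ splitAt order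

  module _ {q} (f : Fin order → Fin (2 + q)) where
    extend-original : ∀ v → extend f (original v) ≡ f v
    extend-original v rewrite Fin.splitAt-↑ˡ order v (order + 2) = refl

    extend-partner : ∀ v → extend f (partner v) ≡ different (f v)
    extend-partner v rewrite Fin.splitAt-↑ʳ order (order + 2) (v ↑ˡ 2) | Fin.splitAt-↑ˡ order v 2 = refl

    extend-extra : ∀ i → extend f (extra i) ≡ i ↑ˡ q
    extend-extra i rewrite Fin.splitAt-↑ʳ order (order + 2) (order ↑ʳ i) | Fin.splitAt-↑ʳ order 2 i = refl

  proper-extension : ∀ {q} → Colourable (2 + q) G → Σ (Fin vertices → Fin (2 + q)) Proper
  proper-extension {q} (f , proper) = extend f , all-constraints (λ s → extend f (Scope.x₃ s) ≢ extend f (Scope.x₄ s))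
    (λ v eq → different-≢ (f v) (trans (sym (extend-original f v)) (trans eq (extend-partner f v))))
    (λ eq → Fin.0≢1+n (trans (sym (extend-extra f zero)) (trans eq (extend-extra f (suc zero)))))
    (All.map (λ {(u , v)} fu≢fv eq → fu≢fv (trans (sym (extend-original f u)) (trans eq (extend-original f v)))) proper)

  proper-restriction : ∀ {q} → Σ (Fin vertices → Fin q) Proper → Colourable q G
  proper-restriction (f , proper) = f ∘ original , All.tabulate λ {(u , v)} e∈ eq →
    let i = base⊆scopes (there (∈.∈-map⁺ originalEdge e∈)) in
    proper (index i) (trans (cong (f ∘ Scope.x₃) (lookup-index i)) (trans eq (sym (cong (f ∘ Scope.x₄) (lookup-index i)))))

  x₁-scopes : ∀ c → Scope.x₁ (Vec.lookup (Vec.fromList scopes) c) ≡ zero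
  x₁-scopes = all-constraints (λ s → Scope.x₁ s ≡ zero) (λ _ → refl) refl (All.tabulate (λ _ → refl))

  x₂-scopes : ∀ c → Scope.x₂ (Vec.lookup (Vec.fromList scopes) c) ≡ suc zero
  x₂-scopes = all-constraints (λ s → Scope.x₂ s ≡ suc zero) (λ _ → refl) refl (All.tabulate (λ _ → refl))

  original-injective : ∀ {u v} → original u ≡ original v → u ≡ v
  original-injective = Fin.↑ˡ-injective (order + 2) _ _

  original≢partner : ∀ u v → original u ≢ partner v
  original≢partner u v eq with trans (sym (Fin.splitAt-↑ˡ order u (order + 2)))
    (trans (cong (splitAt order) eq) (Fin.splitAt-↑ʳ order (order + 2) (v ↑ˡ 2)))
  ... | ()

  -- Two colours drawn by a random function are independent only at distinct vertices. This is where
  -- the graph being loopless enters.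
  x₃≢x₄ : ∀ c → let s = Vec.lookup (Vec.fromList scopes) c in Scope.x₃ s ≢ Scope.x₄ s
  x₃≢x₄ = all-constraints (λ s → Scope.x₃ s ≢ Scope.x₄ s) (λ v → original≢partner v v)
    (λ eq → Fin.0≢1+n (Fin.↑ʳ-injective order _ _ (Fin.↑ʳ-injective order _ _ eq)))
    (All.map (λ u≢v eq → u≢v (original-injective eq)) loopless)

  -- The extra edge provides a constraint even for the graph without vertices. Its contexts cap the
  -- total weight, which would be unbounded in a model without contexts.
  some-constraint : Fin (List.length scopes)
  some-constraint = index (base⊆scopes (here refl))

-- Computing the lifted model of a graph

iterate-uniform : ∀ {A : Set} (enc : A → Data) {u} (F : Data → Data) →
  (∀ h o → update u (nat 0) h o ≡ F o) →
  ∀ xs o → iterate 0 u (nat 0) o (encodeList enc xs) ≡ fold o F (List.length xs)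
iterate-uniform enc F eq []       o = refl
iterate-uniform enc F eq (x ∷ xs) o rewrite eq (enc x) o =
  trans (iterate-uniform enc F eq xs (F o)) (fold-step (List.length xs))
  where
  fold-step : ∀ n → fold (F o) F n ≡ F (fold o F n)
  fold-step zero    = refl
  fold-step (suc n) = cong F (fold-step n)

iterate-count : ∀ {A : Set} (enc : A → Data) s (xs : List A) m →
  iterate 0 (acc increase s) (nat 0) (nat m) (encodeList enc xs) ≡ nat (m + List.length xs * s)
iterate-count enc s []       m = cong nat (sym (ℕ.+-identityʳ m))
iterate-count enc s (x ∷ xs) m = trans (iterate-count enc s xs (m + s)) (cong nat (ℕ.+-assoc m s _))

module Reduction (q : ℕ) (ϑ : ℚ) where
  open Lift q ϑ

  constant : ℕ → Term
  constant n = lit (nat n)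

  -- The tables depend only on q and ϑ, which are fixed, so their encodings enter the program as
  -- literals.
  diagonalData : ℕ → Data
  diagonalData d = encodeList (λ u → encodeℚ (diagonal d u)) (tuples (d ∷ d ∷ []))

  μ̂Data : Data
  μ̂Data = encodeList (λ u → encodeℚ (μ̂ u)) (tuples (2 ∷ 2 ∷ q ∷ q ∷ []))

  copyTerm : ℕ → Term
  copyTerm j = key ⊕ constant j

  diagonalTerm : ℕ → Term → ℕ → Term
  diagonalTerm d x j = (x ,, copyTerm j ,, constant 0) ,, lit (diagonalData d)

  -- The key is the index of the first copy belonging to the constraint.  The
  -- contexts are pushed from the last constraint to the first, so that key starts
  -- past all copies and is lowered by 4 at each step.
  pushContexts : Update
  pushContexts =
    ((copyTerm 0 ,, copyTerm 1 ,, copyTerm 2 ,, copyTerm 3 ,, constant 0) ,, lit μ̂Data) ▸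
    diagonalTerm 2 (constant 0) 0 ▸
    diagonalTerm 2 (constant 1) 1 ▸
    diagonalTerm q (constant 2 ⊕ fst item) 2 ▸
    diagonalTerm q (constant 2 ⊕ snd item) 3 ▸ acc

  -- In `pushPendant` the key is the number n of vertices, so that v gets the partner n + v. In
  -- `pushVertex` one q belongs to a vertex and the other to a partner.
  pushPendant pushVertex pushCopies : Update
  pushPendant = (item ,, key ⊕ item) ▸ acc
  pushVertex  = constant q ▸ constant q ▸ acc
  pushCopies  = constant 2 ▸ constant 2 ▸ constant q ▸ constant q ▸ acc

  plus : Data → Data → Data
  plus x y = applyPrim add (pair x y)

  -- Original vertices keep their numbers, so the edge list of the input is reused as it is, beneath
  -- the extra edge from 2n to 2n + 1 for n vertices. For m constraints `baseIndex` is 2 + (2n + 2)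
  -- + 4m, the number of all observables.
  #vertices #colours edgeData baseIndex outcomesData contextsData reduction : Data → Data
  #vertices x    = iterate 0 (acc increase 1) (nat 0) (nat 0) (applyPrim first x)
  #colours x     = plus (#vertices x) (plus (#vertices x) (nat 2))
  edgeData x     = iterate 0 pushPendant (#vertices x)
    (pair (pair (plus (#vertices x) (plus (#vertices x) (nat 0)))
                (plus (#vertices x) (plus (#vertices x) (nat 1))))
          (applyPrim second x))
    (applyPrim first x)
  baseIndex x    = iterate 0 (acc increase 4) (nat 0) (plus (nat 2) (#colours x)) (edgeData x)
  contextsData x = iterate 4 pushContexts (baseIndex x) (nat 0) (edgeData x)
  outcomesData x = pair (nat 2) (pair (nat 2)
    (iterate 0 pushVertex (nat 0)
      (pair (nat q) (pair (nat q) (iterate 0 pushCopies (nat 0) (nat 0) (edgeData x))))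
      (applyPrim first x)))
  reduction x    = pair (outcomesData x) (contextsData x)

  polyTime-#vertices : PolyTime #vertices
  polyTime-#vertices = polyTime-iterate 0 _ (polyTime-const _) (polyTime-const _) (polyTime-first polyTime-id)

  polyTime-#colours : PolyTime #colours
  polyTime-#colours = polyTime-add polyTime-#vertices (polyTime-add polyTime-#vertices (polyTime-const _))

  polyTime-edgeData : PolyTime edgeData
  polyTime-edgeData = polyTime-iterate 0 _ polyTime-#vertices
    (polyTime-pair (polyTime-pair (polyTime-add polyTime-#vertices (polyTime-add polyTime-#vertices (polyTime-const _)))
                                  (polyTime-add polyTime-#vertices (polyTime-add polyTime-#vertices (polyTime-const _))))
                   (polyTime-second polyTime-id))
    (polyTime-first polyTime-id)

  polyTime-baseIndex : PolyTime baseIndex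
  polyTime-baseIndex = polyTime-iterate 0 _ (polyTime-const _)
    (polyTime-add (polyTime-const (nat 2)) polyTime-#colours) polyTime-edgeData

  polyTime-contextsData : PolyTime contextsData
  polyTime-contextsData = polyTime-iterate 4 _ polyTime-baseIndex (polyTime-const _) polyTime-edgeData

  polyTime-outcomesData : PolyTime outcomesData
  polyTime-outcomesData = polyTime-pair (polyTime-const _) (polyTime-pair (polyTime-const _)
    (polyTime-iterate 0 _ (polyTime-const _)
      (polyTime-pair (polyTime-const _) (polyTime-pair (polyTime-const _)
        (polyTime-iterate 0 _ (polyTime-const _) (polyTime-const _) polyTime-edgeData)))
      (polyTime-first polyTime-id)))

  polyTime-reduction : PolyTime reduction
  polyTime-reduction = polyTime-pair polyTime-outcomesData polyTime-contextsData

  module _ {n : ℕ} where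

    pushAll : ℕ → List (Scope 2 n) → Data
    pushAll B []       = nat 0
    pushAll B (s ∷ ss) = update pushContexts (nat B) (encodeEdge s) (pushAll (B + 4) ss)

    -- Loop invariant: the contexts of ys are already on the accumulator, numbered from the place
    -- where those of xs will end. Lowering the key by 4 gives the first copy of the constraint
    -- pushed next, so the finished list is numbered upwards from B.
    iterate-pushContexts : ∀ B xs ys →
      iterate 4 pushContexts (nat (B + List.length xs * 4)) (pushAll (B + List.length xs * 4) ys) (encodeList encodeEdge xs)
      ≡ pushAll B (xs List.ʳ++ ys)
    iterate-pushContexts B []       ys = cong (λ b → pushAll b ys) (ℕ.+-identityʳ B)
    iterate-pushContexts B (x ∷ xs) ys = trans
      (cong₂ (λ k b → iterate 4 pushContexts (nat k) (update pushContexts (nat k) (encodeEdge x) (pushAll b ys)) (encodeList encodeEdge xs))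
             lowered raised)
      (iterate-pushContexts B xs (x ∷ ys))
      where
      raised : B + (4 + List.length xs * 4) ≡ B + List.length xs * 4 + 4
      raised = rearrange B (List.length xs)
        where
        rearrange : ∀ B l → B + (4 + l * 4) ≡ B + l * 4 + 4
        rearrange = solve-∀
      lowered : B + (4 + List.length xs * 4) ∸ 4 ≡ B + List.length xs * 4
      lowered = trans (cong (_∸ 4) raised) (ℕ.m+n∸n≡m (B + List.length xs * 4) 4)

    -- Passes from the numbering by constraint index, as in the lift, to the running base index of
    -- `pushAll`.
    foldr-pushContexts : ∀ {A : Set} {m} (g : A → Data → Data) (f : Fin m → A) B (ss : Vec (Scope 2 n) m) →
      (∀ i o → g (f i) o ≡ update pushContexts (nat (B + toℕ i * 4)) (encodeEdge (Vec.lookup ss i)) o) →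
      List.foldr g (nat 0) (List.tabulate f) ≡ pushAll B (Vec.toList ss)
    foldr-pushContexts g f B []       eq = refl
    foldr-pushContexts g f B (s ∷ ss) eq = trans (eq zero _)
      (cong₂ (λ b o → update pushContexts (nat b) (encodeEdge s) o) (ℕ.+-identityʳ B)
        (foldr-pushContexts g (f ∘ suc) (B + 4) ss λ i o → trans (eq (suc i) o)
          (cong (λ b → update pushContexts (nat b) (encodeEdge (Vec.lookup ss i)) o)
            (sym (ℕ.+-assoc B 4 (toℕ i * 4))))))

  module _ (G : Graph) where
    open Graph G
    open Gadget G
    open LiftedModel q ϑ instance-of hiding (μ̂; diagonal; gateOccurs; colourOccurs)

    base : ℕ
    base = gates + colours

    encode-copyContext : ∀ c → encodeContext model (copyContext c) ≡
      ⟦ (copyTerm 0 ,, copyTerm 1 ,, copyTerm 2 ,, copyTerm 3 ,, constant 0) ,, lit μ̂Data ⟧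
        (nat (base + toℕ c * 4)) (encodeEdge (Vec.lookup constraints c))
    encode-copyContext c = cong₂ pair
      (cong₂ pair (cong nat (toℕ-copy c j₁)) (cong₂ pair (cong nat (toℕ-copy c j₂))
        (cong₂ pair (cong nat (toℕ-copy c j₃)) (cong (λ i → pair (nat i) (nat 0)) (toℕ-copy c j₄)))))
      (cong (λ ds → encodeList (λ u → encodeℚ (μ̂ u)) (tuples ds)) (outs-copies c))

    encode-diagonal : ∀ {d x i} c j → toℕ x ≡ i → Vec.lookup outs x ≡ d → Vec.lookup bounds j ≡ d →
      encodeContext model (diagonalContext d x c j) ≡
      pair (pair (nat i) (pair (nat (base + toℕ c * 4 + toℕ j)) (nat 0))) (diagonalData d)
    encode-diagonal {d} {x} c j x≡i p r = cong₂ pair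
      (cong₂ pair (cong nat x≡i) (cong (λ i → pair (nat i) (nat 0)) (toℕ-copy c j)))
      (cong (λ ds → encodeList (λ u → encodeℚ (diagonal d u)) (tuples ds)) (outs-diagonal {x = x} c j p r))

    encode-contextsOf : ∀ c rest →
      encodeList (encodeContext model) (contextsOf c List.++ rest) ≡
      update pushContexts (nat (base + toℕ c * 4)) (encodeEdge (Vec.lookup constraints c))
        (encodeList (encodeContext model) rest)
    encode-contextsOf c rest = cong₂ pair (encode-copyContext c)
      (cong₂ pair (encode-diagonal c j₁ (trans (toℕ-gate (At.x₁ c)) (cong toℕ (x₁-scopes c))) (outs-gate (At.x₁ c)) refl)
      (cong₂ pair (encode-diagonal c j₂ (trans (toℕ-gate (At.x₂ c)) (cong toℕ (x₂-scopes c))) (outs-gate (At.x₂ c)) refl)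
      (cong₂ pair (encode-diagonal c j₃ (toℕ-colour (At.x₃ c)) (outs-colour (At.x₃ c)) refl)
      (cong (λ e → pair e (encodeList (encodeContext model) rest))
            (encode-diagonal c j₄ (toℕ-colour (At.x₄ c)) (outs-colour (At.x₄ c)) refl)))))

    encode-contexts : encodeList (encodeContext model) (EmpiricalModel.contexts model) ≡ pushAll base scopes
    encode-contexts = trans (flatten (List.allFin #constraints))
      (trans (foldr-pushContexts _ _ base constraints (λ i o → refl))
             (cong (pushAll base) (Vec.toList∘fromList scopes)))
      where
      flatten : ∀ cs → encodeList (encodeContext model) (List.concat (List.map contextsOf cs)) ≡
        List.foldr (λ c o → update pushContexts (nat (base + toℕ c * 4)) (encodeEdge (Vec.lookup constraints c)) o) (nat 0) cs
      flatten []       = refl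
      flatten (c ∷ cs) = trans (encode-contextsOf c _) (cong
        (update pushContexts (nat (base + toℕ c * 4)) (encodeEdge (Vec.lookup constraints c))) (flatten cs))

    input : Data
    input = encodeGraph G

    #vertices-input : #vertices input ≡ nat order
    #vertices-input = trans (iterate-count encodeFin 1 (List.allFin order) 0)
      (cong nat (trans (ℕ.*-identityʳ _) (List.length-tabulate Function.Base.id)))

    encode-edge : ∀ {i j} {u v : Fin vertices} → toℕ u ≡ i → toℕ v ≡ j → encodeEdge (edge u v) ≡ pair (nat i) (nat j)
    encode-edge refl refl = refl

    toℕ-original : ∀ v → toℕ (original v) ≡ toℕ v
    toℕ-original v = Fin.toℕ-↑ˡ v (order + 2)

    toℕ-partner : ∀ v → toℕ (partner v) ≡ order + toℕ v
    toℕ-partner v = trans (Fin.toℕ-↑ʳ order _) (cong (order +_) (Fin.toℕ-↑ˡ v 2))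

    toℕ-extra : ∀ i → toℕ (extra i) ≡ order + (order + toℕ i)
    toℕ-extra i = trans (Fin.toℕ-↑ʳ order _) (cong (order +_) (Fin.toℕ-↑ʳ order i))

    iterate-pushPendant : ∀ xs ys →
      iterate 0 pushPendant (nat order) (encodeList encodeEdge ys) (encodeList encodeFin xs) ≡
      encodeList encodeEdge (List.map pendant xs List.ʳ++ ys)
    iterate-pushPendant []       ys = refl
    iterate-pushPendant (v ∷ xs) ys rewrite sym (encode-edge {u = original v} {v = partner v} (toℕ-original v) (toℕ-partner v)) =
      iterate-pushPendant xs (pendant v ∷ ys)

    encode-edges : ∀ es → encodeList (λ (u , v) → pair (encodeFin u) (encodeFin v)) es ≡
      encodeList encodeEdge (List.map originalEdge es)
    encode-edges []             = refl
    encode-edges ((u , v) ∷ es) = cong₂ pair (sym (encode-edge (toℕ-original u) (toℕ-original v))) (encode-edges es)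

    edgeData-input : edgeData input ≡ encodeList encodeEdge edgeList
    edgeData-input rewrite #vertices-input
                         | sym (encode-edge {u = extra zero} {v = extra (suc zero)} (toℕ-extra zero) (toℕ-extra (suc zero)))
                         | encode-edges edges =
      iterate-pushPendant (List.allFin order) (extraEdge ∷ List.map originalEdge edges)

    contextsData-input : contextsData input ≡ pushAll base scopes
    contextsData-input rewrite edgeData-input | #vertices-input | iterate-count (encodeEdge {vertices}) 4 edgeList base =
      iterate-pushContexts base edgeList []

    encode-replicate : ∀ d n {m} (xs : Vec ℕ m) → encodeList nat (Vec.toList (Vec.replicate n d Vec.++ xs)) ≡
      fold (encodeList nat (Vec.toList xs)) (pair (nat d)) n
    encode-replicate d zero    xs = refl
    encode-replicate d (suc n) xs = cong (pair (nat d)) (encode-replicate d n xs)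

    encode-copies : ∀ m → encodeList nat (Vec.toList (Vec.concat (Vec.replicate m bounds))) ≡
      fold (nat 0) (λ o → pair (nat 2) (pair (nat 2) (pair (nat q) (pair (nat q) o)))) m
    encode-copies zero    = refl
    encode-copies (suc m) = cong (λ o → pair (nat 2) (pair (nat 2) (pair (nat q) (pair (nat q) o)))) (encode-copies m)

    -- The two innermost entries belong to the extra edge; with two more per vertex they make up all
    -- n + (n + 2) colour variables.
    fold-pairs : ∀ n o → fold (pair (nat q) (pair (nat q) o)) (λ o → pair (nat q) (pair (nat q) o)) n ≡
      fold o (pair (nat q)) (n + (n + 2))
    fold-pairs zero    o = refl
    fold-pairs (suc n) o rewrite ℕ.+-suc n (n + 2) = cong (λ o → pair (nat q) (pair (nat q) o)) (fold-pairs n o)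

    outcomesData-input : outcomesData input ≡ encodeList nat (Vec.toList outs)
    outcomesData-input rewrite edgeData-input = cong (λ o → pair (nat 2) (pair (nat 2) o)) (begin
      iterate 0 pushVertex (nat 0) (pair (nat q) (pair (nat q) copied)) (encodeList encodeFin (List.allFin order))
        ≡⟨ iterate-uniform encodeFin (λ o → pair (nat q) (pair (nat q) o)) (λ _ _ → refl) (List.allFin order) _ ⟩
      fold (pair (nat q) (pair (nat q) copied)) (λ o → pair (nat q) (pair (nat q) o)) (List.length (List.allFin order))
        ≡⟨ cong (fold (pair (nat q) (pair (nat q) copied)) (λ o → pair (nat q) (pair (nat q) o)))
             {x = List.length (List.allFin order)} {y = order} (List.length-tabulate Function.Base.id) ⟩
      fold (pair (nat q) (pair (nat q) copied)) (λ o → pair (nat q) (pair (nat q) o)) order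
        ≡⟨ fold-pairs order copied ⟩
      fold copied (pair (nat q)) vertices
        ≡⟨ cong (λ o → fold o (pair (nat q)) vertices) copied-input ⟩
      fold (encodeList nat (Vec.toList (Vec.concat (Vec.replicate #constraints bounds)))) (pair (nat q)) vertices
        ≡⟨ encode-replicate q vertices (Vec.concat (Vec.replicate #constraints bounds)) ⟨
      encodeList nat (Vec.toList (Vec.replicate vertices q Vec.++ Vec.concat (Vec.replicate #constraints bounds))) ∎)
      where
      open ≡-Reasoning
      copied : Data
      copied = iterate 0 pushCopies (nat 0) (nat 0) (encodeList encodeEdge edgeList)
      copied-input : copied ≡ encodeList nat (Vec.toList (Vec.concat (Vec.replicate #constraints bounds)))
      copied-input = trans (iterate-uniform encodeEdge (λ o → pair (nat 2) (pair (nat 2) (pair (nat q) (pair (nat q) o))))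
                             (λ _ _ → refl) edgeList (nat 0))
        (trans (cong (fold (nat 0) _) (sym (List.length-reverse edgeList))) (sym (encode-copies #constraints)))

    reduction-correct : reduction input ≡ encodeModel model
    reduction-correct = cong₂ pair outcomesData-input (trans contextsData-input (sym encode-contexts))

-- Finite sums

𝟙 : Bool → ℚ
𝟙 true  = 1ℚ
𝟙 false = 0ℚ

𝟙-∧ : ∀ a b → 𝟙 (a ∧ b) ≡ 𝟙 a ℚ.* 𝟙 b
𝟙-∧ true  b = sym (ℚ.*-identityˡ (𝟙 b))
𝟙-∧ false b = sym (ℚ.*-zeroˡ (𝟙 b))

module _ {A : Set} where

  ∑-cong : ∀ {f g : A → ℚ} xs → (∀ {x} → x ∈ xs → f x ≡ g x) → ∑ f xs ≡ ∑ g xs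
  ∑-cong []       eq = refl
  ∑-cong (x ∷ xs) eq = cong₂ ℚ._+_ (eq (here refl)) (∑-cong xs (eq ∘ there))

  ∑-mono : ∀ {f g : A → ℚ} xs → (∀ {x} → x ∈ xs → f x ℚ.≤ g x) → ∑ f xs ℚ.≤ ∑ g xs
  ∑-mono []       le = ℚ.≤-refl
  ∑-mono (x ∷ xs) le = ℚ.+-mono-≤ (le (here refl)) (∑-mono xs (le ∘ there))

  ∑-const : ∀ k (xs : List A) → ∑ (λ _ → k) xs ≡ ∑ (λ _ → 1ℚ) xs ℚ.* k
  ∑-const k []       = sym (ℚ.*-zeroˡ k)
  ∑-const k (x ∷ xs) = trans (cong₂ ℚ._+_ (sym (ℚ.*-identityˡ k)) (∑-const k xs)) (sym (ℚ.*-distribʳ-+ k 1ℚ (∑ (λ _ → 1ℚ) xs)))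

  ∑-zero : ∀ (xs : List A) → ∑ (λ _ → 0ℚ) xs ≡ 0ℚ
  ∑-zero xs = trans (∑-const 0ℚ xs) (ℚ.*-zeroʳ (∑ (λ _ → 1ℚ) xs))

  ∑-+ : ∀ (f g : A → ℚ) xs → ∑ (λ x → f x ℚ.+ g x) xs ≡ ∑ f xs ℚ.+ ∑ g xs
  ∑-+ f g []       = refl
  ∑-+ f g (x ∷ xs) = trans (cong (f x ℚ.+ g x ℚ.+_) (∑-+ f g xs))
    (solve 4 (λ a b c d → a :+ b :+ (c :+ d) := a :+ c :+ (b :+ d)) refl (f x) (g x) (∑ f xs) (∑ g xs))
    where open +-*-Solver

  ∑-*ˡ : ∀ k (f : A → ℚ) xs → ∑ (λ x → k ℚ.* f x) xs ≡ k ℚ.* ∑ f xs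
  ∑-*ˡ k f []       = sym (ℚ.*-zeroʳ k)
  ∑-*ˡ k f (x ∷ xs) = trans (cong (k ℚ.* f x ℚ.+_) (∑-*ˡ k f xs)) (sym (ℚ.*-distribˡ-+ k (f x) (∑ f xs)))

  ∑-++ : ∀ (f : A → ℚ) xs ys → ∑ f (xs List.++ ys) ≡ ∑ f xs ℚ.+ ∑ f ys
  ∑-++ f []       ys = sym (ℚ.+-identityˡ _)
  ∑-++ f (x ∷ xs) ys = trans (cong (f x ℚ.+_) (∑-++ f xs ys)) (sym (ℚ.+-assoc (f x) _ _))

  ∑-map : ∀ {B : Set} (f : A → ℚ) (g : B → A) xs → ∑ f (List.map g xs) ≡ ∑ (f ∘ g) xs
  ∑-map f g []       = refl
  ∑-map f g (x ∷ xs) = cong (f (g x) ℚ.+_) (∑-map f g xs)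

  ∑-nonneg : ∀ {f : A → ℚ} xs → (∀ {x} → x ∈ xs → 0ℚ ℚ.≤ f x) → 0ℚ ℚ.≤ ∑ f xs
  ∑-nonneg {f} xs nn = subst (ℚ._≤ ∑ f xs) (∑-zero xs) (∑-mono xs nn)

  ∑-member : ∀ {f : A → ℚ} xs {x} → (∀ {y} → y ∈ xs → 0ℚ ℚ.≤ f y) → x ∈ xs → f x ℚ.≤ ∑ f xs
  ∑-member {f} (x ∷ xs) nn (here refl) = subst (ℚ._≤ f x ℚ.+ ∑ f xs) (ℚ.+-identityʳ (f x))
    (ℚ.+-monoʳ-≤ (f x) (∑-nonneg xs (nn ∘ there)))
  ∑-member {f} (y ∷ xs) nn (there i) = ℚ.≤-trans (∑-member xs (nn ∘ there) i)
    (subst (ℚ._≤ f y ℚ.+ ∑ f xs) (ℚ.+-identityˡ (∑ f xs)) (ℚ.+-monoˡ-≤ (∑ f xs) (nn (here refl))))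

  -- Marginals are defined by filtering; written with indicators they become sums over all
  -- assignments, whose order can be exchanged.
  ∑-filter : ∀ {P : A → Set} (P? : Decidable P) (f : A → ℚ) xs →
             ∑ f (List.filter P? xs) ≡ ∑ (λ x → 𝟙 (does (P? x)) ℚ.* f x) xs
  ∑-filter P? f []       = refl
  ∑-filter P? f (x ∷ xs) with does (P? x)
  ... | true  = cong₂ ℚ._+_ (sym (ℚ.*-identityˡ (f x))) (∑-filter P? f xs)
  ... | false = trans (∑-filter P? f xs) (sym (trans (cong (ℚ._+ _) (ℚ.*-zeroˡ (f x))) (ℚ.+-identityˡ _)))

  ∑-absent : ∀ (_≟_ : DecidableEquality A) {v} (h : A → ℚ) xs → All (v ≢_) xs →
             ∑ (λ x → 𝟙 (does (v ≟ x)) ℚ.* h x) xs ≡ 0ℚ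
  ∑-absent _≟_ {v} h []       [] = refl
  ∑-absent _≟_ {v} h (x ∷ xs) (v≢x ∷ ps) with v ≟ x
  ... | yes v≡x = ⊥-elim (v≢x v≡x)
  ... | no _    = trans (cong₂ ℚ._+_ (ℚ.*-zeroˡ (h x)) (∑-absent _≟_ h xs ps)) refl

  ∑-delta : ∀ (_≟_ : DecidableEquality A) {v} (h : A → ℚ) {xs} → Unique xs → v ∈ xs →
            ∑ (λ x → 𝟙 (does (v ≟ x)) ℚ.* h x) xs ≡ h v
  ∑-delta _≟_ {v} h {x ∷ xs} (x∉ ∷ u) i with v ≟ x
  ... | yes refl = trans (cong₂ ℚ._+_ (ℚ.*-identityˡ (h x)) (∑-absent _≟_ h xs x∉)) (ℚ.+-identityʳ (h x))
  ... | no v≢x with i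
  ...   | here v≡x = ⊥-elim (v≢x v≡x)
  ...   | there j  = trans (cong (ℚ._+ _) (ℚ.*-zeroˡ (h x))) (trans (ℚ.+-identityˡ _) (∑-delta _≟_ h u j))

∑-swap : ∀ {A B : Set} (f : A → B → ℚ) xs ys → ∑ (λ x → ∑ (f x) ys) xs ≡ ∑ (λ y → ∑ (λ x → f x y) xs) ys
∑-swap f []       ys = sym (∑-zero ys)
∑-swap f (x ∷ xs) ys = trans (cong (∑ (f x) ys ℚ.+_) (∑-swap f xs ys)) (sym (∑-+ (f x) (λ y → ∑ (λ x → f x y) xs) ys))

∑-cartesianProductWith : ∀ {A B C : Set} (f : C → ℚ) (g : A → B → C) xs ys →
  ∑ f (List.cartesianProductWith g xs ys) ≡ ∑ (λ x → ∑ (λ y → f (g x y)) ys) xs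
∑-cartesianProductWith f g []       ys = refl
∑-cartesianProductWith f g (x ∷ xs) ys = trans (∑-++ f (List.map (g x) ys) _)
  (cong₂ ℚ._+_ (∑-map f (g x) ys) (∑-cartesianProductWith f g xs ys))

-- Natural numbers and their reciprocals in ℚ

ι : ℕ → ℚ
ι zero    = 0ℚ
ι (suc n) = 1ℚ ℚ.+ ι n

ι-+ : ∀ m n → ι (m + n) ≡ ι m ℚ.+ ι n
ι-+ zero    n = sym (ℚ.+-identityˡ (ι n))
ι-+ (suc m) n = trans (cong (1ℚ ℚ.+_) (ι-+ m n)) (sym (ℚ.+-assoc 1ℚ (ι m) (ι n)))

ι-* : ∀ m n → ι (m * n) ≡ ι m ℚ.* ι n
ι-* zero    n = sym (ℚ.*-zeroˡ (ι n))
ι-* (suc m) n = trans (ι-+ n (m * n)) (trans (cong₂ ℚ._+_ (sym (ℚ.*-identityˡ (ι n))) (ι-* m n))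
  (sym (ℚ.*-distribʳ-+ (ι n) 1ℚ (ι m))))

∑-upTo-one : ∀ n → ∑ (λ _ → 1ℚ) (List.upTo n) ≡ ι n
∑-upTo-one n = count (λ x → x) n
  where
  count : ∀ (f : ℕ → ℕ) n → ∑ (λ _ → 1ℚ) (List.applyUpTo f n) ≡ ι n
  count f zero    = refl
  count f (suc n) = cong (1ℚ ℚ.+_) (count (f ∘ suc) n)

toℚᵘ-ι : ∀ n → ℚ.toℚᵘ (ι n) ℚᵘ.≃ ℚᵘ.mkℚᵘ (ℤ.+ n) 0
toℚᵘ-ι zero    = ℚᵘ.≃-refl
toℚᵘ-ι (suc n) = ℚᵘ.≃-trans (ℚ.toℚᵘ-homo-+ 1ℚ (ι n))
  (ℚᵘ.≃-trans (ℚᵘ.+-cong (ℚᵘ.≃-refl {ℚ.toℚᵘ 1ℚ}) (toℚᵘ-ι n)) (ℚᵘ.*≡* (cong (λ k → (ℤ.+ 1 ℤ.+ k) ℤ.* ℤ.+ 1) (ℤ.*-identityʳ (ℤ.+ n)))))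

-- Verified in unnormalised rationals, where the factors are the literal fractions n / 1 and 1 / n
-- and no gcd intervenes.
ι-recip : ∀ n .{{_ : NonZero n}} → ι n ℚ.* recip n ≡ 1ℚ
ι-recip (suc n) = ℚ.toℚᵘ-injective (ℚᵘ.≃-trans (ℚ.toℚᵘ-homo-* (ι (suc n)) (recip (suc n)))
  (ℚᵘ.≃-trans (ℚᵘ.*-cong (toℚᵘ-ι (suc n)) (ℚ.toℚᵘ-fromℚᵘ (ℚᵘ.mkℚᵘ (ℤ.+ 1) n)))
    (ℚᵘ.*≡* (trans (ℤ.*-identityʳ _) (trans (ℤ.*-identityʳ (ℤ.+ suc n)) (sym (trans (ℤ.*-identityˡ _) (ℤ.*-identityˡ _))))))))

recip-unique : ∀ n x → ι (suc n) ℚ.* x ≡ 1ℚ → x ≡ recip (suc n)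
recip-unique n x eq = begin
  x                                      ≡⟨ ℚ.*-identityˡ x ⟨
  1ℚ ℚ.* x                               ≡⟨ cong (ℚ._* x) (ι-recip (suc n)) ⟨
  ι (suc n) ℚ.* recip (suc n) ℚ.* x      ≡⟨ solve 3 (λ a b c → a :* b :* c := a :* c :* b) refl (ι (suc n)) (recip (suc n)) x ⟩
  ι (suc n) ℚ.* x ℚ.* recip (suc n)      ≡⟨ cong (ℚ._* recip (suc n)) eq ⟩
  1ℚ ℚ.* recip (suc n)                   ≡⟨ ℚ.*-identityˡ _ ⟩
  recip (suc n)                          ∎
  where open ≡-Reasoning
        open +-*-Solver

recip-* : ∀ m n → recip (m * n) ≡ recip m ℚ.* recip n
recip-* zero    n       = sym (ℚ.*-zeroˡ (recip n))
recip-* (suc m) zero    = trans (cong recip (ℕ.*-zeroʳ m)) (sym (ℚ.*-zeroʳ (recip (suc m))))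
recip-* (suc m) (suc n) = sym (recip-unique (n + m * suc n) _ (begin
  ι (suc m * suc n) ℚ.* (recip (suc m) ℚ.* recip (suc n))
    ≡⟨ cong (ℚ._* (recip (suc m) ℚ.* recip (suc n))) (ι-* (suc m) (suc n)) ⟩
  ι (suc m) ℚ.* ι (suc n) ℚ.* (recip (suc m) ℚ.* recip (suc n))
    ≡⟨ solve 4 (λ a b c d → a :* b :* (c :* d) := a :* c :* (b :* d)) refl (ι (suc m)) (ι (suc n)) (recip (suc m)) (recip (suc n)) ⟩
  ι (suc m) ℚ.* recip (suc m) ℚ.* (ι (suc n) ℚ.* recip (suc n))
    ≡⟨ cong₂ ℚ._*_ (ι-recip (suc m)) (ι-recip (suc n)) ⟩
  1ℚ ∎))
  where open ≡-Reasoning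
        open +-*-Solver

recip-nonneg : ∀ n → 0ℚ ℚ.≤ recip n
recip-nonneg zero    = ℚ.≤-refl
recip-nonneg (suc n) = ℚ.nonNegative⁻¹ (recip (suc n)) {{ℚ.normalize-nonNeg 1 (suc n)}}

*-nonneg : ∀ {x y} → 0ℚ ℚ.≤ x → 0ℚ ℚ.≤ y → 0ℚ ℚ.≤ x ℚ.* y
*-nonneg {x} {y} x≥0 y≥0 = subst (ℚ._≤ x ℚ.* y) (ℚ.*-zeroˡ y) (ℚ.*-monoʳ-≤-nonNeg y {{ℚ.nonNegative y≥0}} x≥0)

unique-tuples : ∀ {n} (ds : Vec ℕ n) → Unique (tuples ds)
unique-tuples []       = [] ∷ []
unique-tuples (d ∷ ds) = Unique.cartesianProductWith⁺ _∷_ (λ { refl → refl , refl }) (Unique.upTo⁺ d) (unique-tuples ds)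

∈-tuples⁺ : ∀ {n} {xs ds : Vec ℕ n} → Pointwise _<_ xs ds → xs ∈ tuples ds
∈-tuples⁺ []       = here refl
∈-tuples⁺ (p ∷ ps) = ∈.∈-cartesianProductWith⁺ _∷_ (∈.∈-upTo⁺ p) (∈-tuples⁺ ps)

∈-tuples⁻ : ∀ {n} {xs} (ds : Vec ℕ n) → xs ∈ tuples ds → Pointwise _<_ xs ds
∈-tuples⁻ []       (here refl) = []
∈-tuples⁻ (d ∷ ds) i with ∈.∈-cartesianProductWith⁻ _∷_ (List.upTo d) (tuples ds) i
... | a , b , a∈ , b∈ , refl = ∈.∈-upTo⁻ a∈ ∷ ∈-tuples⁻ ds b∈

-- Finite distributions

-- Weighted lists, with repetitions and arbitrary total weight. The points will be functions, which
-- have no decidable equality to collect equal ones, so a distribution is observed only through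
-- expectations.
Dist : Set → Set
Dist A = List (ℚ × A)

𝔼 : ∀ {A} → Dist A → (A → ℚ) → ℚ
𝔼 D φ = ∑ (λ (w , x) → w ℚ.* φ x) D

NonNegative : ∀ {A} → Dist A → Set
NonNegative D = All (λ (w , _) → 0ℚ ℚ.≤ w) D

module _ {A : Set} where

  𝔼-cong : ∀ (D : Dist A) {φ ψ} → (∀ x → φ x ≡ ψ x) → 𝔼 D φ ≡ 𝔼 D ψ
  𝔼-cong D eq = ∑-cong D λ {(w , x)} _ → cong (w ℚ.*_) (eq x)

  scale : ℚ → Dist A → Dist A
  scale k = List.map (λ (w , x) → k ℚ.* w , x)

  𝔼-scale : ∀ k (D : Dist A) φ → 𝔼 (scale k D) φ ≡ k ℚ.* 𝔼 D φ
  𝔼-scale k D φ = trans (∑-map _ _ D) (trans (∑-cong D (λ {(w , x)} _ → ℚ.*-assoc k w (φ x)))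
    (∑-*ˡ k (λ (w , x) → w ℚ.* φ x) D))

  𝔼-++ : ∀ (D E : Dist A) φ → 𝔼 (D List.++ E) φ ≡ 𝔼 D φ ℚ.+ 𝔼 E φ
  𝔼-++ D E φ = ∑-++ _ D E

  scale-nonneg : ∀ {k} {D : Dist A} → 0ℚ ℚ.≤ k → NonNegative D → NonNegative (scale k D)
  scale-nonneg k≥0 D≥0 = All.map⁺ (All.map (*-nonneg k≥0) D≥0)

  𝔼-*ˡ : ∀ k (D : Dist A) φ → 𝔼 D (λ x → k ℚ.* φ x) ≡ k ℚ.* 𝔼 D φ
  𝔼-*ˡ k D φ = trans (∑-cong D (λ {(w , x)} _ → swap w (φ x))) (∑-*ˡ k (λ (w , x) → w ℚ.* φ x) D)
    where
    open +-*-Solver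
    swap : ∀ w y → w ℚ.* (k ℚ.* y) ≡ k ℚ.* (w ℚ.* y)
    swap = solve 3 (λ k w y → w :* (k :* y) := k :* (w :* y)) refl k

module _ {A B : Set} where

  mapDist : (A → B) → Dist A → Dist B
  mapDist f = List.map (λ (w , x) → w , f x)

  𝔼-map : ∀ (f : A → B) D φ → 𝔼 (mapDist f D) φ ≡ 𝔼 D (φ ∘ f)
  𝔼-map f D φ = ∑-map _ _ D

  bind : Dist A → (A → Dist B) → Dist B
  bind D k = List.concat (List.map (λ (w , x) → scale w (k x)) D)

  𝔼-bind : ∀ D (k : A → Dist B) φ → 𝔼 (bind D k) φ ≡ 𝔼 D (λ x → 𝔼 (k x) φ)
  𝔼-bind []            k φ = refl
  𝔼-bind ((w , x) ∷ D) k φ = trans (𝔼-++ (scale w (k x)) _ φ) (cong₂ ℚ._+_ (𝔼-scale w (k x) φ) (𝔼-bind D k φ))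

  map-nonneg : ∀ {f : A → B} {D} → NonNegative D → NonNegative (mapDist f D)
  map-nonneg D≥0 = All.map⁺ D≥0

  bind-nonneg : ∀ {D} {k : A → Dist B} → NonNegative D → (∀ x → NonNegative (k x)) → NonNegative (bind D k)
  bind-nonneg []         k≥0 = []
  bind-nonneg {D = (w , x) ∷ D} (w≥0 ∷ D≥0) k≥0 = All.++⁺ (scale-nonneg w≥0 (k≥0 x)) (bind-nonneg D≥0 k≥0)

uniform : ∀ n → Dist (Fin n)
uniform n = List.map (λ i → recip n , i) (List.allFin n)

uniform-nonneg : ∀ n → NonNegative (uniform n)
uniform-nonneg n = All.map⁺ (All.universal (λ _ → recip-nonneg n) (List.allFin n))

∑-tabulate : ∀ {A : Set} (φ : A → ℚ) {n} (f : Fin n → A) → ∑ φ (List.tabulate f) ≡ sum (φ ∘ f)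
∑-tabulate φ {zero}  f = refl
∑-tabulate φ {suc n} f = cong (φ (f zero) ℚ.+_) (∑-tabulate φ (f ∘ suc))

𝔼-uniform : ∀ n φ → 𝔼 (uniform n) φ ≡ recip n ℚ.* sum φ
𝔼-uniform n φ = trans (∑-map _ _ (List.allFin n))
  (trans (∑-tabulate (λ i → recip n ℚ.* φ i) {n} (λ i → i)) (sym (*-distribˡ-sum (recip n) φ)))

sum-const : ∀ n k → sum {n} (λ _ → k) ≡ ι n ℚ.* k
sum-const zero    k = sym (ℚ.*-zeroˡ k)
sum-const (suc n) k = trans (cong₂ ℚ._+_ (sym (ℚ.*-identityˡ k)) (sum-const n k)) (sym (ℚ.*-distribʳ-+ k 1ℚ (ι n)))

recip-sum-const : ∀ n .{{_ : NonZero n}} k → recip n ℚ.* sum {n} (λ _ → k) ≡ k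
recip-sum-const n k = begin
  recip n ℚ.* sum {n} (λ _ → k)   ≡⟨ cong (recip n ℚ.*_) (sum-const n k) ⟩
  recip n ℚ.* (ι n ℚ.* k)         ≡⟨ solve 3 (λ a b c → a :* (b :* c) := b :* a :* c) refl (recip n) (ι n) k ⟩
  ι n ℚ.* recip n ℚ.* k           ≡⟨ cong (ℚ._* k) (ι-recip n) ⟩
  1ℚ ℚ.* k                        ≡⟨ ℚ.*-identityˡ k ⟩
  k                               ∎
  where open ≡-Reasoning
        open +-*-Solver

sum-punchIn : ∀ {n} c (φ : Fin (suc n) → ℚ) → sum (φ ∘ punchIn c) ≡ sum φ ℚ.- φ c
sum-punchIn c φ = trans (rearrange (φ c) (sum (φ ∘ punchIn c))) (cong (ℚ._- φ c) (sym (sum-remove {i = c} φ)))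
  where
  open +-*-Solver
  rearrange : ∀ a s → s ≡ a ℚ.+ s ℚ.- a
  rearrange = solve 2 (λ a s → s := a :+ s :- a) refl

sum-- : ∀ {n} (φ ψ : Fin n → ℚ) → sum (λ i → φ i ℚ.- ψ i) ≡ sum φ ℚ.- sum ψ
sum-- {zero}  φ ψ = refl
sum-- {suc n} φ ψ = trans (cong (φ zero ℚ.- ψ zero ℚ.+_) (sum-- (φ ∘ suc) (ψ ∘ suc)))
  (solve 4 (λ a b c d → a :- b :+ (c :- d) := a :+ c :- (b :+ d)) refl (φ zero) (ψ zero) (sum (φ ∘ suc)) (sum (ψ ∘ suc)))
  where open +-*-Solver

-- Uniform random functions and permutations

randomFunction : ∀ q n → Dist (Fin n → Fin q)
randomFunction q zero    = (1ℚ , λ ()) ∷ []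
randomFunction q (suc n) = bind (uniform q) λ a → mapDist (a Vector.∷_) (randomFunction q n)

-- Draw the image a of 0, then carry a random permutation of one point fewer onto the values other
-- than a by `punchIn a`.
randomPermutation : ∀ n → Dist (Fin n → Fin n)
randomPermutation zero    = (1ℚ , λ ()) ∷ []
randomPermutation (suc n) = bind (uniform (suc n)) λ a → mapDist (λ τ → a Vector.∷ (punchIn a ∘ τ)) (randomPermutation n)

randomFunction-nonneg : ∀ q n → NonNegative (randomFunction q n)
randomFunction-nonneg q zero    = ℚ.nonNegative⁻¹ 1ℚ ∷ []
randomFunction-nonneg q (suc n) = bind-nonneg (uniform-nonneg q) λ _ → map-nonneg (randomFunction-nonneg q n)

randomPermutation-nonneg : ∀ n → NonNegative (randomPermutation n)
randomPermutation-nonneg zero    = ℚ.nonNegative⁻¹ 1ℚ ∷ []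
randomPermutation-nonneg (suc n) = bind-nonneg (uniform-nonneg (suc n)) λ _ → map-nonneg (randomPermutation-nonneg n)

𝔼-randomFunction : ∀ q n φ →
  𝔼 (randomFunction q (suc n)) φ ≡ recip q ℚ.* sum (λ a → 𝔼 (randomFunction q n) (λ h → φ (a Vector.∷ h)))
𝔼-randomFunction q n φ = trans (𝔼-bind (uniform q) _ φ) (trans (𝔼-uniform q _)
  (cong (recip q ℚ.*_) (sum-cong-≗ λ a → 𝔼-map (a Vector.∷_) (randomFunction q n) φ)))

𝔼-randomPermutation : ∀ n φ → 𝔼 (randomPermutation (suc n)) φ ≡
  recip (suc n) ℚ.* sum (λ a → 𝔼 (randomPermutation n) (λ τ → φ (a Vector.∷ (punchIn a ∘ τ))))
𝔼-randomPermutation n φ = trans (𝔼-bind (uniform (suc n)) (λ a → mapDist (λ τ → a Vector.∷ (punchIn a ∘ τ)) (randomPermutation n)) φ) (trans (𝔼-uniform (suc n) _)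
  (cong (recip (suc n) ℚ.*_) (sum-cong-≗ λ a → 𝔼-map (λ τ → a Vector.∷ (punchIn a ∘ τ)) (randomPermutation n) φ)))

module _ (q : ℕ) .{{_ : NonZero q}} where

  randomFunction-total : ∀ n k → 𝔼 (randomFunction q n) (λ _ → k) ≡ k
  randomFunction-total zero    k = trans (ℚ.+-identityʳ (1ℚ ℚ.* k)) (ℚ.*-identityˡ k)
  randomFunction-total (suc n) k = trans (𝔼-randomFunction q n (λ _ → k))
    (trans (cong (recip q ℚ.*_) (sum-cong-≗ {q} λ _ → randomFunction-total n k)) (recip-sum-const q k))

  randomFunction-at : ∀ {n} (i : Fin n) φ → 𝔼 (randomFunction q n) (λ h → φ (h i)) ≡ recip q ℚ.* sum φ
  randomFunction-at {suc n} zero φ = trans (𝔼-randomFunction q n _)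
    (cong (recip q ℚ.*_) (sum-cong-≗ λ a → randomFunction-total n (φ a)))
  randomFunction-at {suc n} (suc i) φ = trans (𝔼-randomFunction q n _)
    (trans (cong (recip q ℚ.*_) (sum-cong-≗ {q} λ a → randomFunction-at i φ)) (recip-sum-const q _))

  -- Once one of the two points is 0, its value is the fresh draw, a constant factor in the
  -- expectation over the remaining values.
  randomFunction-at₂ : ∀ {n} {i j : Fin n} → i ≢ j → ∀ φ ψ →
    𝔼 (randomFunction q n) (λ h → φ (h i) ℚ.* ψ (h j)) ≡ (recip q ℚ.* sum φ) ℚ.* (recip q ℚ.* sum ψ)
  randomFunction-at₂ {suc n} {zero} {zero} i≢j φ ψ = ⊥-elim (i≢j refl)
  randomFunction-at₂ {suc n} {zero} {suc j} i≢j φ ψ = begin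
    𝔼 (randomFunction q (suc n)) (λ h → φ (h zero) ℚ.* ψ (h (suc j)))
      ≡⟨ 𝔼-randomFunction q n _ ⟩
    recip q ℚ.* sum (λ a → 𝔼 (randomFunction q n) (λ h → φ a ℚ.* ψ (h j)))
      ≡⟨ cong (recip q ℚ.*_) (sum-cong-≗ λ a → trans (𝔼-*ˡ (φ a) (randomFunction q n) (λ h → ψ (h j)))
           (trans (cong (φ a ℚ.*_) (randomFunction-at j ψ)) (ℚ.*-comm (φ a) _))) ⟩
    recip q ℚ.* sum (λ a → recip q ℚ.* sum ψ ℚ.* φ a)
      ≡⟨ cong (recip q ℚ.*_) (*-distribˡ-sum (recip q ℚ.* sum ψ) φ) ⟨
    recip q ℚ.* (recip q ℚ.* sum ψ ℚ.* sum φ)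
      ≡⟨ solve 3 (λ r a b → r :* (r :* a :* b) := r :* b :* (r :* a)) refl (recip q) (sum ψ) (sum φ) ⟩
    recip q ℚ.* sum φ ℚ.* (recip q ℚ.* sum ψ) ∎
    where open ≡-Reasoning
          open +-*-Solver
  randomFunction-at₂ {suc n} {suc i} {zero} i≢j φ ψ =
    trans (𝔼-cong (randomFunction q (suc n)) (λ h → ℚ.*-comm (φ (h (suc i))) (ψ (h zero))))
      (trans (randomFunction-at₂ (i≢j ∘ sym) ψ φ) (ℚ.*-comm _ (recip q ℚ.* sum φ)))
  randomFunction-at₂ {suc n} {suc i} {suc j} i≢j φ ψ = trans (𝔼-randomFunction q n _)
    (trans (cong (recip q ℚ.*_) (sum-cong-≗ {q} λ a → randomFunction-at₂ (i≢j ∘ cong suc) φ ψ))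
      (recip-sum-const q _))

randomPermutation-total : ∀ n k → 𝔼 (randomPermutation n) (λ _ → k) ≡ k
randomPermutation-total zero    k = trans (ℚ.+-identityʳ (1ℚ ℚ.* k)) (ℚ.*-identityˡ k)
randomPermutation-total (suc n) k = trans (𝔼-randomPermutation n (λ _ → k))
  (trans (cong (recip (suc n) ℚ.*_) (sum-cong-≗ {suc n} λ _ → randomPermutation-total n k)) (recip-sum-const (suc n) k))

-- At suc i the value avoids the first draw a. Summed over the 2 + n draws every value is counted
-- for all but one of them, and the resulting factor `ι (suc n)` cancels `recip (suc n)`.
randomPermutation-at : ∀ {n} (i : Fin n) φ → 𝔼 (randomPermutation n) (λ σ → φ (σ i)) ≡ recip n ℚ.* sum φ
randomPermutation-at {suc n} zero φ = trans (𝔼-randomPermutation n _)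
  (cong (recip (suc n) ℚ.*_) (sum-cong-≗ λ a → randomPermutation-total n (φ a)))
randomPermutation-at {suc (suc n)} (suc i) φ = trans (𝔼-randomPermutation (suc n) _) (cong (recip (2 + n) ℚ.*_) (begin
  sum (λ a → 𝔼 (randomPermutation (suc n)) (λ τ → φ (punchIn a (τ i))))
    ≡⟨ sum-cong-≗ (λ a → trans (randomPermutation-at i (φ ∘ punchIn a)) (cong (recip (suc n) ℚ.*_) (sum-punchIn a φ))) ⟩
  sum (λ a → recip (suc n) ℚ.* (sum φ ℚ.- φ a))
    ≡⟨ *-distribˡ-sum (recip (suc n)) (λ a → sum φ ℚ.- φ a) ⟨
  recip (suc n) ℚ.* sum (λ a → sum φ ℚ.- φ a)
    ≡⟨ cong (recip (suc n) ℚ.*_) (trans (sum-- (λ _ → sum φ) φ) (cong (ℚ._- sum φ) (sum-const (2 + n) (sum φ)))) ⟩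
  recip (suc n) ℚ.* (ι (2 + n) ℚ.* sum φ ℚ.- sum φ)
    ≡⟨ solve 3 (λ r m s → r :* ((con 1ℚ :+ m) :* s :- s) := m :* r :* s) refl (recip (suc n)) (ι (suc n)) (sum φ) ⟩
  ι (suc n) ℚ.* recip (suc n) ℚ.* sum φ
    ≡⟨ cong (ℚ._* sum φ) (ι-recip (suc n)) ⟩
  1ℚ ℚ.* sum φ
    ≡⟨ ℚ.*-identityˡ (sum φ) ⟩
  sum φ ∎))
  where open ≡-Reasoning
        open +-*-Solver

-- The sum over ordered pairs of distinct elements, written as a difference so that ring identities
-- apply to it.
offDiagonal : ∀ {n} → (Fin n → Fin n → ℚ) → ℚ
offDiagonal Φ = sum (λ a → sum (Φ a)) ℚ.- sum (λ a → Φ a a)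

-- Row c and column c are removed. Each of the two full sums contains `Φ c c`, which `offDiagonal Φ`
-- does not, so it is restored twice.
offDiagonal-punchIn : ∀ {n} c (Φ : Fin (suc n) → Fin (suc n) → ℚ) →
  offDiagonal (λ x y → Φ (punchIn c x) (punchIn c y)) ≡
  offDiagonal Φ ℚ.- sum (Φ c) ℚ.- sum (λ x → Φ x c) ℚ.+ Φ c c ℚ.+ Φ c c
offDiagonal-punchIn c Φ = begin
  sum (λ x → sum (Φ (punchIn c x) ∘ punchIn c)) ℚ.- sum (λ x → Φ (punchIn c x) (punchIn c x))
    ≡⟨ cong₂ ℚ._-_ (sum-cong-≗ (λ x → sum-punchIn c (Φ (punchIn c x)))) (sum-punchIn c (λ x → Φ x x)) ⟩
  sum (λ x → row (punchIn c x)) ℚ.- (sum (λ x → Φ x x) ℚ.- Φ c c)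
    ≡⟨ cong (ℚ._- (sum (λ x → Φ x x) ℚ.- Φ c c)) (sum-punchIn c row) ⟩
  sum row ℚ.- row c ℚ.- (sum (λ x → Φ x x) ℚ.- Φ c c)
    ≡⟨ cong (λ s → s ℚ.- row c ℚ.- (sum (λ x → Φ x x) ℚ.- Φ c c)) (sum-- (λ x → sum (Φ x)) (λ x → Φ x c)) ⟩
  sum (λ x → sum (Φ x)) ℚ.- sum (λ x → Φ x c) ℚ.- (sum (Φ c) ℚ.- Φ c c) ℚ.- (sum (λ x → Φ x x) ℚ.- Φ c c)
    ≡⟨ solve 5 (λ s d r k e → s :- k :- (r :- e) :- (d :- e) := s :- d :- r :- k :+ e :+ e) refl
         (sum (λ x → sum (Φ x))) (sum (λ x → Φ x x)) (sum (Φ c)) (sum (λ x → Φ x c)) (Φ c c) ⟩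
  offDiagonal Φ ℚ.- sum (Φ c) ℚ.- sum (λ x → Φ x c) ℚ.+ Φ c c ℚ.+ Φ c c ∎
  where
  open ≡-Reasoning
  open +-*-Solver
  row = λ x → sum (Φ x) ℚ.- Φ x c

-- An ordered pair of distinct elements survives the deletion of c for exactly n of the 2 + n
-- choices of c.
sum-offDiagonal-punchIn : ∀ {n} (Φ : Fin (2 + n) → Fin (2 + n) → ℚ) →
  sum (λ c → offDiagonal (λ x y → Φ (punchIn c x) (punchIn c y))) ≡ ι n ℚ.* offDiagonal Φ
sum-offDiagonal-punchIn {n} Φ = begin
  sum (λ c → offDiagonal (λ x y → Φ (punchIn c x) (punchIn c y)))
    ≡⟨ sum-cong-≗ (λ c → offDiagonal-punchIn c Φ) ⟩
  sum (λ c → offDiagonal Φ ℚ.- sum (Φ c) ℚ.- sum (λ x → Φ x c) ℚ.+ Φ c c ℚ.+ Φ c c)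
    ≡⟨ trans (∑-distrib-+ (λ c → offDiagonal Φ ℚ.- sum (Φ c) ℚ.- sum (λ x → Φ x c) ℚ.+ Φ c c) diag)
         (cong (ℚ._+ sum diag) (trans (∑-distrib-+ (λ c → offDiagonal Φ ℚ.- sum (Φ c) ℚ.- sum (λ x → Φ x c)) diag)
         (cong (ℚ._+ sum diag) (trans (sum-- (λ c → offDiagonal Φ ℚ.- sum (Φ c)) (λ c → sum (λ x → Φ x c)))
         (cong₂ ℚ._-_ (trans (sum-- (λ _ → offDiagonal Φ) (λ c → sum (Φ c))) (cong (ℚ._- total) (sum-const (2 + n) (offDiagonal Φ))))
                      (∑-comm (λ c x → Φ x c))))))) ⟩
  ι (2 + n) ℚ.* offDiagonal Φ ℚ.- total ℚ.- total ℚ.+ sum diag ℚ.+ sum diag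
    ≡⟨ solve 3 (λ m s d → (con 1ℚ :+ (con 1ℚ :+ m)) :* (s :- d) :- s :- s :+ d :+ d := m :* (s :- d)) refl (ι n) total (sum diag) ⟩
  ι n ℚ.* offDiagonal Φ ∎
  where
  open ≡-Reasoning
  open +-*-Solver
  diag  = λ c → Φ c c
  total = sum (λ a → sum (Φ a))

-- If one of the points is 0, fix its value and apply the one-point law to the other. Otherwise fix
-- the value c at 0 and average the inductive law over c.
randomPermutation-at₂ : ∀ {n} {i j : Fin n} → i ≢ j → ∀ Φ →
  𝔼 (randomPermutation n) (λ σ → Φ (σ i) (σ j)) ≡ recip n ℚ.* (recip (n ∸ 1) ℚ.* offDiagonal Φ)
randomPermutation-at₂ {suc n} {zero} {zero} i≢j Φ = ⊥-elim (i≢j refl)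
randomPermutation-at₂ {suc n} {zero} {suc j} i≢j Φ = trans (𝔼-randomPermutation n _) (cong (recip (suc n) ℚ.*_) (begin
  sum (λ a → 𝔼 (randomPermutation n) (λ τ → Φ a (punchIn a (τ j))))
    ≡⟨ sum-cong-≗ (λ a → trans (randomPermutation-at j (Φ a ∘ punchIn a)) (cong (recip n ℚ.*_) (sum-punchIn a (Φ a)))) ⟩
  sum (λ a → recip n ℚ.* (sum (Φ a) ℚ.- Φ a a))
    ≡⟨ *-distribˡ-sum (recip n) (λ a → sum (Φ a) ℚ.- Φ a a) ⟨
  recip n ℚ.* sum (λ a → sum (Φ a) ℚ.- Φ a a)
    ≡⟨ cong (recip n ℚ.*_) (sum-- (λ a → sum (Φ a)) (λ a → Φ a a)) ⟩
  recip n ℚ.* offDiagonal Φ ∎))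
  where open ≡-Reasoning
randomPermutation-at₂ {suc n} {suc i} {zero} i≢j Φ = trans (randomPermutation-at₂ (i≢j ∘ sym) (λ x y → Φ y x))
  (cong (λ s → recip (suc n) ℚ.* (recip n ℚ.* (s ℚ.- sum (λ a → Φ a a)))) (∑-comm (λ x y → Φ y x)))
randomPermutation-at₂ {suc (suc zero)} {suc zero} {suc zero} i≢j Φ = ⊥-elim (i≢j refl)
-- Two distinct points besides 0 require at least three points; then `recip (suc n)` from the
-- inductive law meets the factor `ι (suc n)`, which is positive and cancels it.
randomPermutation-at₂ {suc (suc (suc n))} {suc i} {suc j} i≢j Φ =
  trans (𝔼-randomPermutation (2 + n) _) (cong (recip (3 + n) ℚ.*_) (begin
  sum (λ c → 𝔼 (randomPermutation (2 + n)) (λ τ → Φ (punchIn c (τ i)) (punchIn c (τ j))))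
    ≡⟨ sum-cong-≗ (λ c → trans (randomPermutation-at₂ (i≢j ∘ cong suc) (λ x y → Φ (punchIn c x) (punchIn c y)))
                               (sym (ℚ.*-assoc (recip (2 + n)) (recip (suc n)) _))) ⟩
  sum (λ c → recip (2 + n) ℚ.* recip (suc n) ℚ.* offDiagonal (λ x y → Φ (punchIn c x) (punchIn c y)))
    ≡⟨ *-distribˡ-sum (recip (2 + n) ℚ.* recip (suc n)) (λ c → offDiagonal (λ x y → Φ (punchIn c x) (punchIn c y))) ⟨
  recip (2 + n) ℚ.* recip (suc n) ℚ.* sum (λ c → offDiagonal (λ x y → Φ (punchIn c x) (punchIn c y)))
    ≡⟨ cong (recip (2 + n) ℚ.* recip (suc n) ℚ.*_) (sum-offDiagonal-punchIn Φ) ⟩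
  recip (2 + n) ℚ.* recip (suc n) ℚ.* (ι (suc n) ℚ.* offDiagonal Φ)
    ≡⟨ solve 4 (λ a b c d → a :* b :* (c :* d) := a :* (c :* b :* d)) refl (recip (2 + n)) (recip (suc n)) (ι (suc n)) (offDiagonal Φ) ⟩
  recip (2 + n) ℚ.* (ι (suc n) ℚ.* recip (suc n) ℚ.* offDiagonal Φ)
    ≡⟨ cong (recip (2 + n) ℚ.*_) (trans (cong (ℚ._* offDiagonal Φ) (ι-recip (suc n))) (ℚ.*-identityˡ (offDiagonal Φ))) ⟩
  recip (2 + n) ℚ.* offDiagonal Φ ∎))
  where open ≡-Reasoning
        open +-*-Solver

-- Empirical models as mixtures

module Model (e : EmpiricalModel) where
  open EmpiricalModel e

  _≟_ : ∀ {n} (xs ys : Vec ℕ n) → _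
  _≟_ = Vec.≡-dec ℕ._≟_

  restrict∈localOutcomes : ∀ {g} → g ∈ globalAssignments e → ∀ C → restrict e g C ∈ localOutcomes e C
  restrict∈localOutcomes {g} g∈ C = ∈-tuples⁺ (restricted (Context.scope C))
    where
    restricted : ∀ {n} (s : Vec (Fin observables) n) → Pointwise _<_ (Vec.map (Vec.lookup g) s) (Vec.map (Vec.lookup outcomes) s)
    restricted []      = []
    restricted (i ∷ s) = Pointwise.lookup (∈-tuples⁻ outcomes g∈) i ∷ restricted s

  -- Every global assignment restricts to exactly one local outcome, so a single context sees the
  -- whole weight.
  weight-marginals : ∀ b C → weight e b ≡ ∑ (marginal e b C) (localOutcomes e C)
  weight-marginals b C = sym (begin
    ∑ (marginal e b C) (localOutcomes e C)
      ≡⟨ ∑-cong (localOutcomes e C) (λ {u} _ → ∑-filter (λ g → restrict e g C ≟ u) b (globalAssignments e)) ⟩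
    ∑ (λ u → ∑ (λ g → 𝟙 (does (restrict e g C ≟ u)) ℚ.* b g) (globalAssignments e)) (localOutcomes e C)
      ≡⟨ ∑-swap (λ u g → 𝟙 (does (restrict e g C ≟ u)) ℚ.* b g) (localOutcomes e C) (globalAssignments e) ⟩
    ∑ (λ g → ∑ (λ u → 𝟙 (does (restrict e g C ≟ u)) ℚ.* b g) (localOutcomes e C)) (globalAssignments e)
      ≡⟨ ∑-cong (globalAssignments e) (λ {g} g∈ → ∑-delta _≟_ (λ _ → b g) (unique-tuples (Vec.map (Vec.lookup outcomes) (Context.scope C))) (restrict∈localOutcomes g∈ C)) ⟩
    weight e b ∎)
    where open ≡-Reasoning

  module _ {b} (feasible : Feasible e b) where

    0≤b : ∀ {g} → g ∈ globalAssignments e → 0ℚ ℚ.≤ b g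
    0≤b = All.lookup (proj₁ feasible)

    marginal≤table : ∀ {C u} → C ∈ contexts → u ∈ localOutcomes e C → marginal e b C u ℚ.≤ Context.table C u
    marginal≤table C∈ u∈ = All.lookup (All.lookup (proj₂ feasible) C∈) u∈

    -- A nonnegative weight is at most any marginal it contributes to. Hence a positive weight
    -- forces a positive table entry in every context.
    b≤table : ∀ {C g} → C ∈ contexts → g ∈ globalAssignments e → b g ℚ.≤ Context.table C (restrict e g C)
    b≤table {C} {g} C∈ g∈ = ℚ.≤-trans
      (∑-member _ (λ h∈ → 0≤b (proj₁ (∈.∈-filter⁻ P? {xs = globalAssignments e} h∈))) (∈.∈-filter⁺ P? g∈ refl))
      (marginal≤table C∈ (restrict∈localOutcomes g∈ C))
      where P? = λ h → restrict e h C ≟ restrict e g C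

    weight≤ : ∀ {C} (T : Vec ℕ (Context.arity C) → ℚ) →
      (∀ {u} → u ∈ localOutcomes e C → marginal e b C u ℚ.≤ T u) → weight e b ℚ.≤ ∑ T (localOutcomes e C)
    weight≤ {C} T le = subst (ℚ._≤ ∑ T (localOutcomes e C)) (sym (weight-marginals b C)) (∑-mono (localOutcomes e C) le)

  module Mixture {A : Set} (D : Dist A) (ext : A → Vec ℕ observables) (ext∈ : ∀ a → ext a ∈ globalAssignments e) where

    mixture : Vec ℕ observables → ℚ
    mixture g = 𝔼 D (λ a → 𝟙 (does (ext a ≟ g)))

    mixture-nonneg : NonNegative D → ∀ g → 0ℚ ℚ.≤ mixture g
    mixture-nonneg D≥0 g = ∑-nonneg D (λ {(w , a)} i → *-nonneg (All.lookup D≥0 i) (𝟙-nonneg (does (ext a ≟ g))))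
      where
      𝟙-nonneg : ∀ x → 0ℚ ℚ.≤ 𝟙 x
      𝟙-nonneg true  = ℚ.nonNegative⁻¹ 1ℚ
      𝟙-nonneg false = ℚ.≤-refl

    -- Change of variables for the image of D under `ext`: χ = 1 gives the weight and indicators
    -- give the marginals, so feasibility becomes a statement on expectations over D.
    mixture-sum : ∀ (χ : Vec ℕ observables → ℚ) → ∑ (λ g → χ g ℚ.* mixture g) (globalAssignments e) ≡ 𝔼 D (χ ∘ ext)
    mixture-sum χ = begin
      ∑ (λ g → χ g ℚ.* mixture g) (globalAssignments e)
        ≡⟨ ∑-cong (globalAssignments e) (λ {g} _ → sym (∑-*ˡ (χ g) (λ (w , a) → w ℚ.* 𝟙 (does (ext a ≟ g))) D)) ⟩
      ∑ (λ g → ∑ (λ (w , a) → χ g ℚ.* (w ℚ.* 𝟙 (does (ext a ≟ g)))) D) (globalAssignments e)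
        ≡⟨ ∑-swap (λ g (w , a) → χ g ℚ.* (w ℚ.* 𝟙 (does (ext a ≟ g)))) (globalAssignments e) D ⟩
      ∑ (λ (w , a) → ∑ (λ g → χ g ℚ.* (w ℚ.* 𝟙 (does (ext a ≟ g)))) (globalAssignments e)) D
        ≡⟨ ∑-cong D (λ {(w , a)} _ → trans
             (∑-cong (globalAssignments e) (λ {g} _ → rearrange (χ g) w (𝟙 (does (ext a ≟ g)))))
             (∑-delta _≟_ (λ g → w ℚ.* χ g) (unique-tuples outcomes) (ext∈ a))) ⟩
      𝔼 D (χ ∘ ext) ∎
      where
      open ≡-Reasoning
      open +-*-Solver
      rearrange : ∀ x w i → x ℚ.* (w ℚ.* i) ≡ i ℚ.* (w ℚ.* x)
      rearrange = solve 3 (λ x w i → x :* (w :* i) := i :* (w :* x)) refl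

    mixture-weight : weight e mixture ≡ 𝔼 D (λ _ → 1ℚ)
    mixture-weight = trans (∑-cong (globalAssignments e) (λ {g} _ → sym (ℚ.*-identityˡ (mixture g)))) (mixture-sum (λ _ → 1ℚ))

    mixture-marginal : ∀ C u → marginal e mixture C u ≡ 𝔼 D (λ a → 𝟙 (does (restrict e (ext a) C ≟ u)))
    mixture-marginal C u = trans (∑-filter (λ g → restrict e g C ≟ u) mixture (globalAssignments e))
      (mixture-sum (λ g → 𝟙 (does (restrict e g C ≟ u))))

-- The Kronecker delta, by the same boolean test on numbers as in the tables `μ̂` and `diagonal`.
δ : ∀ {n} → Fin n → Fin n → ℚ
δ x y = 𝟙 (toℕ x ≡ᵇ toℕ y)

sum-zero : ∀ n → sum {n} (λ _ → 0ℚ) ≡ 0ℚ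
sum-zero n = trans (sum-const n 0ℚ) (ℚ.*-zeroʳ (ι n))

sum-δ : ∀ {n} (a : Fin n) → sum (λ x → δ x a) ≡ 1ℚ
sum-δ {suc n} zero    = cong (1ℚ ℚ.+_) (sum-zero n)
sum-δ {suc n} (suc a) = trans (ℚ.+-identityˡ _) (sum-δ a)

sum-δδ : ∀ {n} (a b : Fin n) → sum (λ x → δ x a ℚ.* δ x b) ≡ δ a b
sum-δδ {suc n} zero zero       = cong (1ℚ ℚ.+_) (sum-zero n)
sum-δδ {suc n} zero (suc b)    = trans (ℚ.+-identityˡ _) (trans (sum-cong-≗ {n} (λ x → ℚ.*-zeroˡ (δ x b))) (sum-zero n))
sum-δδ {suc n} (suc a) zero    = trans (ℚ.+-identityˡ _) (trans (sum-cong-≗ {n} (λ x → ℚ.*-zeroʳ (δ x a))) (sum-zero n))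
sum-δδ {suc n} (suc a) (suc b) = trans (ℚ.+-identityˡ _) (sum-δδ a b)

offDiagonal-δ : ∀ {n} (a b : Fin n) → offDiagonal (λ x y → δ x a ℚ.* δ y b) ≡ 1ℚ ℚ.- δ a b
offDiagonal-δ a b = cong₂ ℚ._-_
  (trans (sum-cong-≗ (λ x → trans (sym (*-distribˡ-sum (δ x a) (λ y → δ y b)))
                                   (trans (cong (δ x a ℚ.*_) (sum-δ b)) (ℚ.*-identityʳ (δ x a)))))
         (sum-δ a))
  (sum-δδ a b)

≡ᵇ-true : ∀ {m n} → (m ≡ᵇ n) ≡ true → m ≡ n
≡ᵇ-true {m} {n} eq = ℕ.≡ᵇ⇒≡ m n (subst T (sym eq) tt)

below : ∀ {a n} → a < n → ∃[ i ] a ≡ toℕ {n} i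
below a<n = fromℕ< a<n , sym (Fin.toℕ-fromℕ< a<n)

module GadgetModel (q : ℕ) .{{_ : NonZero q}} (ϑ : ℚ) (G : Graph) where
  open Gadget G
  open LiftedModel q ϑ instance-of hiding (gateOccurs; colourOccurs)
  open Model model

  contextOf∈ : ∀ c {C} → C ∈ contextsOf c → C ∈ EmpiricalModel.contexts model
  contextOf∈ c C∈ = ∈.∈-concat⁺′ C∈ (∈.∈-map⁺ contextsOf (∈.∈-allFin c))

  Assignment : Set
  Assignment = (Fin 2 → Fin 2) × (Fin vertices → Fin q)

  copiesOf : Assignment → Scope 2 vertices → Vec ℕ 4
  copiesOf (α , β) (scope x₁ x₂ x₃ x₄) = toℕ (α x₁) ∷ toℕ (α x₂) ∷ toℕ (β x₃) ∷ toℕ (β x₄) ∷ []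

  module Parts (a : Assignment) where
    gatePart : Vec ℕ 2
    gatePart = Vec.tabulate (toℕ ∘ proj₁ a)

    colourPart : Vec ℕ vertices
    colourPart = Vec.tabulate (toℕ ∘ proj₂ a)

    copyPart : Vec ℕ copies
    copyPart = Vec.concat (Vec.map (copiesOf a) constraints)

    extension : Vec ℕ (2 + (vertices + copies))
    extension = gatePart Vec.++ (colourPart Vec.++ copyPart)

    extension∈ : extension ∈ globalAssignments model
    extension∈ = ∈-tuples⁺ (Pointwise.++⁺ (tabulated (proj₁ a))
      (Pointwise.++⁺ (tabulated (proj₂ a)) (Pointwise.concat⁺ (copied constraints))))
      where
      tabulated : ∀ {n d} (f : Fin n → Fin d) → Pointwise _<_ (Vec.tabulate (toℕ ∘ f)) (Vec.replicate n d)
      tabulated {zero}  f = []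
      tabulated {suc n} f = Fin.toℕ<n (f zero) ∷ tabulated (f ∘ suc)
      copied : ∀ {m} (ss : Vec (Scope 2 vertices) m) → Pointwise (Pointwise _<_) (Vec.map (copiesOf a) ss) (Vec.replicate m bounds)
      copied []                       = []
      copied (scope x₁ x₂ x₃ x₄ ∷ ss) = (Fin.toℕ<n (proj₁ a x₁) ∷ Fin.toℕ<n (proj₁ a x₂) ∷
        Fin.toℕ<n (proj₂ a x₃) ∷ Fin.toℕ<n (proj₂ a x₄) ∷ []) ∷ copied ss

    extension-gate : ∀ x → Vec.lookup extension (gate x) ≡ toℕ (proj₁ a x)
    extension-gate x = trans (Vec.lookup-++ˡ gatePart (colourPart Vec.++ copyPart) x) (Vec.lookup∘tabulate (toℕ ∘ proj₁ a) x)

    extension-colour : ∀ x → Vec.lookup extension (colour x) ≡ toℕ (proj₂ a x)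
    extension-colour x = trans (Vec.lookup-++ʳ gatePart (colourPart Vec.++ copyPart) (x ↑ˡ copies))
      (trans (Vec.lookup-++ˡ colourPart copyPart x) (Vec.lookup∘tabulate (toℕ ∘ proj₂ a) x))

    extension-copy : ∀ c j → Vec.lookup extension (copy c j) ≡ Vec.lookup (copiesOf a (Vec.lookup constraints c)) j
    extension-copy c j = trans (Vec.lookup-++ʳ gatePart (colourPart Vec.++ copyPart) (vertices ↑ʳ combine c j))
      (trans (Vec.lookup-++ʳ colourPart copyPart (combine c j))
      (trans (Vec.lookup-concat (Vec.map (copiesOf a) constraints) c j)
             (cong (λ xs → Vec.lookup xs j) (Vec.lookup-map c (copiesOf a) constraints))))

  open Parts

  twist : Fin 2 → Fin 2 → Fin 2
  twist ρ zero    = ρ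
  twist ρ (suc _) = opposite ρ

  aligned : Dist Assignment
  aligned = bind (uniform 2) λ ρ → mapDist (λ β → (λ _ → ρ) , β) (randomFunction q vertices)

  opposed : (Fin vertices → Fin q) → Dist Assignment
  opposed f = bind (uniform 2) λ ρ → mapDist (λ σ → twist ρ , σ ∘ f) (randomPermutation q)

  aligned-nonneg : NonNegative aligned
  aligned-nonneg = bind-nonneg (uniform-nonneg 2) λ ρ → map-nonneg {f = λ β → (λ _ → ρ) , β} (randomFunction-nonneg q vertices)

  opposed-nonneg : ∀ f → NonNegative (opposed f)
  opposed-nonneg f = bind-nonneg (uniform-nonneg 2) λ ρ → map-nonneg {f = λ σ → twist ρ , σ ∘ f} (randomPermutation-nonneg q)

  𝔼-aligned : ∀ Φ → 𝔼 aligned Φ ≡ recip 2 ℚ.* sum (λ ρ → 𝔼 (randomFunction q vertices) (λ β → Φ ((λ _ → ρ) , β)))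
  𝔼-aligned Φ = trans (𝔼-bind (uniform 2) (λ ρ → mapDist (λ β → (λ _ → ρ) , β) (randomFunction q vertices)) Φ)
    (trans (𝔼-uniform 2 (λ ρ → 𝔼 (mapDist (λ β → (λ _ → ρ) , β) (randomFunction q vertices)) Φ))
    (cong (recip 2 ℚ.*_) (sum-cong-≗ λ ρ → 𝔼-map (λ β → (λ _ → ρ) , β) (randomFunction q vertices) Φ)))

  𝔼-opposed : ∀ f Φ → 𝔼 (opposed f) Φ ≡ recip 2 ℚ.* sum (λ ρ → 𝔼 (randomPermutation q) (λ σ → Φ (twist ρ , σ ∘ f)))
  𝔼-opposed f Φ = trans (𝔼-bind (uniform 2) (λ ρ → mapDist (λ σ → twist ρ , σ ∘ f) (randomPermutation q)) Φ)
    (trans (𝔼-uniform 2 (λ ρ → 𝔼 (mapDist (λ σ → twist ρ , σ ∘ f) (randomPermutation q)) Φ))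
    (cong (recip 2 ℚ.*_) (sum-cong-≗ λ ρ → 𝔼-map (λ σ → twist ρ , σ ∘ f) (randomPermutation q) Φ)))

  scopeIndicator : Scope 2 vertices → Fin 2 → Fin 2 → Fin q → Fin q → Assignment → ℚ
  scopeIndicator s r z a b (α , β) = δ (α (Scope.x₁ s)) r ℚ.* δ (α (Scope.x₂ s)) z ℚ.* (δ (β (Scope.x₃ s)) a ℚ.* δ (β (Scope.x₄ s)) b)

  sum-twist : ∀ {x y} → x ≡ zero → y ≡ suc zero → ∀ r z → sum (λ ρ → δ (twist ρ x) r ℚ.* δ (twist ρ y) z) ≡ 1ℚ ℚ.- δ r z
  sum-twist refl refl zero       zero       = refl
  sum-twist refl refl zero       (suc zero) = refl
  sum-twist refl refl (suc zero) zero       = refl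
  sum-twist refl refl (suc zero) (suc zero) = refl

  -- Both gates show the same fair coin, which yields `recip 2 * δ r z`; the colours at distinct
  -- vertices are independent and uniform.
  aligned-scope : ∀ {s} → Scope.x₃ s ≢ Scope.x₄ s → ∀ r z a b →
    𝔼 aligned (scopeIndicator s r z a b) ≡ recip 2 ℚ.* (recip q ℚ.* recip q) ℚ.* δ r z
  aligned-scope {s} x₃≢x₄ r z a b = begin
    𝔼 aligned (scopeIndicator s r z a b)
      ≡⟨ 𝔼-aligned (scopeIndicator s r z a b) ⟩
    recip 2 ℚ.* sum (λ ρ → 𝔼 (randomFunction q vertices) (λ β → scopeIndicator s r z a b ((λ _ → ρ) , β)))
      ≡⟨ cong (recip 2 ℚ.*_) (sum-cong-≗ {2} λ ρ → trans
           (𝔼-*ˡ (δ ρ r ℚ.* δ ρ z) (randomFunction q vertices) (λ β → δ (β (Scope.x₃ s)) a ℚ.* δ (β (Scope.x₄ s)) b))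
           (trans (cong (δ ρ r ℚ.* δ ρ z ℚ.*_) (trans (randomFunction-at₂ q x₃≢x₄ (λ x → δ x a) (λ y → δ y b)) pairLaw))
                  (ℚ.*-comm (δ ρ r ℚ.* δ ρ z) (recip q ℚ.* recip q)))) ⟩
    recip 2 ℚ.* sum (λ ρ → recip q ℚ.* recip q ℚ.* (δ ρ r ℚ.* δ ρ z))
      ≡⟨ cong (recip 2 ℚ.*_) (trans (sym (*-distribˡ-sum (recip q ℚ.* recip q) (λ ρ → δ ρ r ℚ.* δ ρ z)))
           (cong (recip q ℚ.* recip q ℚ.*_) (sum-δδ r z))) ⟩
    recip 2 ℚ.* (recip q ℚ.* recip q ℚ.* δ r z)
      ≡⟨ ℚ.*-assoc (recip 2) (recip q ℚ.* recip q) (δ r z) ⟨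
    recip 2 ℚ.* (recip q ℚ.* recip q) ℚ.* δ r z ∎
    where
    open ≡-Reasoning
    pairLaw : recip q ℚ.* sum (λ x → δ x a) ℚ.* (recip q ℚ.* sum (λ y → δ y b)) ≡ recip q ℚ.* recip q
    pairLaw = trans (cong₂ (λ x y → recip q ℚ.* x ℚ.* (recip q ℚ.* y)) (sum-δ a) (sum-δ b))
      (cong₂ ℚ._*_ (ℚ.*-identityʳ (recip q)) (ℚ.*-identityʳ (recip q)))

  -- Properness of f at the edge is exactly the hypothesis of the two-point law of a random
  -- permutation.
  opposed-scope : ∀ {s} → Scope.x₁ s ≡ zero → Scope.x₂ s ≡ suc zero → ∀ f → f (Scope.x₃ s) ≢ f (Scope.x₄ s) → ∀ r z a b →
    𝔼 (opposed f) (scopeIndicator s r z a b) ≡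
    recip 2 ℚ.* (recip q ℚ.* recip (q ∸ 1)) ℚ.* ((1ℚ ℚ.- δ r z) ℚ.* (1ℚ ℚ.- δ a b))
  opposed-scope {s} s₁ s₂ f proper r z a b = begin
    𝔼 (opposed f) (scopeIndicator s r z a b)
      ≡⟨ 𝔼-opposed f (scopeIndicator s r z a b) ⟩
    recip 2 ℚ.* sum (λ ρ → 𝔼 (randomPermutation q) (λ σ → gateFactor ρ ℚ.* Φ (σ (f (Scope.x₃ s))) (σ (f (Scope.x₄ s)))))
      ≡⟨ cong (recip 2 ℚ.*_) (sum-cong-≗ {2} λ ρ → trans
           (𝔼-*ˡ (gateFactor ρ) (randomPermutation q) (λ σ → Φ (σ (f (Scope.x₃ s))) (σ (f (Scope.x₄ s)))))
           (trans (cong (gateFactor ρ ℚ.*_) (trans (randomPermutation-at₂ proper Φ)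
                     (cong (λ x → recip q ℚ.* (recip (q ∸ 1) ℚ.* x)) (offDiagonal-δ a b))))
                  (ℚ.*-comm (gateFactor ρ) law))) ⟩
    recip 2 ℚ.* sum (λ ρ → law ℚ.* gateFactor ρ)
      ≡⟨ cong (recip 2 ℚ.*_) (trans (sym (*-distribˡ-sum law gateFactor)) (cong (law ℚ.*_) (sum-twist s₁ s₂ r z))) ⟩
    recip 2 ℚ.* (law ℚ.* (1ℚ ℚ.- δ r z))
      ≡⟨ rearrange (recip 2) (recip q) (recip (q ∸ 1)) (1ℚ ℚ.- δ a b) (1ℚ ℚ.- δ r z) ⟩
    recip 2 ℚ.* (recip q ℚ.* recip (q ∸ 1)) ℚ.* ((1ℚ ℚ.- δ r z) ℚ.* (1ℚ ℚ.- δ a b)) ∎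
    where
    open ≡-Reasoning
    open +-*-Solver
    Φ : Fin q → Fin q → ℚ
    Φ x y = δ x a ℚ.* δ y b
    gateFactor : Fin 2 → ℚ
    gateFactor ρ = δ (twist ρ (Scope.x₁ s)) r ℚ.* δ (twist ρ (Scope.x₂ s)) z
    law : ℚ
    law = recip q ℚ.* (recip (q ∸ 1) ℚ.* (1ℚ ℚ.- δ a b))
    rearrange : ∀ h x y d t → h ℚ.* (x ℚ.* (y ℚ.* d) ℚ.* t) ≡ h ℚ.* (x ℚ.* y) ℚ.* (t ℚ.* d)
    rearrange = solve 5 (λ h x y d t → h :* (x :* (y :* d) :* t) := h :* (x :* y) :* (t :* d)) refl

  aligned-gate : ∀ x a b → 𝔼 aligned (λ (α , β) → δ (α x) a ℚ.* δ (α x) b) ≡ recip 2 ℚ.* δ a b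
  aligned-gate x a b = trans (𝔼-aligned _) (cong (recip 2 ℚ.*_) (trans
    (sum-cong-≗ {2} λ ρ → randomFunction-total q vertices (δ ρ a ℚ.* δ ρ b)) (sum-δδ a b)))

  opposed-gate : ∀ f x a b → 𝔼 (opposed f) (λ (α , β) → δ (α x) a ℚ.* δ (α x) b) ≡ recip 2 ℚ.* δ a b
  opposed-gate f x a b = trans (𝔼-opposed f _) (cong (recip 2 ℚ.*_) (trans
    (sum-cong-≗ {2} λ ρ → randomPermutation-total q (δ (twist ρ x) a ℚ.* δ (twist ρ x) b)) (total x a b)))
    where
    total : ∀ x a b → sum (λ ρ → δ (twist ρ x) a ℚ.* δ (twist ρ x) b) ≡ δ a b
    total zero       a          b          = sum-δδ a b
    total (suc zero) zero       zero       = refl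
    total (suc zero) zero       (suc zero) = refl
    total (suc zero) (suc zero) zero       = refl
    total (suc zero) (suc zero) (suc zero) = refl

  aligned-colour : ∀ x a b → 𝔼 aligned (λ (α , β) → δ (β x) a ℚ.* δ (β x) b) ≡ recip q ℚ.* δ a b
  aligned-colour x a b = trans (𝔼-aligned _) (trans
    (cong (recip 2 ℚ.*_) (sum-cong-≗ {2} λ ρ → trans (randomFunction-at q x (λ y → δ y a ℚ.* δ y b))
                                                     (cong (recip q ℚ.*_) (sum-δδ a b))))
    (recip-sum-const 2 (recip q ℚ.* δ a b)))

  opposed-colour : ∀ f x a b → 𝔼 (opposed f) (λ (α , β) → δ (β x) a ℚ.* δ (β x) b) ≡ recip q ℚ.* δ a b
  opposed-colour f x a b = trans (𝔼-opposed f _) (trans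
    (cong (recip 2 ℚ.*_) (sum-cong-≗ {2} λ ρ → trans (randomPermutation-at (f x) (λ y → δ y a ℚ.* δ y b))
                                                     (cong (recip q ℚ.*_) (sum-δδ a b))))
    (recip-sum-const 2 (recip q ℚ.* δ a b)))

  aligned-total : ∀ k → 𝔼 aligned (λ _ → k) ≡ k
  aligned-total k = trans (𝔼-aligned _) (trans
    (cong (recip 2 ℚ.*_) (sum-cong-≗ {2} λ ρ → randomFunction-total q vertices k)) (recip-sum-const 2 k))

  opposed-total : ∀ f k → 𝔼 (opposed f) (λ _ → k) ≡ k
  opposed-total f k = trans (𝔼-opposed f _) (trans
    (cong (recip 2 ℚ.*_) (sum-cong-≗ {2} λ ρ → randomPermutation-total q k)) (recip-sum-const 2 k))

-- The two values of NCF

recip-2q² : ∀ q → recip (2 * q ^ 2) ≡ recip 2 ℚ.* (recip q ℚ.* recip q)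
recip-2q² q = trans (recip-* 2 (q ^ 2)) (cong (recip 2 ℚ.*_)
  (trans (cong (λ k → recip (q * k)) (ℕ.*-identityʳ q)) (recip-* q q)))

recip-2q[q-1] : ∀ q → recip (2 * q * (q ∸ 1)) ≡ recip 2 ℚ.* (recip q ℚ.* recip (q ∸ 1))
recip-2q[q-1] q = trans (recip-* (2 * q) (q ∸ 1))
  (trans (cong (ℚ._* recip (q ∸ 1)) (recip-* 2 q)) (ℚ.*-assoc (recip 2) (recip q) (recip (q ∸ 1))))

≡ᵇ-reflexive : ∀ {m n} → m ≡ n → (m ≡ᵇ n) ≡ true
≡ᵇ-reflexive {zero}  refl = refl
≡ᵇ-reflexive {suc m} refl = ≡ᵇ-reflexive {m} refl

≡ᵇ-false : ∀ {m n} → (m ≡ᵇ n) ≡ false → m ≢ n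
≡ᵇ-false eq m≡n with trans (sym eq) (≡ᵇ-reflexive m≡n)
... | ()

module _ (q : ℕ) (ϑ : ℚ) where
  open Lift q ϑ

  -- Exhibits the table as the combination, with weights ϑ and 1 - ϑ, of the scope laws of `aligned`
  -- and `opposed`.
  μ̂-δ : ∀ (r z : Fin 2) (a b : Fin q) → μ̂ (toℕ r ∷ toℕ z ∷ toℕ a ∷ toℕ b ∷ []) ≡
    ϑ ℚ.* (recip 2 ℚ.* (recip q ℚ.* recip q) ℚ.* δ r z) ℚ.+
    (1ℚ ℚ.- ϑ) ℚ.* (recip 2 ℚ.* (recip q ℚ.* recip (q ∸ 1)) ℚ.* ((1ℚ ℚ.- δ r z) ℚ.* (1ℚ ℚ.- δ a b)))
  μ̂-δ r z a b = trans (cases r z) (cong₂ (λ x y → ϑ ℚ.* (x ℚ.* δ r z) ℚ.+ (1ℚ ℚ.- ϑ) ℚ.* (y ℚ.* ((1ℚ ℚ.- δ r z) ℚ.* (1ℚ ℚ.- δ a b))))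
    (recip-2q² q) (recip-2q[q-1] q))
    where
    open +-*-Solver
    equal : ∀ t k l d → t ℚ.* k ≡ t ℚ.* (k ℚ.* 1ℚ) ℚ.+ (1ℚ ℚ.- t) ℚ.* (l ℚ.* ((1ℚ ℚ.- 1ℚ) ℚ.* (1ℚ ℚ.- d)))
    equal = solve 4 (λ t k l d → t :* k := t :* (k :* con 1ℚ) :+ (con 1ℚ :- t) :* (l :* ((con 1ℚ :- con 1ℚ) :* (con 1ℚ :- d)))) refl
    clash : ∀ t k l → 0ℚ ≡ t ℚ.* (k ℚ.* 0ℚ) ℚ.+ (1ℚ ℚ.- t) ℚ.* (l ℚ.* ((1ℚ ℚ.- 0ℚ) ℚ.* (1ℚ ℚ.- 1ℚ)))
    clash = solve 3 (λ t k l → con 0ℚ := t :* (k :* con 0ℚ) :+ (con 1ℚ :- t) :* (l :* ((con 1ℚ :- con 0ℚ) :* (con 1ℚ :- con 1ℚ)))) refl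
    proper : ∀ t k l → (1ℚ ℚ.- t) ℚ.* l ≡ t ℚ.* (k ℚ.* 0ℚ) ℚ.+ (1ℚ ℚ.- t) ℚ.* (l ℚ.* ((1ℚ ℚ.- 0ℚ) ℚ.* (1ℚ ℚ.- 0ℚ)))
    proper = solve 3 (λ t k l → (con 1ℚ :- t) :* l := t :* (k :* con 0ℚ) :+ (con 1ℚ :- t) :* (l :* ((con 1ℚ :- con 0ℚ) :* (con 1ℚ :- con 0ℚ)))) refl
    unequal : (if toℕ a ≡ᵇ toℕ b then 0ℚ else (1ℚ ℚ.- ϑ) ℚ.* recip (2 * q * (q ∸ 1))) ≡
      ϑ ℚ.* (recip (2 * q ^ 2) ℚ.* 0ℚ) ℚ.+ (1ℚ ℚ.- ϑ) ℚ.* (recip (2 * q * (q ∸ 1)) ℚ.* ((1ℚ ℚ.- 0ℚ) ℚ.* (1ℚ ℚ.- δ a b)))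
    unequal with toℕ a ≡ᵇ toℕ b
    ... | true  = clash ϑ (recip (2 * q ^ 2)) (recip (2 * q * (q ∸ 1)))
    ... | false = proper ϑ (recip (2 * q ^ 2)) (recip (2 * q * (q ∸ 1)))
    cases : ∀ r z → μ̂ (toℕ r ∷ toℕ z ∷ toℕ a ∷ toℕ b ∷ []) ≡
      ϑ ℚ.* (recip (2 * q ^ 2) ℚ.* δ r z) ℚ.+ (1ℚ ℚ.- ϑ) ℚ.* (recip (2 * q * (q ∸ 1)) ℚ.* ((1ℚ ℚ.- δ r z) ℚ.* (1ℚ ℚ.- δ a b)))
    cases zero       zero       = equal ϑ (recip (2 * q ^ 2)) (recip (2 * q * (q ∸ 1))) (δ a b)
    cases zero       (suc zero) = unequal
    cases (suc zero) zero       = unequal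
    cases (suc zero) (suc zero) = equal ϑ (recip (2 * q ^ 2)) (recip (2 * q * (q ∸ 1))) (δ a b)

  diagonal-δ : ∀ {d} (a b : Fin d) → diagonal d (toℕ a ∷ toℕ b ∷ []) ≡ recip d ℚ.* δ a b
  diagonal-δ {d} a b with toℕ a ≡ᵇ toℕ b
  ... | true  = sym (ℚ.*-identityʳ (recip d))
  ... | false = sym (ℚ.*-zeroʳ (recip d))

  diagonal-positive : ∀ {d a b} → 0ℚ ℚ.< diagonal d (a ∷ b ∷ []) → a ≡ b
  diagonal-positive {d} {a} {b} pos with a ≡ᵇ b in eq
  ... | true  = ≡ᵇ-true eq
  ... | false = ⊥-elim (ℚ.<-irrefl refl pos)

  μ̂-positive : ∀ {r z a b} → 0ℚ ℚ.< μ̂ (r ∷ z ∷ a ∷ b ∷ []) → z ≢ r → a ≢ b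
  μ̂-positive {r} {z} {a} {b} pos z≢r a≡b with z ≡ᵇ r in eq
  ... | true  = z≢r (≡ᵇ-true eq)
  ... | false with a ≡ᵇ b in eq′
  ...   | true  = ℚ.<-irrefl refl pos
  ...   | false = ≡ᵇ-false eq′ a≡b

indicator₂ : ∀ x y a b → 𝟙 (does (Vec.≡-dec ℕ._≟_ (x ∷ y ∷ []) (a ∷ b ∷ []))) ≡ 𝟙 (x ≡ᵇ a) ℚ.* 𝟙 (y ≡ᵇ b)
indicator₂ x y a b with x ≡ᵇ a | y ≡ᵇ b
... | true  | true  = refl
... | true  | false = refl
... | false | true  = refl
... | false | false = refl

indicator₄ : ∀ x y z w a b c d → 𝟙 (does (Vec.≡-dec ℕ._≟_ (x ∷ y ∷ z ∷ w ∷ []) (a ∷ b ∷ c ∷ d ∷ []))) ≡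
  𝟙 (x ≡ᵇ a) ℚ.* 𝟙 (y ≡ᵇ b) ℚ.* (𝟙 (z ≡ᵇ c) ℚ.* 𝟙 (w ≡ᵇ d))
indicator₄ x y z w a b c d = begin
  𝟙 ((x ≡ᵇ a) ∧ ((y ≡ᵇ b) ∧ does (Vec.≡-dec ℕ._≟_ (z ∷ w ∷ []) (c ∷ d ∷ []))))
    ≡⟨ trans (𝟙-∧ (x ≡ᵇ a) _) (cong (𝟙 (x ≡ᵇ a) ℚ.*_) (𝟙-∧ (y ≡ᵇ b) _)) ⟩
  𝟙 (x ≡ᵇ a) ℚ.* (𝟙 (y ≡ᵇ b) ℚ.* 𝟙 (does (Vec.≡-dec ℕ._≟_ (z ∷ w ∷ []) (c ∷ d ∷ []))))
    ≡⟨ cong (λ i → 𝟙 (x ≡ᵇ a) ℚ.* (𝟙 (y ≡ᵇ b) ℚ.* i)) (indicator₂ z w c d) ⟩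
  𝟙 (x ≡ᵇ a) ℚ.* (𝟙 (y ≡ᵇ b) ℚ.* (𝟙 (z ≡ᵇ c) ℚ.* 𝟙 (w ≡ᵇ d)))
    ≡⟨ ℚ.*-assoc (𝟙 (x ≡ᵇ a)) (𝟙 (y ≡ᵇ b)) (𝟙 (z ≡ᵇ c) ℚ.* 𝟙 (w ≡ᵇ d)) ⟨
  𝟙 (x ≡ᵇ a) ℚ.* 𝟙 (y ≡ᵇ b) ℚ.* (𝟙 (z ≡ᵇ c) ℚ.* 𝟙 (w ≡ᵇ d)) ∎
  where open ≡-Reasoning

pairView : ∀ {d u} → Pointwise _<_ u (d ∷ d ∷ []) → ∃[ i ] ∃[ k ] u ≡ toℕ {d} i ∷ toℕ {d} k ∷ []
pairView (i< ∷ k< ∷ []) with below i< | below k<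
... | i , refl | k , refl = i , k , refl

quadrupleView : ∀ {d e u} → Pointwise _<_ u (d ∷ d ∷ e ∷ e ∷ []) →
  ∃[ r ] ∃[ z ] ∃[ a ] ∃[ b ] u ≡ toℕ {d} r ∷ toℕ {d} z ∷ toℕ {e} a ∷ toℕ {e} b ∷ []
quadrupleView (r< ∷ z< ∷ a< ∷ b< ∷ []) with below r< | below z< | below a< | below b<
... | r , refl | z , refl | a , refl | b , refl = r , z , a , b , refl

-- For κ = ϑ / (2q²) this is `μ̂` with the entries at unequal gates erased. There are 2q² outcomes
-- with equal gates, so its total is ϑ.
alignedTable : ℚ → Vec ℕ 4 → ℚ
alignedTable κ u = if Vec.lookup u (suc zero) ≡ᵇ Vec.lookup u zero then κ else 0ℚ

below-if : ∀ {x y k} t → x ℚ.≤ (if t then k else y) → (t ≡ false → x ℚ.≤ 0ℚ) → x ℚ.≤ (if t then k else 0ℚ)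
below-if true  le _ = le
below-if false _  h = h refl

∑-tuples-one : ∀ {n} d (ds : Vec ℕ n) → ∑ (λ _ → 1ℚ) (tuples (d ∷ ds)) ≡ ι d ℚ.* ∑ (λ _ → 1ℚ) (tuples ds)
∑-tuples-one d ds = trans (∑-cartesianProductWith (λ _ → 1ℚ) _∷_ (List.upTo d) (tuples ds))
  (trans (∑-const (∑ (λ _ → 1ℚ) (tuples ds)) (List.upTo d)) (cong (ℚ._* ∑ (λ _ → 1ℚ) (tuples ds)) (∑-upTo-one d)))

∑-alignedTable : ∀ q κ → ∑ (alignedTable κ) (tuples (2 ∷ 2 ∷ q ∷ q ∷ [])) ≡ ι 2 ℚ.* (ι q ℚ.* ι q) ℚ.* κ
∑-alignedTable q κ = begin
  ∑ (alignedTable κ) (tuples (2 ∷ 2 ∷ q ∷ q ∷ []))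
    ≡⟨ ∑-cartesianProductWith (alignedTable κ) _∷_ (0 ∷ 1 ∷ []) (tuples (2 ∷ q ∷ q ∷ [])) ⟩
  row 0 ℚ.+ (row 1 ℚ.+ 0ℚ)
    ≡⟨ cong₂ (λ x y → x ℚ.+ (y ℚ.+ 0ℚ)) (row-sum 0) (row-sum 1) ⟩
  (size² ℚ.* κ ℚ.+ (size² ℚ.* 0ℚ ℚ.+ 0ℚ)) ℚ.+ ((size² ℚ.* 0ℚ ℚ.+ (size² ℚ.* κ ℚ.+ 0ℚ)) ℚ.+ 0ℚ)
    ≡⟨ collect size² κ ⟩
  ι 2 ℚ.* size² ℚ.* κ
    ≡⟨ cong (λ s → ι 2 ℚ.* s ℚ.* κ) size²-ι ⟩
  ι 2 ℚ.* (ι q ℚ.* ι q) ℚ.* κ ∎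
  where
  open ≡-Reasoning
  open +-*-Solver
  collect : ∀ s k → (s ℚ.* k ℚ.+ (s ℚ.* 0ℚ ℚ.+ 0ℚ)) ℚ.+ ((s ℚ.* 0ℚ ℚ.+ (s ℚ.* k ℚ.+ 0ℚ)) ℚ.+ 0ℚ) ≡ ι 2 ℚ.* s ℚ.* k
  collect = solve 2 (λ s k → (s :* k :+ (s :* con 0ℚ :+ con 0ℚ)) :+ ((s :* con 0ℚ :+ (s :* k :+ con 0ℚ)) :+ con 0ℚ) :=
                             con (ι 2) :* s :* k) refl
  size² : ℚ
  size² = ∑ (λ _ → 1ℚ) (tuples (q ∷ q ∷ []))
  row : ℕ → ℚ
  row r = ∑ (λ u → alignedTable κ (r ∷ u)) (tuples (2 ∷ q ∷ q ∷ []))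
  entry : ℕ → ℕ → ℚ
  entry r z = if z ≡ᵇ r then κ else 0ℚ
  row-sum : ∀ r → row r ≡ size² ℚ.* entry r 0 ℚ.+ (size² ℚ.* entry r 1 ℚ.+ 0ℚ)
  row-sum r = trans (∑-cartesianProductWith (λ u → alignedTable κ (r ∷ u)) _∷_ (0 ∷ 1 ∷ []) (tuples (q ∷ q ∷ [])))
    (cong₂ (λ x y → x ℚ.+ (y ℚ.+ 0ℚ)) (∑-const (entry r 0) (tuples (q ∷ q ∷ []))) (∑-const (entry r 1) (tuples (q ∷ q ∷ []))))
  size²-ι : size² ≡ ι q ℚ.* ι q
  size²-ι = trans (∑-tuples-one q (q ∷ [])) (cong (ι q ℚ.*_) (trans (∑-tuples-one q []) (ℚ.*-identityʳ (ι q))))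

∑-alignedTable-ϑ : ∀ q .{{_ : NonZero q}} ϑ → ∑ (alignedTable (ϑ ℚ.* recip (2 * q ^ 2))) (tuples (2 ∷ 2 ∷ q ∷ q ∷ [])) ≡ ϑ
∑-alignedTable-ϑ q ϑ = begin
  ∑ (alignedTable (ϑ ℚ.* recip (2 * q ^ 2))) (tuples (2 ∷ 2 ∷ q ∷ q ∷ []))
    ≡⟨ ∑-alignedTable q (ϑ ℚ.* recip (2 * q ^ 2)) ⟩
  ι 2 ℚ.* (ι q ℚ.* ι q) ℚ.* (ϑ ℚ.* recip (2 * q ^ 2))
    ≡⟨ cong (λ k → ι 2 ℚ.* (ι q ℚ.* ι q) ℚ.* (ϑ ℚ.* k)) (recip-2q² q) ⟩
  ι 2 ℚ.* (ι q ℚ.* ι q) ℚ.* (ϑ ℚ.* (recip 2 ℚ.* (recip q ℚ.* recip q)))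
    ≡⟨ rearrange (ι 2) (ι q) ϑ (recip 2) (recip q) ⟩
  ϑ ℚ.* ((ι 2 ℚ.* recip 2) ℚ.* ((ι q ℚ.* recip q) ℚ.* (ι q ℚ.* recip q)))
    ≡⟨ cong₂ (λ x y → ϑ ℚ.* (x ℚ.* (y ℚ.* y))) (ι-recip 2) (ι-recip q) ⟩
  ϑ ℚ.* 1ℚ
    ≡⟨ ℚ.*-identityʳ ϑ ⟩
  ϑ ∎
  where
  open ≡-Reasoning
  open +-*-Solver
  rearrange : ∀ h n t k r → h ℚ.* (n ℚ.* n) ℚ.* (t ℚ.* (k ℚ.* (r ℚ.* r))) ≡ t ℚ.* ((h ℚ.* k) ℚ.* ((n ℚ.* r) ℚ.* (n ℚ.* r)))
  rearrange = solve 5 (λ h n t k r → h :* (n :* n) :* (t :* (k :* (r :* r))) := t :* ((h :* k) :* ((n :* r) :* (n :* r)))) refl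

-- Feasible mixtures and upper bounds on the weight

module Values (q : ℕ) .{{_ : NonZero q}} (ϑ : ℚ) (0≤ϑ : 0ℚ ℚ.≤ ϑ) (ϑ≤1 : ϑ ℚ.≤ 1ℚ) (G : Graph) where
  open GadgetModel q ϑ G
  open Gadget G
  open LiftedModel q ϑ instance-of hiding (gateOccurs; colourOccurs)
  open Model model
  open Parts

  restrict-extension : ∀ a c → restrict model (extension a) (copyContext c) ≡ copiesOf a (Vec.lookup constraints c)
  restrict-extension a c = cong₂ _∷_ (extension-copy a c j₁) (cong₂ _∷_ (extension-copy a c j₂)
    (cong₂ _∷_ (extension-copy a c j₃) (cong (_∷ []) (extension-copy a c j₄))))

  -- Copies repeat central values, so a copy context tests the joint law of one scope, and a
  -- diagonal context tests a single central variable twice.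
  module Feasibility (D : Dist Assignment) (D≥0 : NonNegative D)
    (scopeLaw : ∀ c r z a b → 𝔼 D (scopeIndicator (Vec.lookup constraints c) r z a b) ℚ.≤ μ̂ (toℕ r ∷ toℕ z ∷ toℕ a ∷ toℕ b ∷ []))
    (gateLaw : ∀ x a b → 𝔼 D (λ (α , β) → δ (α x) a ℚ.* δ (α x) b) ℚ.≤ recip 2 ℚ.* δ a b)
    (colourLaw : ∀ x a b → 𝔼 D (λ (α , β) → δ (β x) a ℚ.* δ (β x) b) ℚ.≤ recip q ℚ.* δ a b)
    where
    open Mixture D extension extension∈ public

    Respected : Context outs → Set
    Respected C = All (λ u → marginal model mixture C u ℚ.≤ Context.table C u) (localOutcomes model C)

    copies-respected : ∀ c → Respected (copyContext c)
    copies-respected c = All.tabulate λ {u} u∈ →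
      let r , z , a , b , eq = quadrupleView (∈-tuples⁻ bounds (subst (λ ds → u ∈ tuples ds) (outs-copies c) u∈)) in
      subst (λ u → marginal model mixture (copyContext c) u ℚ.≤ μ̂ u) (sym eq) (respected r z a b)
      where
      respected : ∀ r z a b → marginal model mixture (copyContext c) (toℕ r ∷ toℕ z ∷ toℕ a ∷ toℕ b ∷ []) ℚ.≤ μ̂ (toℕ r ∷ toℕ z ∷ toℕ a ∷ toℕ b ∷ [])
      respected r z a b = subst (ℚ._≤ μ̂ u)
        (sym (trans (mixture-marginal (copyContext c) u) (𝔼-cong D λ x → trans
          (cong (λ v → 𝟙 (does (v ≟ u))) (restrict-extension x c))
          (indicator₄ (toℕ (proj₁ x (At.x₁ c))) (toℕ (proj₁ x (At.x₂ c))) (toℕ (proj₂ x (At.x₃ c))) (toℕ (proj₂ x (At.x₄ c)))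
                      (toℕ r) (toℕ z) (toℕ a) (toℕ b)))))
        (scopeLaw c r z a b)
        where u = toℕ r ∷ toℕ z ∷ toℕ a ∷ toℕ b ∷ []

    diagonal-respected : ∀ {d} x c j (v : Assignment → Fin d) → Vec.lookup outs x ≡ d → Vec.lookup bounds j ≡ d →
      (∀ a → Vec.lookup (extension a) x ≡ toℕ (v a)) → (∀ a → Vec.lookup (copiesOf a (Vec.lookup constraints c)) j ≡ toℕ (v a)) →
      (∀ i k → 𝔼 D (λ a → δ (v a) i ℚ.* δ (v a) k) ℚ.≤ recip d ℚ.* δ i k) → Respected (diagonalContext d x c j)
    diagonal-respected {d} x c j v x-bound j-bound x-value j-value law = All.tabulate λ {u} u∈ →
      let i , k , eq = pairView (∈-tuples⁻ (d ∷ d ∷ []) (subst (λ ds → u ∈ tuples ds) (outs-diagonal {x = x} c j x-bound j-bound) u∈)) in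
      subst (λ u → marginal model mixture (diagonalContext d x c j) u ℚ.≤ diagonal d u) (sym eq) (respected i k)
      where
      respected : ∀ i k → marginal model mixture (diagonalContext d x c j) (toℕ i ∷ toℕ k ∷ []) ℚ.≤ diagonal d (toℕ i ∷ toℕ k ∷ [])
      respected i k = subst₂ ℚ._≤_
        (sym (trans (mixture-marginal (diagonalContext d x c j) u) (𝔼-cong D λ a → trans
          (cong₂ (λ m n → 𝟙 (does ((m ∷ n ∷ []) ≟ u))) (x-value a) (trans (extension-copy a c j) (j-value a)))
          (indicator₂ (toℕ (v a)) (toℕ (v a)) (toℕ i) (toℕ k)))))
        (sym (diagonal-δ q ϑ i k))
        (law i k)
        where u = toℕ i ∷ toℕ k ∷ []

    feasible : Feasible model mixture
    feasible = All.universal (mixture-nonneg D≥0) (globalAssignments model) ,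
      All.concat⁺ (All.map⁺ (All.universal (λ c →
        copies-respected c ∷
        diagonal-respected (gate (At.x₁ c)) c j₁ (λ a → proj₁ a (At.x₁ c)) (outs-gate (At.x₁ c)) refl
          (λ a → extension-gate a (At.x₁ c)) (λ a → refl) (gateLaw (At.x₁ c)) ∷
        diagonal-respected (gate (At.x₂ c)) c j₂ (λ a → proj₁ a (At.x₂ c)) (outs-gate (At.x₂ c)) refl
          (λ a → extension-gate a (At.x₂ c)) (λ a → refl) (gateLaw (At.x₂ c)) ∷
        diagonal-respected (colour (At.x₃ c)) c j₃ (λ a → proj₂ a (At.x₃ c)) (outs-colour (At.x₃ c)) refl
          (λ a → extension-colour a (At.x₃ c)) (λ a → refl) (colourLaw (At.x₃ c)) ∷
        diagonal-respected (colour (At.x₄ c)) c j₄ (λ a → proj₂ a (At.x₄ c)) (outs-colour (At.x₄ c)) refl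
          (λ a → extension-colour a (At.x₄ c)) (λ a → refl) (colourLaw (At.x₄ c)) ∷ [])
        (List.allFin #constraints)))

  1-ϑ≥0 : 0ℚ ℚ.≤ 1ℚ ℚ.- ϑ
  1-ϑ≥0 = subst (ℚ._≤ 1ℚ ℚ.- ϑ) (ℚ.+-inverseʳ ϑ) (ℚ.+-monoˡ-≤ (ℚ.- ϑ) ϑ≤1)

  δ-nonneg : ∀ {n} (x y : Fin n) → 0ℚ ℚ.≤ δ x y
  δ-nonneg x y with toℕ x ≡ᵇ toℕ y
  ... | true  = ℚ.nonNegative⁻¹ 1ℚ
  ... | false = ℚ.≤-refl

  1-δ-nonneg : ∀ {n} (x y : Fin n) → 0ℚ ℚ.≤ 1ℚ ℚ.- δ x y
  1-δ-nonneg x y with toℕ x ≡ᵇ toℕ y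
  ... | true  = ℚ.≤-refl
  ... | false = ℚ.nonNegative⁻¹ 1ℚ

  ϑ*≤ : ∀ {x} → 0ℚ ℚ.≤ x → ϑ ℚ.* x ℚ.≤ x
  ϑ*≤ {x} x≥0 = subst (ϑ ℚ.* x ℚ.≤_) (ℚ.*-identityˡ x) (ℚ.*-monoʳ-≤-nonNeg x {{ℚ.nonNegative x≥0}} ϑ≤1)

  partial : Dist Assignment
  partial = scale ϑ aligned

  full : (Fin vertices → Fin q) → Dist Assignment
  full f = partial List.++ scale (1ℚ ℚ.- ϑ) (opposed f)

  𝔼-full : ∀ f Φ → 𝔼 (full f) Φ ≡ ϑ ℚ.* 𝔼 aligned Φ ℚ.+ (1ℚ ℚ.- ϑ) ℚ.* 𝔼 (opposed f) Φ
  𝔼-full f Φ = trans (𝔼-++ partial (scale (1ℚ ℚ.- ϑ) (opposed f)) Φ) (cong₂ ℚ._+_ (𝔼-scale ϑ aligned Φ) (𝔼-scale (1ℚ ℚ.- ϑ) (opposed f) Φ))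

  convex : ∀ x → ϑ ℚ.* x ℚ.+ (1ℚ ℚ.- ϑ) ℚ.* x ≡ x
  convex = solve 2 (λ t x → t :* x :+ (con 1ℚ :- t) :* x := x) refl ϑ
    where open +-*-Solver

  -- Leaving out the opposed part only underfills the tables, which the inequalities defining NCF
  -- allow.
  module Partial = Feasibility partial (scale-nonneg 0≤ϑ aligned-nonneg)
    (λ c r z a b → subst₂ ℚ._≤_
      (trans (ℚ.+-identityʳ _) (sym (trans (𝔼-scale ϑ aligned _) (cong (ϑ ℚ.*_) (aligned-scope (x₃≢x₄ c) r z a b)))))
      (sym (μ̂-δ q ϑ r z a b))
      -- The aligned summand of `μ̂` is matched exactly, and 0 is compared with the nonnegative
      -- opposed summand.
      (ℚ.+-monoʳ-≤ (ϑ ℚ.* (recip 2 ℚ.* (recip q ℚ.* recip q) ℚ.* δ r z))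
        (*-nonneg 1-ϑ≥0 (*-nonneg (*-nonneg (recip-nonneg 2) (*-nonneg (recip-nonneg q) (recip-nonneg (q ∸ 1))))
                                  (*-nonneg (1-δ-nonneg r z) (1-δ-nonneg a b))))))
    (λ x a b → subst (ℚ._≤ recip 2 ℚ.* δ a b) (sym (trans (𝔼-scale ϑ aligned _) (cong (ϑ ℚ.*_) (aligned-gate x a b))))
      (ϑ*≤ (*-nonneg (recip-nonneg 2) (δ-nonneg a b))))
    (λ x a b → subst (ℚ._≤ recip q ℚ.* δ a b) (sym (trans (𝔼-scale ϑ aligned _) (cong (ϑ ℚ.*_) (aligned-colour x a b))))
      (ϑ*≤ (*-nonneg (recip-nonneg q) (δ-nonneg a b))))

  partial-weight : weight model Partial.mixture ≡ ϑ
  partial-weight = trans Partial.mixture-weight (trans (𝔼-scale ϑ aligned (λ _ → 1ℚ))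
    (trans (cong (ϑ ℚ.*_) (aligned-total 1ℚ)) (ℚ.*-identityʳ ϑ)))

  module _ (f : Fin vertices → Fin q) (proper : Proper f) where
    -- Every inequality is now an equality: the mixture reproduces all the tables.
    module Full = Feasibility (full f)
      (All.++⁺ (scale-nonneg 0≤ϑ aligned-nonneg) (scale-nonneg 1-ϑ≥0 (opposed-nonneg f)))
      (λ c r z a b → ℚ.≤-reflexive (trans (𝔼-full f _) (trans
        (cong₂ (λ x y → ϑ ℚ.* x ℚ.+ (1ℚ ℚ.- ϑ) ℚ.* y)
          (aligned-scope (x₃≢x₄ c) r z a b)
          (opposed-scope (x₁-scopes c) (x₂-scopes c) f (proper c) r z a b))
        (sym (μ̂-δ q ϑ r z a b)))))
      (λ x a b → ℚ.≤-reflexive (trans (𝔼-full f _) (trans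
        (cong₂ (λ y z → ϑ ℚ.* y ℚ.+ (1ℚ ℚ.- ϑ) ℚ.* z) (aligned-gate x a b) (opposed-gate f x a b)) (convex (recip 2 ℚ.* δ a b)))))
      (λ x a b → ℚ.≤-reflexive (trans (𝔼-full f _) (trans
        (cong₂ (λ y z → ϑ ℚ.* y ℚ.+ (1ℚ ℚ.- ϑ) ℚ.* z) (aligned-colour x a b) (opposed-colour f x a b)) (convex (recip q ℚ.* δ a b)))))

    full-weight : weight model Full.mixture ≡ 1ℚ
    full-weight = trans Full.mixture-weight (trans (𝔼-full f (λ _ → 1ℚ))
      (trans (cong₂ (λ y z → ϑ ℚ.* y ℚ.+ (1ℚ ℚ.- ϑ) ℚ.* z) (aligned-total 1ℚ) (opposed-total f 1ℚ)) (convex 1ℚ)))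

  c₀ : Fin #constraints
  c₀ = some-constraint

  -- A gate context is used since its table is a closed 2 by 2 one, whatever q is, and its sum
  -- evaluates to 1.
  weight≤1 : ∀ b → Feasible model b → weight model b ℚ.≤ 1ℚ
  weight≤1 b feasible = ℚ.≤-trans
    (weight≤ feasible {diagonalContext 2 (gate (At.x₁ c₀)) c₀ j₁} (diagonal 2) (marginal≤table feasible (contextOf∈ c₀ (there (here refl)))))
    (ℚ.≤-reflexive (cong (λ ds → ∑ (diagonal 2) (tuples ds)) (outs-diagonal {x = gate (At.x₁ c₀)} c₀ j₁ (outs-gate (At.x₁ c₀)) refl)))

  module _ (uncolourable : ¬ Σ (Fin vertices → Fin q) Proper) {b} (feasible : Feasible model b) where

    module _ {g} (g∈ : g ∈ globalAssignments model) (b>0 : 0ℚ ℚ.< b g) where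

      table-positive : ∀ c {C} → C ∈ contextsOf c → 0ℚ ℚ.< Context.table C (restrict model g C)
      table-positive c C∈ = ℚ.<-≤-trans b>0 (b≤table feasible (contextOf∈ c C∈) g∈)

      value : ∀ i → ℕ
      value i = Vec.lookup g i

      value<q : ∀ x → value (colour x) < q
      value<q x = subst (value (colour x) <_) (outs-colour x) (Pointwise.lookup (∈-tuples⁻ outs g∈) (colour x))

      gate₁ : ∀ c → value (gate zero) ≡ value (copy c j₁)
      gate₁ c = trans (cong (value ∘ gate) (sym (x₁-scopes c))) (diagonal-positive q ϑ {2} (table-positive c (there (here refl))))

      gate₂ : ∀ c → value (gate (suc zero)) ≡ value (copy c j₂)
      gate₂ c = trans (cong (value ∘ gate) (sym (x₂-scopes c))) (diagonal-positive q ϑ {2} (table-positive c (there (there (here refl)))))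

      -- All copies of gates go back to the same two central gates, so if they differ at `c₀` they
      -- differ at every constraint. The positive entries of `μ̂` then make the central colours of g
      -- differ along every edge.
      gates-agree : value (copy c₀ j₂) ≢ value (copy c₀ j₁) → ⊥
      gates-agree differ = uncolourable (f , λ c eq → μ̂-positive q ϑ (table-positive c (here refl))
        (λ same → differ (trans (sym (gate₂ c₀)) (trans (gate₂ c) (trans same (trans (sym (gate₁ c)) (gate₁ c₀))))))
        (trans (sym (diagonal-positive q ϑ {q} (table-positive c (there (there (there (here refl)))))))
        (trans (trans (sym (toℕ-f (At.x₃ c))) (trans (cong toℕ eq) (toℕ-f (At.x₄ c))))
               (diagonal-positive q ϑ {q} (table-positive c (there (there (there (there (here refl))))))))))
        where
        f : Fin vertices → Fin q
        f x = fromℕ< (value<q x)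
        toℕ-f : ∀ x → toℕ (f x) ≡ value (colour x)
        toℕ-f x = Fin.toℕ-fromℕ< (value<q x)

    κ : ℚ
    κ = ϑ ℚ.* recip (2 * q ^ 2)

    -- At equal gates the table itself is the bound. At unequal gates the marginal is a sum of
    -- weights none of which can be positive.
    marginal≤alignedTable : ∀ {u} → u ∈ localOutcomes model (copyContext c₀) → marginal model b (copyContext c₀) u ℚ.≤ alignedTable κ u
    marginal≤alignedTable {r ∷ z ∷ x ∷ y ∷ []} u∈ = below-if (z ≡ᵇ r) (marginal≤table feasible (contextOf∈ c₀ (here refl)) u∈) λ z≢r →
      subst (marginal model b (copyContext c₀) u ℚ.≤_) (∑-zero matching) (∑-mono matching (nonpositive (≡ᵇ-false z≢r)))
      where
      u = r ∷ z ∷ x ∷ y ∷ []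
      P? = λ g → restrict model g (copyContext c₀) ≟ u
      matching = List.filter P? (globalAssignments model)
      nonpositive : z ≢ r → ∀ {g} → g ∈ matching → b g ℚ.≤ 0ℚ
      nonpositive z≢r {g} g∈ = let g∈′ , restricted = ∈.∈-filter⁻ P? {xs = globalAssignments model} g∈ in
        ℚ.≮⇒≥ λ b>0 → gates-agree g∈′ b>0 λ same → z≢r
          (trans (sym (cong (λ v → Vec.lookup v j₂) restricted)) (trans same (cong (λ v → Vec.lookup v j₁) restricted)))

    weight≤ϑ : weight model b ℚ.≤ ϑ
    weight≤ϑ = ℚ.≤-trans (weight≤ feasible {copyContext c₀} (alignedTable κ) marginal≤alignedTable)
      (ℚ.≤-reflexive (trans (cong (λ ds → ∑ (alignedTable κ) (tuples ds)) (outs-copies c₀)) (∑-alignedTable-ϑ q ϑ)))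

  ncf-colourable : Σ (Fin vertices → Fin q) Proper → NCF model 1ℚ
  ncf-colourable (f , proper) = (Full.mixture f proper , Full.feasible f proper , full-weight f proper) , weight≤1

  ncf-uncolourable : ¬ Σ (Fin vertices → Fin q) Proper → NCF model ϑ
  ncf-uncolourable uncolourable = (Partial.mixture , Partial.feasible , partial-weight) , λ b → weight≤ϑ uncolourable

-- Reading off the decision

-- The machine cannot multiply, but the factor comes from a fixed threshold, so a fixed number of
-- additions does it.
times : ℕ → Data → Data
times zero    x = nat 0
times (suc k) x = applyPrim add (pair x (times k x))

times-nat : ∀ k a → times k (nat a) ≡ nat (k * a)
times-nat zero    a = refl
times-nat (suc k) a = cong (λ y → applyPrim add (pair (nat a) y)) (times-nat k a)

polyTime-times : ∀ k {f} → PolyTime f → PolyTime (λ x → times k (f x))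
polyTime-times zero    P = polyTime-const (nat 0)
polyTime-times (suc k) P = polyTime-add P (polyTime-times k P)

-- The test τ < r for τ ≥ 0 on the encoding of r. A set sign flag means that r is negative and gives
-- 0; otherwise the cross-multiplied truncated difference is positive exactly when r is larger.
exceeds : ℚ → Data → Data
exceeds τ y = if-data (applyPrim first (applyPrim first y)) (nat 0)
  (if-data (applyPrim sub (pair (times (ℚ.↧ₙ τ) (applyPrim second (applyPrim first y)))
                                (times ℤ.∣ ℚ.↥ τ ∣ (applyPrim second y))))
           (nat 1) (nat 0))

polyTime-exceeds : ∀ τ → PolyTime (exceeds τ)
polyTime-exceeds τ = polyTime-if (polyTime-first (polyTime-first polyTime-id)) (polyTime-const (nat 0))
  (polyTime-if (polyTime-sub (polyTime-times (ℚ.↧ₙ τ) (polyTime-second (polyTime-first polyTime-id)))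
                             (polyTime-times ℤ.∣ ℚ.↥ τ ∣ (polyTime-second polyTime-id)))
               (polyTime-const (nat 1)) (polyTime-const (nat 0)))

if-positive : ∀ {m} y z → 0 < m → if-data (nat m) y z ≡ y
if-positive y z (s≤s _) = refl

<-numerators : ∀ a b m n → ℤ.+ a ℤ.* ℤ.+ m ℤ.< ℤ.+ b ℤ.* ℤ.+ n → a * m < b * n
<-numerators a b m n lt = ℤ.drop‿+<+ (subst₂ ℤ._<_ (sym (ℤ.pos-* a m)) (sym (ℤ.pos-* b n)) lt)

exceeds-nonneg : ∀ n t a d .(p : Coprime n (suc t)) .(c : Coprime a (suc d)) →
  exceeds (mkℚ (ℤ.+ n) t p) (encodeℚ (mkℚ (ℤ.+ a) d c)) ≡ if-data (nat (suc t * a ∸ n * suc d)) (nat 1) (nat 0)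
exceeds-nonneg n t a d p c = cong₂ (λ x y → if-data (applyPrim sub (pair x y)) (nat 1) (nat 0))
  (times-nat (suc t) a) (times-nat n (suc d))

exceeds-above : ∀ τ r → 0ℚ ℚ.≤ τ → τ ℚ.< r → exceeds τ (encodeℚ r) ≡ nat 1
exceeds-above (mkℚ ℤ.-[1+ _ ] _ _)  r                        (ℚ.*≤* ())
exceeds-above τ                     r@(mkℚ ℤ.-[1+ _ ] _ _)   0≤τ τ<r =
  ⊥-elim (ℚ.<-irrefl refl (ℚ.<-trans (ℚ.≤-<-trans 0≤τ τ<r) (ℚ.negative⁻¹ r)))
exceeds-above τ@(mkℚ (ℤ.+ n) t p) r@(mkℚ (ℤ.+ a) d c) 0≤τ τ<r = trans (exceeds-nonneg n t a d p c)
  (if-positive (nat 1) (nat 0) (ℕ.m<n⇒0<n∸m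
    (subst (n * suc d <_) (ℕ.*-comm a (suc t)) (<-numerators n a (suc d) (suc t) (ℚ.drop-*<* τ<r)))))

exceeds-below : ∀ τ r → 0ℚ ℚ.≤ τ → r ℚ.< τ → exceeds τ (encodeℚ r) ≡ nat 0
exceeds-below (mkℚ ℤ.-[1+ _ ] _ _)  r                        (ℚ.*≤* ())
exceeds-below τ                     r@(mkℚ ℤ.-[1+ _ ] _ _)   0≤τ r<τ = refl
exceeds-below τ@(mkℚ (ℤ.+ n) t p) r@(mkℚ (ℤ.+ a) d c) 0≤τ r<τ = trans (exceeds-nonneg n t a d p c)
  (cong (λ m → if-data (nat m) (nat 1) (nat 0)) (ℕ.m≤n⇒m∸n≡0
    (subst (_≤ n * suc d) (ℕ.*-comm a (suc t)) (ℕ.<⇒≤ (<-numerators a n (suc t) (suc d) (ℚ.drop-*<* r<τ))))))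

flip : Data → Data
flip y = applyPrim sub (pair (nat 1) y)

≤-abs : ∀ x → x ℚ.≤ ℚ.∣ x ∣
≤-abs x with ℚ.≤-total 0ℚ x
... | inj₁ 0≤x = ℚ.≤-reflexive (sym (ℚ.0≤p⇒∣p∣≡p 0≤x))
... | inj₂ x≤0 = ℚ.≤-trans x≤0 (ℚ.0≤∣p∣ x)

module _ {r v ε h : ℚ} (near : ℚ.∣ r ℚ.- v ∣ ℚ.≤ ε) (ε<h : ε ℚ.< h) where
  open +-*-Solver

  near-above : v ℚ.- h ℚ.< r
  near-above = subst₂ ℚ._<_
    (solve 3 (λ r v h → v :- r :+ (r :- h) := v :- h) refl r v h)
    (solve 2 (λ r h → h :+ (r :- h) := r) refl r h)
    (ℚ.+-monoˡ-< (r ℚ.- h) (ℚ.≤-<-trans (ℚ.≤-trans (≤-abs (v ℚ.- r))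
      (subst (ℚ._≤ ε) (trans (sym (ℚ.∣-p∣≡∣p∣ (r ℚ.- v)))
        (cong ℚ.∣_∣ (solve 2 (λ r v → :- (r :- v) := v :- r) refl r v))) near)) ε<h))

  near-below : r ℚ.< v ℚ.+ h
  near-below = subst₂ ℚ._<_
    (solve 2 (λ r v → r :- v :+ v := r) refl r v)
    (ℚ.+-comm h v)
    (ℚ.+-monoˡ-< v (ℚ.≤-<-trans (ℚ.≤-trans (≤-abs (r ℚ.- v)) near) ε<h))

-- One query, on the reduced instance, is enough, as every acceptable answer settles the promise.
-- Answers of polynomial length keep both the query and the test on its answer polynomial.
decide-by-search : ∀ {P : PromiseProblem} {Acceptable : PromiseProblem.Inst P → Data → Set} {decide : Data → Data} →
  let open PromiseProblem P in PolyTime decide →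
  (∀ {i y} → Acceptable i y → Yes i → decide y ≡ nat 1) →
  (∀ {i y} → Acceptable i y → No i → decide y ≡ nat 0) →
  NPHard P → NPHardSearch (record { Inst = Inst ; encode = encode ; Acceptable = Acceptable })
decide-by-search {P} {Acceptable} {decide} (d , halts-decide) on-yes on-no hard L L∈NP with hard L L∈NP
... | f , (p , halts-f) , reduces = ((embed p then query tt) then embed d) , λ O solves bounded →
  decide ∘ O ∘ f ,
  halts-then {p = embed p then query tt} {f = O ∘ f} {g = decide}
    (halts-then {f = f} {g = O} (halts-embed {f = f} halts-f) (halts-query tt bounded)) (halts-embed {f = decide} halts-decide) ,
  λ x → let i , fx≡ , L⇒Yes , ¬L⇒No = reduces x
            accepted = subst (Acceptable i ∘ O) (sym fx≡) (solves i) in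
    (λ l → on-yes accepted (L⇒Yes l)) , (λ ¬l → on-no accepted (¬L⇒No ¬l))

distinguish-NPHard : ∀ p ϑ → 0ℚ ℚ.≤ ϑ → ϑ ℚ.≤ 1ℚ →
  NPHard (Colourability (2 + p)) → NPHard (DistinguishNCF (2 + p) ϑ (λ _ → ⊤))
distinguish-NPHard p ϑ 0≤ϑ ϑ≤1 hard L L∈NP = let f , polyTime-f , reduces = hard L L∈NP in
  reduction ∘ f , polyTime-then polyTime-f polyTime-reduction , λ x →
    let G , fx≡ , L⇒Yes , ¬L⇒No = reduces x
        open Gadget G
        open Values (2 + p) ϑ 0≤ϑ ϑ≤1 G in
    (instance-of , tt) , trans (cong reduction fx≡) (reduction-correct G) ,
    (λ l → ncf-colourable (proper-extension (L⇒Yes l))) ,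
    (λ ¬l → ncf-uncolourable (¬L⇒No ¬l ∘ proper-restriction))
  where open Reduction (2 + p) ϑ

module _ (q : ℕ) (ϑ : ℚ) (0≤ϑ : 0ℚ ℚ.≤ ϑ) (ϑ≤1 : ϑ ℚ.≤ 1ℚ) {F : Instance → Set}
         (hard : NPHard (DistinguishNCF q ϑ F)) {ε : ℚ} where
  open +-*-Solver

  -- `midpoint` lies halfway between the NCF values ϑ and 1, at distance `gap` from each. The CF
  -- values are 1 - ϑ and 0, and halfway between them lies `gap` itself.
  gap midpoint : ℚ
  gap      = (1ℚ ℚ.- ϑ) ℚ.* ½
  midpoint = (1ℚ ℚ.+ ϑ) ℚ.* ½

  0≤gap : 0ℚ ℚ.≤ gap
  0≤gap = ℚ.*-monoʳ-≤-nonNeg ½ (subst (ℚ._≤ 1ℚ ℚ.- ϑ) (ℚ.+-inverseʳ ϑ) (ℚ.+-monoˡ-≤ (ℚ.- ϑ) ϑ≤1))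

  0≤midpoint : 0ℚ ℚ.≤ midpoint
  0≤midpoint = ℚ.*-monoʳ-≤-nonNeg ½ (ℚ.+-mono-≤ (ℚ.nonNegative⁻¹ 1ℚ) 0≤ϑ)

  approximate-NCF : ε ℚ.< gap → NPHardSearch (Approximate NCF ε q ϑ F)
  approximate-NCF ε<gap = decide-by-search {DistinguishNCF q ϑ F} {SearchProblem.Acceptable (Approximate NCF ε q ϑ F)}
    (polyTime-exceeds midpoint)
    (λ { (r , refl , near) ncf → exceeds-above midpoint r 0≤midpoint
           (subst (ℚ._< r) (solve 1 (λ t → con 1ℚ :- (con 1ℚ :- t) :* con ½ := (con 1ℚ :+ t) :* con ½) refl ϑ)
                  (near-above {v = 1ℚ} (near 1ℚ ncf) ε<gap)) })
    (λ { (r , refl , near) ncf → exceeds-below midpoint r 0≤midpoint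
           (subst (r ℚ.<_) (solve 1 (λ t → t :+ (con 1ℚ :- t) :* con ½ := (con 1ℚ :+ t) :* con ½) refl ϑ)
                  (near-below {v = ϑ} (near ϑ ncf) ε<gap)) })
    hard

  approximate-CF : ε ℚ.< gap → NPHardSearch (Approximate CF ε q ϑ F)
  approximate-CF ε<gap = decide-by-search {DistinguishNCF q ϑ F} {SearchProblem.Acceptable (Approximate CF ε q ϑ F)}
    -- Yes-instances have CF 0, the smaller value, so the outcome of the comparison is negated.
    (polyTime-sub (polyTime-const (nat 1)) (polyTime-exceeds gap))
    (λ { (r , refl , near) ncf → cong flip (exceeds-below gap r 0≤gap
           (subst (r ℚ.<_) (ℚ.+-identityˡ gap) (near-below {v = 0ℚ} (near 0ℚ (1ℚ , ncf , refl)) ε<gap))) })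
    (λ { (r , refl , near) ncf → cong flip (exceeds-above gap r 0≤gap
           (subst (ℚ._< r) (solve 1 (λ t → con 1ℚ :- t :- (con 1ℚ :- t) :* con ½ := (con 1ℚ :- t) :* con ½) refl ϑ)
                  (near-above {v = 1ℚ ℚ.- ϑ} (near (1ℚ ℚ.- ϑ) (ϑ , ncf , refl)) ε<gap))) })
    hard

theorem7p5 : (q : ℕ) → 3 ≤ q → NPComplete (Colourability q) →
    (ϑ : ℚ) → 0ℚ ℚ.< ϑ → ϑ ℚ.< 1ℚ →
    ∃[ F ] ( AlwaysSatisfiable q F
    × NPHard (DistinguishNCF q ϑ F)
    × (∀ (ε : ℚ) → ε ℚ.< (1ℚ ℚ.- ϑ) ℚ.* ½ →
    NPHardSearch (Approximate NCF ε q ϑ F)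
    × NPHardSearch (Approximate CF ε q ϑ F)))
theorem7p5 q@(suc (suc p)) (s≤s (s≤s _)) (_ , hard) ϑ 0<ϑ ϑ<1 =
  -- The family consists of all instances: giving every gate the same value satisfies each
  -- constraint by its first alternative.
  (λ _ → ⊤) , (λ I _ → (λ _ → zero) , (λ _ → zero) , λ c → inj₁ refl) , distinguish ,
  λ ε ε<gap → approximate-NCF q ϑ (ℚ.<⇒≤ 0<ϑ) (ℚ.<⇒≤ ϑ<1) distinguish ε<gap ,
              approximate-CF q ϑ (ℚ.<⇒≤ 0<ϑ) (ℚ.<⇒≤ ϑ<1) distinguish ε<gap
  where
  distinguish : NPHard (DistinguishNCF q ϑ (λ _ → ⊤))
  distinguish = distinguish-NPHard p ϑ (ℚ.<⇒≤ 0<ϑ) (ℚ.<⇒≤ ϑ<1) hard
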